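{- Let $\bar x:[0,\infty)\to(0,1]$ be the solution of $\bar x'(t)=-\bar x^2(t)-(1-\bar x^2(t))\bar x(t)$, $\bar x(0)=1$, and consider the system $$\bar s_2'=\bar x^2+(1-\bar x^2)\bar s_2^2,\qquad \bar s_3'=3\bar x^2+3(1-\bar x^2)\bar s_2\bar s_3,\qquad \bar s_4'=7\bar x^2+(1-\bar x^2)\bigl(4\bar s_2\bar s_4+3\bar s_3^2\bigr),$$ with $\bar s_2(0)=\bar s_3(0)=\bar s_4(0)=1$. Let $t_c\in(0,\infty)$ be the explosion time of $\bar s_2$, i.e. $\bar s_2$ is defined on $[0,t_c)$ and $\bar s_2(t)\to+\infty$ as $t\uparrow t_c$. Then $\bar s_2,\bar s_3,\bar s_4$ are uniquely defined on $[0,t_c)$, and as $t\uparrow t_c$ there exist positive constants $\alpha,\beta$ such that $$\bar s_2(t)\sim\frac{\alpha}{t_c-t},\qquad \bar s_3(t)\sim\beta\,\bar s_2(t)^3\sim\frac{\beta\alpha^3}{(t_c-t)^3},\qquad \bar s_4(t)\sim 3\beta^2\bar s_2(t)^5\sim\frac{3\beta^2\alpha^5}{(t_c-t)^5}.$$ More precisely, $\bar s_k(t)=\gamma_k(t_c-t)^{ -(2k-3)}\bigl(1+O(t_c-t)\bigr)$ for $k=2,3,4$, with $\gamma_2=\alpha$, $\gamma_3=\beta\alpha^3$, $\gamma_4=3\beta^2\alpha^5$. Here $\alpha=(1-\bar x^2(t_c))^{ -1}$ and $\beta=g(t_c)$, where $g$ is defined as follows: let $f$ be the solution of $f'=-\bar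 x^2 f^2-(1-\bar x^2)$, $f(0)=1$ (so that $f=1/\bar s_2$ on $[0,t_c)$ and $f(t_c)=0$), and let $g$ be the solution of $g'=3\bar x^2 f^3-3\bar x^2 f g$, $g(0)=1$, i.e. $g(t)=e^{ -G(t)}+3e^{ -G(t)}\int_0^t e^{G(u)}\bar x^2(u)f^3(u)\,du$ with $G(t)=3\int_0^t\bar x^2(u)f(u)\,du$.
   Context: It is known (and used as part of the setting) that $\bar x$ exists and is positive for all $t\ge0$ and that $\bar s_2$ explodes at a finite time $t_c>0$. The notation $a(t)\sim b(t)$ means $a(t)/b(t)\to1$. -}

module Defs where

open import Level using (0ℓ)
open import Algebra.Bundles using (CommutativeRing)
open import Data.Nat.Base as ℕ using (ℕ; zero; suc; _!)
open import Data.Product.Base using (Σ; ∃; _×_; _,_)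
open import Data.Unit.Base using (⊤)
open import Relation.Binary.Core using (Rel)
open import Relation.Binary.Bundles using (TotalOrder)
open import Relation.Binary.Structures using (IsTotalOrder)
open import Relation.Nullary.Negation.Core using (¬_)
open import Relation.Unary using (Pred)
import Algebra.Construct.NaturalChoice.Max as Max
import Algebra.Properties.Semiring.Exp as Exp
import Algebra.Properties.Semiring.Mult as Mult
import Relation.Binary.Construct.NonStrictToStrict as ToStrict

-- The real numbers, given by their textbook axioms (an ordered field with the
-- least-upper-bound property), which determine them up to isomorphism.
-- Equality is a setoid equality because quotient types are not available.

record CompleteOrderedField : Set₁ where
  infix 4 _≤_
  infix 9 _⁻¹
  field
    commutativeRing : CommutativeRing 0ℓ 0ℓ

  open CommutativeRing commutativeRing public

  field
    _≤_          : Rel Carrier 0ℓ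
    isTotalOrder : IsTotalOrder _≈_ _≤_
    +-monoˡ-≤    : ∀ z {x y} → x ≤ y → x + z ≤ y + z
    *-nonNeg     : ∀ {x y} → 0# ≤ x → 0# ≤ y → 0# ≤ x * y
    0≉1          : ¬ (0# ≈ 1#)

    -- The inverse is total with the convention 0⁻¹ = 0.
    _⁻¹          : Carrier → Carrier
    *-inverseʳ   : ∀ {x} → ¬ (x ≈ 0#) → x * x ⁻¹ ≈ 1#
    0⁻¹≈0        : ∀ {x} → x ≈ 0# → x ⁻¹ ≈ 0#

  UpperBound : Pred Carrier 0ℓ → Pred Carrier 0ℓ
  UpperBound P b = ∀ x → P x → x ≤ b

  field
    supremum : (P : Pred Carrier 0ℓ) → ∃ P → ∃ (UpperBound P) →
               Σ Carrier λ s → UpperBound P s × (∀ b → UpperBound P b → s ≤ b)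

  totalOrder : TotalOrder 0ℓ 0ℓ 0ℓ
  totalOrder = record { isTotalOrder = isTotalOrder }

module Analysis (R : CompleteOrderedField) where

  open CompleteOrderedField R public

  open ToStrict _≈_ _≤_ public using (_<_)
  open Exp semiring public using (_^_)
  open Mult semiring using () renaming (_×_ to _·_)
  open Max totalOrder public using (_⊔_)

  fromℕ : ℕ → Carrier
  fromℕ n = n · 1#

  ∣_∣ : Carrier → Carrier
  ∣ x ∣ = x ⊔ (- x)

  [0,∞⟩ : Pred Carrier 0ℓ
  [0,∞⟩ t = 0# ≤ t

  [0,_⟩ : Carrier → Pred Carrier 0ℓ
  [0, b ⟩ t = 0# ≤ t × t < b

  [0,_] : Carrier → Pred Carrier 0ℓ
  [0, b ] t = 0# ≤ t × t ≤ b

  -- A function on a domain D is a function on the whole carrier of which only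
  -- the values on D matter.

  EqualOn : Pred Carrier 0ℓ → Rel (Carrier → Carrier) 0ℓ
  EqualOn D h k = ∀ t → D t → h t ≈ k t

  -- d is the derivative of h at a relative to D (one-sided at an endpoint of D):
  -- h y = h a + d (y - a) + o(y - a) as y → a in D.
  -- With y ≈ a this also forces h to respect _≈_ on D.
  HasDerivative : Pred Carrier 0ℓ → (Carrier → Carrier) → Carrier → Carrier → Set
  HasDerivative D h d a =
    ∀ ε → 0# < ε → Σ Carrier λ δ → 0# < δ ×
      (∀ y → D y → ∣ y - a ∣ < δ →
        ∣ (h y - h a) - d * (y - a) ∣ ≤ ε * ∣ y - a ∣)

  -- y(0) = y₀ and y′ = rhs on D.
  IVP : Pred Carrier 0ℓ → Carrier → (y rhs : Carrier → Carrier) → Set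
  IVP D y₀ y rhs = y 0# ≈ y₀ × (∀ t → D t → HasDerivative D y (rhs t) t)

  -- y is, up to equality on D, the only function satisfying P.
  IsTheOn : Pred Carrier 0ℓ → Pred (Carrier → Carrier) 0ℓ → Pred (Carrier → Carrier) 0ℓ
  IsTheOn D P y = P y × (∀ z → P z → EqualOn D z y)

  -- "For all t < b sufficiently close to b", for functions living on [0, b).
  EventuallyBelow : Carrier → Pred Carrier 0ℓ → Set
  EventuallyBelow b P =
    Σ Carrier λ δ → 0# < δ × (∀ t → [0, b ⟩ t → b - t < δ → P t)

  TendsTo : Carrier → (Carrier → Carrier) → Carrier → Set
  TendsTo b h l = ∀ ε → 0# < ε → EventuallyBelow b (λ t → ∣ h t - l ∣ < ε)

  TendsTo+∞ : Carrier → (Carrier → Carrier) → Set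
  TendsTo+∞ b h = ∀ M → EventuallyBelow b (λ t → M < h t)

  -- a(t) ∼ c(t) as t ↑ b.  As 0⁻¹ = 0, a limit 1 of the quotient
  -- forces c(t) ≠ 0 for t near b.
  Asymptotic : Carrier → Rel (Carrier → Carrier) 0ℓ
  Asymptotic b a c = TendsTo b (λ t → a t * c t ⁻¹) 1#

  -- γ (b - t)⁻ᵖ
  pole : Carrier → Carrier → ℕ → Carrier → Carrier
  pole b γ p t = γ * ((b - t) ^ p) ⁻¹

  -- h(t) = γ (b - t)⁻ᵖ (1 + O(b - t)) as t ↑ b.
  PowerLaw : Carrier → ℕ → Carrier → (Carrier → Carrier) → Set
  PowerLaw b p γ h =
    Σ (Carrier → Carrier) λ r → Σ Carrier λ C → EventuallyBelow b λ t →
      h t ≈ pole b γ p t * (1# + r t) × ∣ r t ∣ ≤ C * (b - t)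

  expSum : ℕ → Carrier → Carrier
  expSum zero    x = 0#
  expSum (suc n) x = expSum n x + x ^ n * fromℕ (n !) ⁻¹

  IsExp : (Carrier → Carrier) → Set
  IsExp exp = ∀ x ε → 0# < ε → Σ ℕ λ N → ∀ n → N ℕ.≤ n → ∣ expSum n x - exp x ∣ < ε

  -- Tagged partitions of [a, b]: each step is a subinterval [a, c] with tag ξ.
  data TaggedPartition (b : Carrier) : Carrier → Set where
    stop : ∀ {a} → a ≈ b → TaggedPartition b a
    step : ∀ {a} ξ c → a ≤ ξ → ξ ≤ c → TaggedPartition b c → TaggedPartition b a

  MeshBelow : Carrier → ∀ {b a} → TaggedPartition b a → Set
  MeshBelow δ (stop _)               = ⊤
  MeshBelow δ (step {a} ξ c _ _ rest) = c - a < δ × MeshBelow δ rest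

  riemannSum : (Carrier → Carrier) → ∀ {b a} → TaggedPartition b a → Carrier
  riemannSum h (stop _)               = 0#
  riemannSum h (step {a} ξ c _ _ rest) = h ξ * (c - a) + riemannSum h rest

  -- The Riemann integral of h over [a, b] (for a ≤ b) exists and equals v.
  IsIntegral : (Carrier → Carrier) → (a b v : Carrier) → Set
  IsIntegral h a b v =
    ∀ ε → 0# < ε → Σ Carrier λ δ → 0# < δ ×
      (∀ (π : TaggedPartition b a) → MeshBelow δ π → ∣ riemannSum h π - v ∣ < ε)

  module Equations (x : Carrier → Carrier) where

    IsX : Set
    IsX = IVP [0,∞⟩ 1# x (λ t → - (x t ^ 2) - (1# - x t ^ 2) * x t)
        × (∀ t → [0,∞⟩ t → 0# < x t × x t ≤ 1#)

    IsS₂ : Pred Carrier 0ℓ → (s₂ : Carrier → Carrier) → Set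
    IsS₂ D s₂ = IVP D 1# s₂ (λ t → x t ^ 2 + (1# - x t ^ 2) * s₂ t ^ 2)

    IsS₃ : Pred Carrier 0ℓ → (s₂ s₃ : Carrier → Carrier) → Set
    IsS₃ D s₂ s₃ = IVP D 1# s₃ (λ t →
      fromℕ 3 * x t ^ 2 + fromℕ 3 * (1# - x t ^ 2) * s₂ t * s₃ t)

    IsS₄ : Pred Carrier 0ℓ → (s₂ s₃ s₄ : Carrier → Carrier) → Set
    IsS₄ D s₂ s₃ s₄ = IVP D 1# s₄ (λ t →
      fromℕ 7 * x t ^ 2
        + (1# - x t ^ 2) * (fromℕ 4 * s₂ t * s₄ t + fromℕ 3 * s₃ t ^ 2))

    IsF : Pred Carrier 0ℓ → (f : Carrier → Carrier) → Set
    IsF D f = IVP D 1# f (λ t → - (x t ^ 2 * f t ^ 2) - (1# - x t ^ 2))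

    IsG : Pred Carrier 0ℓ → (f g : Carrier → Carrier) → Set
    IsG D f g = IVP D 1# g (λ t →
      fromℕ 3 * x t ^ 2 * f t ^ 3 - fromℕ 3 * x t ^ 2 * f t * g t)

    -- g(t) = e^{-G(t)} + 3 e^{-G(t)} ∫₀ᵗ e^{G(u)} x²(u) f³(u) du on [0, b], with
    -- G(t) = 3 ∫₀ᵗ x²(u) f(u) du; I and J are the values of the two integrals.
    ExplicitFormula : Carrier → (f g : Carrier → Carrier) → Set
    ExplicitFormula b f g =
      Σ (Carrier → Carrier) λ exp → IsExp exp ×
      Σ (Carrier → Carrier) λ G → Σ (Carrier → Carrier) λ I → Σ (Carrier → Carrier) λ J →
        ∀ t → [0, b ] t →
          IsIntegral (λ u → x u ^ 2 * f u) 0# t (I t)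
        × G t ≈ fromℕ 3 * I t
        × IsIntegral (λ u → exp (G u) * x u ^ 2 * f u ^ 3) 0# t (J t)
        × g t ≈ exp (- G t) + fromℕ 3 * exp (- G t) * J t

{-# OPTIONS --safe #-}

-- With f = 1/s₂ the explosion becomes a regular zero: f extends to [0, tc] as a solution of
-- f′ = -x² f² - (1 - x²), so f(t) = (1 - x²(tc)) (tc - t) + O((tc - t)²).  The substitutions
-- s₃ = g s₂³ and s₄ = (3 g² + n f) s₂⁵ turn the remaining equations into the linear equations
--   g′ = 3 x² f³ - 3 x² f g,   n′ = 7 x² f⁴ - 18 x² f² g + 3 x² g² - 4 x² f n,   n(0) = -2,
-- which are regular on [0, tc].  Hence g and n are Lipschitz up to tc and the asymptotics
-- of s₂, s₃, s₄ are read off from that of f.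

module Submission where

open import Defs
open import Level using (0ℓ)
open import Axiom.ExcludedMiddle using (ExcludedMiddle)
open import Algebra.Bundles using (CommutativeRing)
open import Data.Empty using (⊥-elim)
open import Data.Integer.Base as ℤ using (ℤ; +_; -[1+_])
import Data.Integer.Properties as ℤ
open import Data.Maybe.Base using (Maybe; just; nothing)
open import Data.Nat.Base as ℕ using (ℕ; zero; suc; _!)
import Data.Nat.Properties as ℕ
open import Data.Product.Base using (Σ; _×_; _,_; proj₁; proj₂)
import Data.Sign.Base as Sign
open import Data.Sum.Base using (_⊎_; inj₁; inj₂)
open import Relation.Binary.Bundles using (TotalOrder)
import Relation.Binary.PropositionalEquality.Core as ≡
open import Relation.Nullary.Decidable.Core using (Dec; yes; no; decidable-stable)
open import Relation.Nullary.Negation.Core using (¬_)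
open import Relation.Unary using (Pred)
import Algebra.Construct.NaturalChoice.Max as Max
import Algebra.Properties.AbelianGroup as AbelianGroupProperties
import Algebra.Properties.Ring as RingProperties
import Algebra.Properties.Semiring.Mult as SemiringMult
import Algebra.Solver.Ring as RingSolver
import Algebra.Solver.Ring.AlmostCommutativeRing as ACR
import Relation.Binary.Construct.NonStrictToStrict as ToStrict
import Relation.Binary.Reasoning.Setoid as SetoidReasoning

-- The factor 3 and the correction `n` come from writing s₄ = m s₂⁵, which gives m′ = 7 x² f⁵ - 5 x²
-- f m + (1 - x²) (3 g² - m) / f. The last term is singular where f vanishes, which suggests that m
-- tends to 3 g². With m = 3 g² + n f the singular term becomes -(1 - x²) n and cancels against n
-- f′, and everything left is divisible by f. For s₃ = g s₂³ the terms with 1 - x² cancel at once,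
-- so no correction arises. The obstacle is the endpoint: the equation of `s₂` holds on [0, tc)
-- only, yet f must be differentiable at `tc` itself, because its slope there is what yields α.
-- Integrals and solutions therefore live on the closed interval, in the class of bounded Lipschitz
-- functions. This class is closed under sums, products, the exponential and antiderivatives, and it
-- makes every error estimate explicit. The exponential and the antiderivatives are built from the
-- least-upper-bound property.

module IntegerCoefficients {c ℓ} (R : CommutativeRing c ℓ) where
  open CommutativeRing R
  open RingProperties ring
  open AbelianGroupProperties +-abelianGroup using (⁻¹-∙-comm; ε⁻¹≈ε; ⁻¹-involutive)
  open SemiringMult semiring using (×-homo-+; ×1-homo-*) renaming (_×_ to _·_)
  open SetoidReasoning setoid

  -- Integer coefficients for the ring solver.

  ι : ℤ → Carrier
  ι (+ n)      = n · 1#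
  ι (-[1+ n ]) = - (suc n · 1#)

  ι-neg : ∀ i → ι (ℤ.- i) ≈ - ι i
  ι-neg (+ zero)   = sym ε⁻¹≈ε
  ι-neg (+ suc n)  = refl
  ι-neg (-[1+ n ]) = sym (⁻¹-involutive _)

  ι-⊖ : ∀ m n → ι (m ℤ.⊖ n) ≈ m · 1# - n · 1#
  ι-⊖ m zero = begin
    ι (m ℤ.⊖ 0)        ≡⟨ ≡.cong ι (ℤ.⊖-≥ {m} ℕ.z≤n) ⟩
    m · 1#             ≈⟨ +-identityʳ _ ⟨
    m · 1# + 0#        ≈⟨ +-congˡ ε⁻¹≈ε ⟨
    m · 1# - 0#        ∎
  ι-⊖ zero (suc n) = sym (+-identityˡ _)
  ι-⊖ (suc m) (suc n) = begin
    ι (suc m ℤ.⊖ suc n)                    ≡⟨ ≡.cong ι (ℤ.[1+m]⊖[1+n]≡m⊖n m n) ⟩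
    ι (m ℤ.⊖ n)                            ≈⟨ ι-⊖ m n ⟩
    m · 1# - n · 1#                        ≈⟨ +-congʳ (+-identityʳ _) ⟨
    (m · 1# + 0#) - n · 1#                 ≈⟨ +-congʳ (+-congˡ (-‿inverseʳ 1#)) ⟨
    (m · 1# + (1# - 1#)) - n · 1#          ≈⟨ +-congʳ (+-assoc _ _ _) ⟨
    ((m · 1# + 1#) - 1#) - n · 1#          ≈⟨ +-assoc _ _ _ ⟩
    (m · 1# + 1#) + (- 1# - n · 1#)        ≈⟨ +-cong (+-comm _ _) (⁻¹-∙-comm _ _) ⟩
    suc m · 1# - suc n · 1#                ∎

  ι-+ : ∀ i j → ι (i ℤ.+ j) ≈ ι i + ι j
  ι-+ (+ m) (+ n) = ×-homo-+ 1# m n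
  ι-+ (+ m) (-[1+ n ]) = ι-⊖ m (suc n)
  ι-+ (-[1+ m ]) (+ n) = trans (ι-⊖ n (suc m)) (+-comm _ _)
  ι-+ (-[1+ m ]) (-[1+ n ]) = begin
    - (suc (suc (m ℕ.+ n)) · 1#)           ≡⟨ ≡.cong (λ k → - (suc k · 1#)) (ℕ.+-suc m n) ⟨
    - ((suc m ℕ.+ suc n) · 1#)             ≈⟨ -‿cong (×-homo-+ 1# (suc m) (suc n)) ⟩
    - (suc m · 1# + suc n · 1#)            ≈⟨ ⁻¹-∙-comm _ _ ⟨
    - (suc m · 1#) - suc n · 1#            ∎

  ι-* : ∀ i j → ι (i ℤ.* j) ≈ ι i * ι j
  ι-* (+ m) (+ n) = begin
    ι (Sign.+ ℤ.◃ (m ℕ.* n))  ≡⟨ ≡.cong ι (ℤ.+◃n≡+n (m ℕ.* n)) ⟩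
    (m ℕ.* n) · 1#            ≈⟨ ×1-homo-* m n ⟩
    m · 1# * n · 1#           ∎
  ι-* (+ m) (-[1+ n ]) = begin
    ι (Sign.- ℤ.◃ (m ℕ.* suc n))  ≡⟨ ≡.cong ι (ℤ.-◃n≡-n (m ℕ.* suc n)) ⟩
    ι (ℤ.- (+ (m ℕ.* suc n)))     ≈⟨ ι-neg (+ (m ℕ.* suc n)) ⟩
    - ((m ℕ.* suc n) · 1#)        ≈⟨ -‿cong (×1-homo-* m (suc n)) ⟩
    - (m · 1# * suc n · 1#)       ≈⟨ -‿distribʳ-* _ _ ⟩
    m · 1# * - (suc n · 1#)       ∎
  ι-* (-[1+ m ]) (+ n) = begin
    ι (Sign.- ℤ.◃ (suc m ℕ.* n))  ≡⟨ ≡.cong ι (ℤ.-◃n≡-n (suc m ℕ.* n)) ⟩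
    ι (ℤ.- (+ (suc m ℕ.* n)))     ≈⟨ ι-neg (+ (suc m ℕ.* n)) ⟩
    - ((suc m ℕ.* n) · 1#)        ≈⟨ -‿cong (×1-homo-* (suc m) n) ⟩
    - (suc m · 1# * n · 1#)       ≈⟨ -‿distribˡ-* _ _ ⟩
    - (suc m · 1#) * n · 1#       ∎
  ι-* (-[1+ m ]) (-[1+ n ]) = begin
    (suc m ℕ.* suc n) · 1#            ≈⟨ ×1-homo-* (suc m) (suc n) ⟩
    suc m · 1# * suc n · 1#           ≈⟨ ⁻¹-involutive _ ⟨
    - - (suc m · 1# * suc n · 1#)     ≈⟨ -‿cong (-‿distribʳ-* _ _) ⟩
    - (suc m · 1# * - (suc n · 1#))   ≈⟨ -‿distribˡ-* _ _ ⟩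
    - (suc m · 1#) * - (suc n · 1#)   ∎

  -- ι with the numeral 1 read as 1# instead of 1# + 0#.
  ⟦_⟧ᶻ : ℤ → Carrier
  ⟦ + 1 ⟧ᶻ = 1#
  ⟦ i   ⟧ᶻ = ι i

  ⟦⟧ᶻ≈ι : ∀ i → ⟦ i ⟧ᶻ ≈ ι i
  ⟦⟧ᶻ≈ι (+ 0)           = refl
  ⟦⟧ᶻ≈ι (+ 1)           = sym (+-identityʳ 1#)
  ⟦⟧ᶻ≈ι (+ suc (suc n)) = refl
  ⟦⟧ᶻ≈ι (-[1+ n ])      = refl

  -- The setoid equality of a ring comes without a decision procedure, so the solver normalises over
  -- ℤ, where equality is decidable. Numerals are sent to multiples of `1#`, hence `con (+ 3)` is
  -- `fromℕ 3` by definition and the coefficients of the differential equations can be written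
  -- directly.
  morphism : ℤ.+-*-rawRing ACR.-Raw-AlmostCommutative⟶ ACR.fromCommutativeRing R
  morphism = record
    { ⟦_⟧    = ⟦_⟧ᶻ
    ; +-homo = λ i j → trans (⟦⟧ᶻ≈ι (i ℤ.+ j)) (trans (ι-+ i j) (sym (+-cong (⟦⟧ᶻ≈ι i) (⟦⟧ᶻ≈ι j))))
    ; *-homo = λ i j → trans (⟦⟧ᶻ≈ι (i ℤ.* j)) (trans (ι-* i j) (sym (*-cong (⟦⟧ᶻ≈ι i) (⟦⟧ᶻ≈ι j))))
    ; -‿homo = λ i → trans (⟦⟧ᶻ≈ι (ℤ.- i)) (trans (ι-neg i) (-‿cong (sym (⟦⟧ᶻ≈ι i))))
    ; 0-homo = refl
    ; 1-homo = refl
    }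

  _≟ᶻ_ : ∀ i j → Maybe (⟦ i ⟧ᶻ ≈ ⟦ j ⟧ᶻ)
  i ≟ᶻ j with i ℤ.≟ j
  ... | yes i≡j = just (reflexive (≡.cong ⟦_⟧ᶻ i≡j))
  ... | no  _   = nothing

  open RingSolver ℤ.+-*-rawRing (ACR.fromCommutativeRing R) morphism _≟ᶻ_ public
    using (Polynomial; solve; _:=_; _:+_; _:*_; _:-_; :-_; _:^_; con)

  :0 :1 :2 : ∀ {n} → Polynomial n
  :0 = con (+ 0)
  :1 = con (+ 1)
  :2 = con (+ 2)

module RealAnalysis (em : ExcludedMiddle 0ℓ) (ℝ : CompleteOrderedField) where

  open Analysis ℝ hiding (zero)
  open IntegerCoefficients commutativeRing
    using (solve; _:=_; _:+_; _:*_; _:-_; :-_; _:^_; con; :0; :1; :2)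
  open TotalOrder totalOrder using (≤-respˡ-≈; ≤-respʳ-≈)
    renaming (refl to ≤-refl; trans to ≤-trans; antisym to ≤-antisym; total to ≤-total; reflexive to ≤-reflexive)
  open SemiringMult semiring using (×1-homo-*)
  open Max totalOrder using (x≤x⊔y; x≤y⊔x; ⊔-lub; ⊔-cong)

  -- Order, inverses and absolute value.

  infixl 6 _⊕_
  infixl 7 _⊗_

  2# : Carrier
  2# = fromℕ 2

  ½ : Carrier
  ½ = 2# ⁻¹

  opaque
    <-≤-trans : ∀ {a b c} → a < b → b ≤ c → a < c
    <-≤-trans = ToStrict.<-≤-trans _≈_ _≤_ sym ≤-trans ≤-antisym ≤-respʳ-≈

    ≤-<-trans : ∀ {a b c} → a ≤ b → b < c → a < c
    ≤-<-trans = ToStrict.≤-<-trans _≈_ _≤_ ≤-trans ≤-antisym ≤-respˡ-≈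

    <⇒≱ : ∀ {a b} → a < b → ¬ (b ≤ a)
    <⇒≱ = ToStrict.<⇒≱ _≈_ _≤_ ≤-antisym

    ≰⇒> : ∀ {a b} → ¬ (a ≤ b) → b < a
    ≰⇒> = ToStrict.≰⇒> _≈_ _≤_ sym ≤-reflexive ≤-total

    ≤⊎> : ∀ a b → a ≤ b ⊎ b < a
    ≤⊎> a b with em {a ≤ b}
    ... | yes a≤b = inj₁ a≤b
    ... | no  a≰b = inj₂ (≰⇒> a≰b)

    ≮⇒≥ : ∀ {a b} → ¬ (a < b) → b ≤ a
    ≮⇒≥ {a} {b} a≮b with ≤⊎> b a
    ... | inj₁ b≤a = b≤a
    ... | inj₂ a<b = ⊥-elim (a≮b a<b)

    <-respʳ : ∀ {a b c} → b ≈ c → a < b → a < c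
    <-respʳ b≈c a<b = <-≤-trans a<b (≤-reflexive b≈c)

    <-respˡ : ∀ {a b c} → b ≈ c → b < a → c < a
    <-respˡ b≈c b<a = ≤-<-trans (≤-reflexive (sym b≈c)) b<a

    0≤diff : ∀ {a b} → a ≤ b → 0# ≤ b - a
    0≤diff {a} a≤b = ≤-respˡ-≈ (-‿inverseʳ a) (+-monoˡ-≤ (- a) a≤b)

    ≤-by : ∀ {a b e} → 0# ≤ e → b - a ≈ e → a ≤ b
    ≤-by {a} {b} {e} 0≤e b-a≈e =
      ≤-respˡ-≈ (+-identityˡ a) (≤-respʳ-≈ (trans (+-congʳ (sym b-a≈e)) (solve 2 (λ a b → (b :- a) :+ a := b) refl a b))
        (+-monoˡ-≤ a 0≤e))

    _⊗_ : ∀ {a b} → 0# ≤ a → 0# ≤ b → 0# ≤ a * b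
    _⊗_ = *-nonNeg

    _⊕_ : ∀ {a b} → 0# ≤ a → 0# ≤ b → 0# ≤ a + b
    _⊕_ {a} {b} 0≤a 0≤b = ≤-trans 0≤b (≤-respˡ-≈ (+-identityˡ b) (+-monoˡ-≤ b 0≤a))

    +-mono-≤ : ∀ {a b c d} → a ≤ b → c ≤ d → a + c ≤ b + d
    +-mono-≤ {a} {b} {c} {d} a≤b c≤d = ≤-by (0≤diff a≤b ⊕ 0≤diff c≤d)
      (solve 4 (λ a b c d → (b :+ d) :- (a :+ c) := (b :- a) :+ (d :- c)) refl a b c d)

    neg-mono-≤ : ∀ {a b} → a ≤ b → - b ≤ - a
    neg-mono-≤ {a} {b} a≤b = ≤-by (0≤diff a≤b) (solve 2 (λ a b → :- a :- :- b := b :- a) refl a b)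

    *-monoˡ-≤ : ∀ {a b c} → 0# ≤ c → a ≤ b → c * a ≤ c * b
    *-monoˡ-≤ {a} {b} {c} 0≤c a≤b = ≤-by (0≤c ⊗ 0≤diff a≤b)
      (solve 3 (λ a b c → c :* b :- c :* a := c :* (b :- a)) refl a b c)

    *-monoʳ-≤ : ∀ {a b c} → 0# ≤ c → a ≤ b → a * c ≤ b * c
    *-monoʳ-≤ {a} {b} {c} 0≤c a≤b = ≤-by (0≤c ⊗ 0≤diff a≤b)
      (solve 3 (λ a b c → b :* c :- a :* c := c :* (b :- a)) refl a b c)

    *-mono-≤ : ∀ {a b c d} → 0# ≤ a → a ≤ b → 0# ≤ c → c ≤ d → a * c ≤ b * d
    *-mono-≤ 0≤a a≤b 0≤c c≤d = ≤-trans (*-monoʳ-≤ 0≤c a≤b) (*-monoˡ-≤ (≤-trans 0≤a a≤b) c≤d)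

    0≤-neg : ∀ {a} → a ≤ 0# → 0# ≤ - a
    0≤-neg {a} a≤0 = ≤-respʳ-≈ (+-identityˡ _) (0≤diff a≤0)

    0≤sq : ∀ a → 0# ≤ a * a
    0≤sq a with ≤-total 0# a
    ... | inj₁ 0≤a = 0≤a ⊗ 0≤a
    ... | inj₂ a≤0 = ≤-respʳ-≈ (solve 1 (λ a → :- a :* :- a := a :* a) refl a) (0≤-neg a≤0 ⊗ 0≤-neg a≤0)

    0≤1 : 0# ≤ 1#
    0≤1 = ≤-respʳ-≈ (*-identityˡ 1#) (0≤sq 1#)

    0<1 : 0# < 1#
    0<1 = 0≤1 , 0≉1

    <⇒0<diff : ∀ {a b} → a < b → 0# < b - a
    <⇒0<diff {a} {b} (a≤b , a≉b) = 0≤diff a≤b , λ 0≈b-a → a≉b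
      (trans (sym (+-identityˡ a)) (trans (+-congʳ 0≈b-a) (solve 2 (λ a b → (b :- a) :+ a := b) refl a b)))

    <-by : ∀ {a b e} → 0# < e → b - a ≈ e → a < b
    <-by {a} {b} (0≤e , 0≉e) eq = ≤-by 0≤e eq , λ a≈b → 0≉e (trans (sym (trans (+-congˡ (-‿cong a≈b)) (-‿inverseʳ b))) eq)

    0<⇒≉0 : ∀ {a} → 0# < a → ¬ (a ≈ 0#)
    0<⇒≉0 (_ , 0≉a) a≈0 = 0≉a (sym a≈0)

    *-cancelˡ-≈ : ∀ {a b c} → ¬ (a ≈ 0#) → a * b ≈ a * c → b ≈ c
    *-cancelˡ-≈ {a} {b} {c} a≉0 ab≈ac = trans (sym (lem b)) (trans (*-congˡ ab≈ac) (lem c))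
      where
      lem : ∀ b → a ⁻¹ * (a * b) ≈ b
      lem b = trans (solve 3 (λ a i b → i :* (a :* b) := (a :* i) :* b) refl a (a ⁻¹) b)
                    (trans (*-congʳ (*-inverseʳ a≉0)) (*-identityˡ b))

    *-nonzero : ∀ {a b} → ¬ (a ≈ 0#) → ¬ (b ≈ 0#) → ¬ (a * b ≈ 0#)
    *-nonzero {a} a≉0 b≉0 ab≈0 = b≉0 (*-cancelˡ-≈ a≉0 (trans ab≈0 (sym (zeroʳ a))))

    0<* : ∀ {a b} → 0# < a → 0# < b → 0# < a * b
    0<* 0<a 0<b = proj₁ 0<a ⊗ proj₁ 0<b , λ 0≈ab → *-nonzero (0<⇒≉0 0<a) (0<⇒≉0 0<b) (sym 0≈ab)

    0<+ˡ : ∀ {a b} → 0# < a → 0# ≤ b → 0# < a + b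
    0<+ˡ {a} {b} 0<a 0≤b = <-≤-trans 0<a (≤-by 0≤b (solve 2 (λ a b → (a :+ b) :- a := b) refl a b))

    ⁻¹-unique : ∀ {a b} → a * b ≈ 1# → b ≈ a ⁻¹
    ⁻¹-unique {a} {b} ab≈1 = *-cancelˡ-≈ a≉0 (trans ab≈1 (sym (*-inverseʳ a≉0)))
      where
      a≉0 : ¬ (a ≈ 0#)
      a≉0 a≈0 = 0≉1 (trans (sym (zeroˡ b)) (trans (*-congʳ (sym a≈0)) ab≈1))

    ⁻¹-cong : ∀ {a b} → a ≈ b → a ⁻¹ ≈ b ⁻¹
    ⁻¹-cong {a} {b} a≈b with em {a ≈ 0#}
    ... | yes a≈0 = trans (0⁻¹≈0 a≈0) (sym (0⁻¹≈0 (trans (sym a≈b) a≈0)))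
    ... | no  a≉0 = ⁻¹-unique (trans (*-congʳ (sym a≈b)) (*-inverseʳ a≉0))

    0<⁻¹ : ∀ {a} → 0# < a → 0# < a ⁻¹
    0<⁻¹ {a} 0<a with ≤⊎> (a ⁻¹) 0#
    ... | inj₂ 0<a⁻¹ = 0<a⁻¹
    ... | inj₁ a⁻¹≤0 = ⊥-elim (<⇒≱ 0<1 (≤-by (proj₁ 0<a ⊗ 0≤-neg a⁻¹≤0)
            (trans (+-congˡ (-‿cong (sym (*-inverseʳ (0<⇒≉0 0<a)))))
              (solve 2 (λ a i → :0 :- a :* i := a :* :- i) refl a (a ⁻¹)))))

    *-inverse-pos : ∀ {a} → 0# < a → a * a ⁻¹ ≈ 1#
    *-inverse-pos 0<a = *-inverseʳ (0<⇒≉0 0<a)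

    0<2 : 0# < 2#
    0<2 = 0<+ˡ 0<1 (0≤1 ⊕ ≤-refl)

    0<½ : 0# < ½
    0<½ = 0<⁻¹ 0<2

    2½≈1 : 2# * ½ ≈ 1#
    2½≈1 = *-inverse-pos 0<2

    ½+½ : ∀ a → ½ * a + ½ * a ≈ a
    ½+½ a = trans (solve 2 (λ h a → h :* a :+ h :* a := (:2 :* h) :* a) refl ½ a) (trans (*-congʳ 2½≈1) (*-identityˡ a))

    ½<1 : ∀ {a} → 0# < a → ½ * a < a
    ½<1 {a} 0<a = <-by (0<* 0<½ 0<a) (trans (+-congʳ (sym (½+½ a))) (solve 1 (λ b → (b :+ b) :- b := b) refl (½ * a)))

    ≤-by-η : ∀ {a b} → (∀ η → 0# < η → a ≤ b + η) → a ≤ b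
    ≤-by-η {a} {b} a≤b+η with ≤⊎> a b
    ... | inj₁ a≤b = a≤b
    -- Half of a - b, taken for η, contradicts b < a.
    ... | inj₂ b<a = ⊥-elim (<⇒≱ (½<1 0<a-b) (≤-by (0≤diff (a≤b+η _ (0<* 0<½ 0<a-b)))
            (solve 3 (λ a b h → h :- (a :- b) := (b :+ h) :- a) refl a b (½ * (a - b)))))
      where
      0<a-b : 0# < a - b
      0<a-b = <⇒0<diff b<a

    ∣∣-lub : ∀ {a c} → a ≤ c → - a ≤ c → ∣ a ∣ ≤ c
    ∣∣-lub = ⊔-lub

    a≤∣a∣ : ∀ a → a ≤ ∣ a ∣
    a≤∣a∣ a = x≤x⊔y a (- a)

    -a≤∣a∣ : ∀ a → - a ≤ ∣ a ∣
    -a≤∣a∣ a = x≤y⊔x a (- a)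

    ∣∣-cong : ∀ {a b} → a ≈ b → ∣ a ∣ ≈ ∣ b ∣
    ∣∣-cong a≈b = ⊔-cong a≈b (-‿cong a≈b)

    0≤∣∣ : ∀ a → 0# ≤ ∣ a ∣
    0≤∣∣ a with ≤-total 0# a
    ... | inj₁ 0≤a = ≤-trans 0≤a (a≤∣a∣ a)
    ... | inj₂ a≤0 = ≤-trans (0≤-neg a≤0) (-a≤∣a∣ a)

    0≤⇒∣∣≈ : ∀ {a} → 0# ≤ a → ∣ a ∣ ≈ a
    0≤⇒∣∣≈ {a} 0≤a = ≤-antisym (∣∣-lub ≤-refl (≤-by (0≤a ⊕ 0≤a) (solve 1 (λ a → a :- :- a := a :+ a) refl a))) (a≤∣a∣ a)

    ∣∣-neg : ∀ a → ∣ - a ∣ ≈ ∣ a ∣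
    ∣∣-neg a = ≤-antisym (∣∣-lub (-a≤∣a∣ a) (≤-respˡ-≈ (sym a≈) (a≤∣a∣ a)))
                         (∣∣-lub (≤-respˡ-≈ a≈ (-a≤∣a∣ (- a))) (a≤∣a∣ (- a)))
      where
      a≈ : - - a ≈ a
      a≈ = solve 1 (λ a → :- :- a := a) refl a

    ≤0⇒∣∣≈ : ∀ {a} → a ≤ 0# → ∣ a ∣ ≈ - a
    ≤0⇒∣∣≈ {a} a≤0 = trans (sym (∣∣-neg a)) (0≤⇒∣∣≈ (0≤-neg a≤0))

    ∣a-b∣≈∣b-a∣ : ∀ a b → ∣ a - b ∣ ≈ ∣ b - a ∣
    ∣a-b∣≈∣b-a∣ a b = trans (∣∣-cong (solve 2 (λ a b → a :- b := :- (b :- a)) refl a b)) (∣∣-neg (b - a))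

    ∣a+b∣≤ : ∀ a b → ∣ a + b ∣ ≤ ∣ a ∣ + ∣ b ∣
    ∣a+b∣≤ a b = ∣∣-lub (+-mono-≤ (a≤∣a∣ a) (a≤∣a∣ b))
      (≤-respˡ-≈ (solve 2 (λ a b → :- a :+ :- b := :- (a :+ b)) refl a b) (+-mono-≤ (-a≤∣a∣ a) (-a≤∣a∣ b)))

    ∣a-b∣≤ : ∀ a b → ∣ a - b ∣ ≤ ∣ a ∣ + ∣ b ∣
    ∣a-b∣≤ a b = ≤-respʳ-≈ (+-congˡ (∣∣-neg b)) (∣a+b∣≤ a (- b))

    ∣ab∣≈ : ∀ a b → ∣ a * b ∣ ≈ ∣ a ∣ * ∣ b ∣
    ∣ab∣≈ a b with ≤-total 0# a | ≤-total 0# b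
    ... | inj₁ 0≤a | inj₁ 0≤b = trans (0≤⇒∣∣≈ (0≤a ⊗ 0≤b)) (sym (*-cong (0≤⇒∣∣≈ 0≤a) (0≤⇒∣∣≈ 0≤b)))
    ... | inj₁ 0≤a | inj₂ b≤0 = trans (trans (sym (∣∣-neg _)) (trans (∣∣-cong eq) (0≤⇒∣∣≈ (0≤a ⊗ 0≤-neg b≤0))))
                                      (sym (*-cong (0≤⇒∣∣≈ 0≤a) (≤0⇒∣∣≈ b≤0)))
      where
      eq : - (a * b) ≈ a * - b
      eq = solve 2 (λ a b → :- (a :* b) := a :* :- b) refl a b
    ... | inj₂ a≤0 | inj₁ 0≤b = trans (trans (sym (∣∣-neg _)) (trans (∣∣-cong eq) (0≤⇒∣∣≈ (0≤-neg a≤0 ⊗ 0≤b))))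
                                      (sym (*-cong (≤0⇒∣∣≈ a≤0) (0≤⇒∣∣≈ 0≤b)))
      where
      eq : - (a * b) ≈ - a * b
      eq = solve 2 (λ a b → :- (a :* b) := :- a :* b) refl a b
    ... | inj₂ a≤0 | inj₂ b≤0 = trans (trans (∣∣-cong eq) (0≤⇒∣∣≈ (0≤-neg a≤0 ⊗ 0≤-neg b≤0)))
                                      (sym (*-cong (≤0⇒∣∣≈ a≤0) (≤0⇒∣∣≈ b≤0)))
      where
      eq : a * b ≈ - a * - b
      eq = solve 2 (λ a b → a :* b := :- a :* :- b) refl a b

    ∣ab∣≤ : ∀ {a b A B} → ∣ a ∣ ≤ A → ∣ b ∣ ≤ B → ∣ a * b ∣ ≤ A * B
    ∣ab∣≤ {a} {b} a≤A b≤B = ≤-respˡ-≈ (sym (∣ab∣≈ a b)) (*-mono-≤ (0≤∣∣ a) a≤A (0≤∣∣ b) b≤B)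

    ∣a∣∣a∣≈ : ∀ a → ∣ a ∣ * ∣ a ∣ ≈ a * a
    ∣a∣∣a∣≈ a = trans (sym (∣ab∣≈ a a)) (0≤⇒∣∣≈ (0≤sq a))

    ∣a∣≤0⇒a≈0 : ∀ {a} → ∣ a ∣ ≤ 0# → a ≈ 0#
    ∣a∣≤0⇒a≈0 {a} ∣a∣≤0 = ≤-antisym (≤-trans (a≤∣a∣ a) ∣a∣≤0)
      (≤-by (0≤-neg (≤-trans (-a≤∣a∣ a) ∣a∣≤0)) (solve 1 (λ a → a :- :0 := :- :- a) refl a))

    a-b≈0⇒a≈b : ∀ {a b} → a - b ≈ 0# → a ≈ b
    a-b≈0⇒a≈b {a} {b} eq = trans (solve 2 (λ a b → a := (a :- b) :+ b) refl a b) (trans (+-congʳ eq) (+-identityˡ b))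

    min⁺ : ∀ {a b} → 0# < a → 0# < b → Σ Carrier λ c → 0# < c × c ≤ a × c ≤ b
    min⁺ {a} {b} 0<a 0<b with ≤-total a b
    ... | inj₁ a≤b = a , 0<a , ≤-refl , a≤b
    ... | inj₂ b≤a = b , 0<b , b≤a , ≤-refl

  -- Derivatives

  -- `HasDerivative D h d a` is by definition `LittleO D a` of the remainder (h y - h a) - d (y -
  -- a). Each rule of differentiation thus reduces to an algebraic identity between remainders.
  LittleO : Pred Carrier 0ℓ → Carrier → (Carrier → Carrier) → Set
  LittleO D a e = ∀ ε → 0# < ε → Σ Carrier λ δ → 0# < δ ×
    (∀ y → D y → ∣ y - a ∣ < δ → ∣ e y ∣ ≤ ε * ∣ y - a ∣)

  BigO : Pred Carrier 0ℓ → Carrier → (Carrier → Carrier) → Set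
  BigO D a e = Σ Carrier λ C → 0# ≤ C × Σ Carrier λ δ → 0# < δ ×
    (∀ y → D y → ∣ y - a ∣ < δ → ∣ e y ∣ ≤ C * ∣ y - a ∣)

  littleO-cong : ∀ {D a e e′} → (∀ y → D y → e y ≈ e′ y) → LittleO D a e → LittleO D a e′
  littleO-cong e≈e′ o ε 0<ε = let δ , 0<δ , H = o ε 0<ε in
    δ , 0<δ , λ y Dy y≈a → ≤-respˡ-≈ (∣∣-cong (e≈e′ y Dy)) (H y Dy y≈a)

  halves-≤ : ∀ {u v} ε z → u ≤ ½ * ε * z → v ≤ ½ * ε * z → u + v ≤ ε * z
  halves-≤ ε z u≤ v≤ = ≤-respʳ-≈ (trans (solve 2 (λ c z → c :* z :+ c :* z := (c :+ c) :* z) refl (½ * ε) z) (*-congʳ (½+½ ε)))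
    (+-mono-≤ u≤ v≤)

  -- The witness is ε / (1 + B); adding 1 covers the case B = 0.
  shrink : ∀ {B ε} → 0# ≤ B → 0# < ε → Σ Carrier λ ε′ → 0# < ε′ × B * ε′ ≤ ε
  shrink {B} {ε} 0≤B 0<ε = ε * i , 0<* 0<ε 0<i , ≤-by (proj₁ 0<ε ⊗ proj₁ 0<i)
      (trans (+-congʳ (sym (trans (*-congˡ (*-inverse-pos 0<1+B)) (*-identityʳ ε))))
        (solve 3 (λ C ε i → ε :* ((:1 :+ C) :* i) :- C :* (ε :* i) := ε :* i) refl B ε i))
    where
    0<1+B : 0# < 1# + B
    0<1+B = 0<+ˡ 0<1 0≤B
    i : Carrier
    i = (1# + B) ⁻¹
    0<i : 0# < i
    0<i = 0<⁻¹ 0<1+B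

  ≤-by-ε : ∀ {u v w} → 0# ≤ w → (∀ ε → 0# < ε → u ≤ v + ε * w) → u ≤ v
  ≤-by-ε {u} {v} {w} 0≤w H = ≤-by-η λ η 0<η → let ε , 0<ε , wε≤η = shrink 0≤w 0<η in
    ≤-trans (H ε 0<ε) (+-mono-≤ ≤-refl (≤-respˡ-≈ (*-comm w ε) wε≤η))

  littleO-+ : ∀ {D a e e′} → LittleO D a e → LittleO D a e′ → LittleO D a (λ y → e y + e′ y)
  littleO-+ {D} {a} {e} {e′} o o′ ε 0<ε =
    let δ , 0<δ , H = o (½ * ε) (0<* 0<½ 0<ε)
        δ′ , 0<δ′ , H′ = o′ (½ * ε) (0<* 0<½ 0<ε)
        δ″ , 0<δ″ , ≤δ , ≤δ′ = min⁺ 0<δ 0<δ′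
    in δ″ , 0<δ″ , λ y Dy near →
    ≤-trans (∣a+b∣≤ (e y) (e′ y)) (halves-≤ ε ∣ y - a ∣ (H y Dy (<-≤-trans near ≤δ)) (H′ y Dy (<-≤-trans near ≤δ′)))

  quadratic⇒littleO : ∀ {D a e} C δ → 0# ≤ C → 0# < δ →
    (∀ y → D y → ∣ y - a ∣ < δ → ∣ e y ∣ ≤ C * (∣ y - a ∣ * ∣ y - a ∣)) → LittleO D a e
  quadratic⇒littleO {D} {a} {e} C δ 0≤C 0<δ H ε 0<ε =
    let ε′ , 0<ε′ , Cε′≤ε = shrink 0≤C 0<ε
        δ′ , 0<δ′ , ≤δ , ≤ε′ = min⁺ 0<δ 0<ε′
    in δ′ , 0<δ′ , λ y Dy near → ≤-trans (H y Dy (<-≤-trans near ≤δ))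
      (≤-respˡ-≈ (*-assoc C ∣ y - a ∣ ∣ y - a ∣)
        (*-monoʳ-≤ (0≤∣∣ (y - a)) (≤-trans (*-monoˡ-≤ 0≤C (≤-trans (proj₁ near) ≤ε′)) Cε′≤ε)))

  bigO-* : ∀ {D a e e′} → BigO D a e → BigO D a e′ → LittleO D a (λ y → e y * e′ y)
  bigO-* (C , 0≤C , δ , 0<δ , H) (C′ , 0≤C′ , δ′ , 0<δ′ , H′) =
    let δ″ , 0<δ″ , ≤δ , ≤δ′ = min⁺ 0<δ 0<δ′ in
    quadratic⇒littleO (C * C′) δ″ (0≤C ⊗ 0≤C′) 0<δ″ λ y Dy near →
    ≤-respʳ-≈ (solve 3 (λ C C′ z → (C :* z) :* (C′ :* z) := (C :* C′) :* (z :* z)) refl C C′ _)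
      (∣ab∣≤ (H y Dy (<-≤-trans near ≤δ)) (H′ y Dy (<-≤-trans near ≤δ′)))

  littleO-bounded-* : ∀ {D a e} (b : Carrier → Carrier) B → 0# ≤ B → (∀ y → D y → ∣ b y ∣ ≤ B) →
    LittleO D a e → LittleO D a (λ y → b y * e y)
  littleO-bounded-* {D} {a} b B 0≤B b≤B o ε 0<ε =
    let ε′ , 0<ε′ , Bε′≤ε = shrink 0≤B 0<ε
        δ , 0<δ , H = o ε′ 0<ε′
    in δ , 0<δ , λ y Dy near → ≤-trans (∣ab∣≤ (b≤B y Dy) (H y Dy near))
      (≤-respˡ-≈ (*-assoc B ε′ ∣ y - a ∣) (*-monoʳ-≤ (0≤∣∣ (y - a)) Bε′≤ε))

  littleO-scale : ∀ {D a e} c → LittleO D a e → LittleO D a (λ y → c * e y)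
  littleO-scale c = littleO-bounded-* (λ _ → c) ∣ c ∣ (0≤∣∣ c) (λ _ _ → ≤-refl)

  increment-bigO : ∀ {D h d a} → HasDerivative D h d a → BigO D a (λ y → h y - h a)
  increment-bigO {D} {h} {d} {a} h′ = let δ , 0<δ , H = h′ 1# 0<1 in
    1# + ∣ d ∣ , 0≤1 ⊕ 0≤∣∣ d , δ , 0<δ , λ y Dy near →
    ≤-respʳ-≈ (sym (distribʳ _ _ _)) (≤-respˡ-≈ (∣∣-cong (solve 2 (λ p q → (p :- q) :+ q := p) refl _ _))
      (≤-trans (∣a+b∣≤ _ _) (+-mono-≤ (H y Dy near) (≤-reflexive (∣ab∣≈ d (y - a))))))

  deriv-cong : ∀ {D h d d′ a} → d ≈ d′ → HasDerivative D h d a → HasDerivative D h d′ a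
  deriv-cong {D} {h} {d} {d′} {a} d≈d′ = littleO-cong {D} {a} λ y _ → +-congˡ (-‿cong (*-congʳ d≈d′))

  deriv-ext : ∀ {D h k d a} → D a → (∀ y → D y → h y ≈ k y) → HasDerivative D h d a → HasDerivative D k d a
  deriv-ext {D} {h} {k} {d} {a} Da h≈k = littleO-cong {D} {a} λ y Dy → +-congʳ (+-cong (h≈k y Dy) (-‿cong (h≈k a Da)))

  deriv-⊆ : ∀ {D D′ : Pred Carrier 0ℓ} {h d a} → (∀ y → D′ y → D y) → HasDerivative D h d a → HasDerivative D′ h d a
  deriv-⊆ D′⊆D h′ ε 0<ε = let δ , 0<δ , H = h′ ε 0<ε in
    δ , 0<δ , λ y D′y → H y (D′⊆D y D′y)

  deriv-const : ∀ {D} c {a} → HasDerivative D (λ _ → c) 0# a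
  deriv-const c {a} ε 0<ε = 1# , 0<1 , λ y _ _ →
    ≤-respˡ-≈ (trans (sym (0≤⇒∣∣≈ ≤-refl)) (∣∣-cong (solve 3 (λ c y a → :0 := (c :- c) :- :0 :* (y :- a)) refl c y a)))
      (proj₁ 0<ε ⊗ 0≤∣∣ _)

  deriv-id : ∀ {D a} → HasDerivative D (λ y → y) 1# a
  deriv-id {D} {a} ε 0<ε = 1# , 0<1 , λ y _ _ →
    ≤-respˡ-≈ (trans (sym (0≤⇒∣∣≈ ≤-refl)) (∣∣-cong (solve 2 (λ y a → :0 := (y :- a) :- :1 :* (y :- a)) refl y a)))
      (proj₁ 0<ε ⊗ 0≤∣∣ _)

  module _ {D : Pred Carrier 0ℓ} {a : Carrier} {h k : Carrier → Carrier} {d e : Carrier} where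

    deriv-+ : HasDerivative D h d a → HasDerivative D k e a → HasDerivative D (λ y → h y + k y) (d + e) a
    deriv-+ h′ k′ = littleO-cong {D} {a} (λ y _ → solve 8
      (λ hy ha ky ka d e y a → ((hy :- ha) :- d :* (y :- a)) :+ ((ky :- ka) :- e :* (y :- a)) :=
        ((hy :+ ky) :- (ha :+ ka)) :- (d :+ e) :* (y :- a)) refl (h y) (h a) (k y) (k a) d e y a)
      (littleO-+ {D} {a} h′ k′)

    -- The remainder of the product is k(a) times the remainder of h, plus h(a) times the remainder
    -- of k, plus the product of the two increments. Each increment is O(y - a), so their product is
    -- o(y - a).
    deriv-* : HasDerivative D h d a → HasDerivative D k e a → HasDerivative D (λ y → h y * k y) (d * k a + h a * e) a
    deriv-* h′ k′ = littleO-cong {D} {a} (λ y _ → solve 8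
      (λ hy ha ky ka d e y a →
        (ka :* ((hy :- ha) :- d :* (y :- a)) :+ ha :* ((ky :- ka) :- e :* (y :- a))) :+ (hy :- ha) :* (ky :- ka) :=
        (hy :* ky :- ha :* ka) :- (d :* ka :+ ha :* e) :* (y :- a)) refl (h y) (h a) (k y) (k a) d e y a)
      (littleO-+ {D} {a} (littleO-+ {D} {a} (littleO-scale {D} {a} (k a) h′) (littleO-scale {D} {a} (h a) k′))
        (bigO-* {D} {a} (increment-bigO h′) (increment-bigO k′)))

  module _ {D : Pred Carrier 0ℓ} {a : Carrier} {h : Carrier → Carrier} {d : Carrier} where

    deriv-scale : ∀ c → HasDerivative D h d a → HasDerivative D (λ y → c * h y) (c * d) a
    deriv-scale c h′ = deriv-cong (solve 3 (λ c d h → :0 :* h :+ c :* d := c :* d) refl c d (h a))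
      (deriv-* (deriv-const c) h′)

    deriv-neg : HasDerivative D h d a → HasDerivative D (λ y → - h y) (- d) a
    deriv-neg h′ = littleO-cong {D} {a} (λ y _ → solve 5
      (λ hy ha d y a → :- :1 :* ((hy :- ha) :- d :* (y :- a)) := (:- hy :- :- ha) :- :- d :* (y :- a)) refl (h y) (h a) d y a)
      (littleO-scale {D} {a} (- 1#) h′)

    deriv-^ : ∀ n → HasDerivative D h d a → HasDerivative D (λ y → h y ^ suc n) (fromℕ (suc n) * h a ^ n * d) a
    deriv-^ zero h′ = deriv-cong (solve 2 (λ d h → d :* :1 :+ h :* :0 := (:1 :+ :0) :* :1 :* d) refl d (h a))
      (deriv-* h′ (deriv-const 1#))
    deriv-^ (suc n) h′ = deriv-cong
      (solve 4 (λ d h p n → d :* (h :* p) :+ h :* (n :* p :* d) := (:1 :+ n) :* (h :* p) :* d) refl d (h a) (h a ^ n) (fromℕ (suc n)))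
      (deriv-* h′ (deriv-^ n h′))

  deriv-- : ∀ {D h k d e a} → HasDerivative D h d a → HasDerivative D k e a → HasDerivative D (λ y → h y - k y) (d - e) a
  deriv-- h′ k′ = deriv-+ h′ (deriv-neg k′)

  -- Mean value inequalities.

  Convex : Pred Carrier 0ℓ → Set
  Convex D = ∀ {a b t} → D a → D b → a ≤ t → t ≤ b → D t

  module MeanValue {D : Pred Carrier 0ℓ} {h d : Carrier → Carrier} (convex : Convex D)
                   (h′ : ∀ t → D t → HasDerivative D h (d t) t) where

    -- Let s be the supremum of the t for which the chord slope from a is at most K + ε.
    -- The derivative at s shows that t can be moved up to s and then beyond it.
    increment-≤+ε : ∀ {a b K} → D a → D b → a ≤ b → (∀ t → a ≤ t → t ≤ b → d t ≤ K) →
                    ∀ ε → 0# < ε → h b - h a ≤ (K + ε) * (b - a)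
    increment-≤+ε {a} {b} {K} Da Db a≤b d≤K ε 0<ε = reach (≤⊎> b (s + ½ * δ))
      where
      P : Pred Carrier 0ℓ
      P t = a ≤ t × t ≤ b × h t - h a ≤ (K + ε) * (t - a)

      Pa : P a
      Pa = ≤-refl , a≤b , ≤-reflexive (solve 3 (λ a h K → h :- h := K :* (a :- a)) refl a (h a) (K + ε))

      sup : Σ Carrier λ s → UpperBound P s × (∀ c → UpperBound P c → s ≤ c)
      sup = supremum P (a , Pa) (b , λ _ Pt → proj₁ (proj₂ Pt))

      s : Carrier
      s = proj₁ sup
      a≤s : a ≤ s
      a≤s = proj₁ (proj₂ sup) a Pa
      s≤b : s ≤ b
      s≤b = proj₂ (proj₂ sup) b (λ _ Pt → proj₁ (proj₂ Pt))
      Ds : D s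
      Ds = convex Da Db a≤s s≤b

      δ : Carrier
      δ = proj₁ (h′ s Ds ε 0<ε)
      0<δ : 0# < δ
      0<δ = proj₁ (proj₂ (h′ s Ds ε 0<ε))
      near-s : ∀ y → D y → ∣ y - s ∣ < δ → ∣ (h y - h s) - d s * (y - s) ∣ ≤ ε * ∣ y - s ∣
      near-s = proj₂ (proj₂ (h′ s Ds ε 0<ε))

      forward : ∀ y → s ≤ y → y ≤ b → y - s < δ → h y - h s ≤ (K + ε) * (y - s)
      forward y s≤y y≤b y-s<δ = ≤-by (0≤diff est ⊕ 0≤diff (d≤K s a≤s s≤b) ⊗ 0≤diff s≤y)
          (solve 6 (λ hy hs d K ε z → (K :+ ε) :* z :- (hy :- hs) := (ε :* z :- ((hy :- hs) :- d :* z)) :+ (K :- d) :* z)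
            refl (h y) (h s) (d s) K ε (y - s))
        where
        ∣y-s∣≈ : ∣ y - s ∣ ≈ y - s
        ∣y-s∣≈ = 0≤⇒∣∣≈ (0≤diff s≤y)
        est : (h y - h s) - d s * (y - s) ≤ ε * (y - s)
        est = ≤-trans (a≤∣a∣ _) (≤-respʳ-≈ (*-congˡ ∣y-s∣≈)
                (near-s y (convex Da Db (≤-trans a≤s s≤y) y≤b) (<-respˡ (sym ∣y-s∣≈) y-s<δ)))

      backward : ∀ t → a ≤ t → t ≤ s → s - t < δ → h s - h t ≤ (K + ε) * (s - t)
      backward t a≤t t≤s s-t<δ = ≤-by (0≤diff est ⊕ 0≤diff (d≤K s a≤s s≤b) ⊗ 0≤diff t≤s)
          (solve 7 (λ ht hs d K ε t s → (K :+ ε) :* (s :- t) :- (hs :- ht) :=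
              (ε :* (s :- t) :- :- ((ht :- hs) :- d :* (t :- s))) :+ (K :- d) :* (s :- t))
            refl (h t) (h s) (d s) K ε t s)
        where
        ∣t-s∣≈ : ∣ t - s ∣ ≈ s - t
        ∣t-s∣≈ = trans (∣a-b∣≈∣b-a∣ t s) (0≤⇒∣∣≈ (0≤diff t≤s))
        est : - ((h t - h s) - d s * (t - s)) ≤ ε * (s - t)
        est = ≤-trans (-a≤∣a∣ _) (≤-respʳ-≈ (*-congˡ ∣t-s∣≈)
                (near-s t (convex Da Ds a≤t t≤s) (<-respˡ (sym ∣t-s∣≈) s-t<δ)))

      join : ∀ t u → h t - h a ≤ (K + ε) * (t - a) → h u - h t ≤ (K + ε) * (u - t) → h u - h a ≤ (K + ε) * (u - a)
      join t u p q = ≤-by (0≤diff p ⊕ 0≤diff q)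
        (solve 7 (λ ha ht hu K a t u → K :* (u :- a) :- (hu :- ha) :=
            (K :* (t :- a) :- (ht :- ha)) :+ (K :* (u :- t) :- (hu :- ht))) refl (h a) (h t) (h u) (K + ε) a t u)

      s-δ<s : s - δ < s
      s-δ<s = <-by 0<δ (solve 2 (λ s δ → s :- (s :- δ) := δ) refl s δ)

      -- Without such a t, the smaller number s - δ would be an upper bound of `P`.
      close : Σ Carrier λ t → P t × s - δ < t
      close = decidable-stable em λ ¬p →
        <⇒≱ s-δ<s (proj₂ (proj₂ sup) (s - δ) (λ t Pt → ≮⇒≥ (λ lt → ¬p (t , Pt , lt))))

      Ps : P s
      Ps = let t , Pt , s-δ<t = close in a≤s , s≤b , join t s (proj₂ (proj₂ Pt))
        (backward t (proj₁ Pt) (proj₁ (proj₂ sup) t Pt)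
          (<-by (<⇒0<diff s-δ<t) (solve 3 (λ s t δ → δ :- (s :- t) := t :- (s :- δ)) refl s t δ)))

      -- Either b is so close that one forward step from s ends there, or s + ½ δ still lies in `P`,
      -- above its supremum.
      reach : b ≤ s + ½ * δ ⊎ s + ½ * δ < b → h b - h a ≤ (K + ε) * (b - a)
      reach (inj₁ b≤) = join s b (proj₂ (proj₂ Ps)) (forward b s≤b ≤-refl
        (≤-<-trans (≤-by (0≤diff b≤) (solve 3 (λ b s η → η :- (b :- s) := (s :+ η) :- b) refl b s (½ * δ))) (½<1 0<δ)))
      reach (inj₂ <b) = ⊥-elim (<⇒≱ s<y (proj₁ (proj₂ sup) y (≤-trans a≤s (proj₁ s<y) , proj₁ <b ,
          join s y (proj₂ (proj₂ Ps)) (forward y (proj₁ s<y) (proj₁ <b) (<-respˡ (sym y-s≈) (½<1 0<δ))))))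
        where
        y : Carrier
        y = s + ½ * δ
        y-s≈ : y - s ≈ ½ * δ
        y-s≈ = solve 2 (λ s η → (s :+ η) :- s := η) refl s (½ * δ)
        s<y : s < y
        s<y = <-by (0<* 0<½ 0<δ) y-s≈

    increment-≤ : ∀ {a b K} → D a → D b → a ≤ b → (∀ t → a ≤ t → t ≤ b → d t ≤ K) → h b - h a ≤ K * (b - a)
    increment-≤ Da Db a≤b d≤K = ≤-by-ε (0≤diff a≤b) λ ε 0<ε →
      ≤-respʳ-≈ (distribʳ _ _ _) (increment-≤+ε Da Db a≤b d≤K ε 0<ε)

  increment-≥ : ∀ {D} {h d : Carrier → Carrier} → Convex D → (∀ t → D t → HasDerivative D h (d t) t) →
    ∀ {a b K} → D a → D b → a ≤ b → (∀ t → a ≤ t → t ≤ b → K ≤ d t) → K * (b - a) ≤ h b - h a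
  increment-≥ {D} {h} {d} convex h′ {a} {b} {K} Da Db a≤b K≤d =
    ≤-by (0≤diff (MeanValue.increment-≤ {h = λ t → - h t} {d = λ t → - d t} convex (λ t Dt → deriv-neg (h′ t Dt)) Da Db a≤b
        (λ t a≤t t≤b → neg-mono-≤ (K≤d t a≤t t≤b))))
      (solve 5 (λ ha hb K a b → (hb :- ha) :- K :* (b :- a) := :- K :* (b :- a) :- (:- hb :- :- ha)) refl (h a) (h b) K a b)

  increment-∣∣-≤ : ∀ {D} {h d : Carrier → Carrier} → Convex D → (∀ t → D t → HasDerivative D h (d t) t) →
    ∀ {a b K} → D a → D b → a ≤ b → (∀ t → a ≤ t → t ≤ b → ∣ d t ∣ ≤ K) → ∣ h b - h a ∣ ≤ K * (b - a)
  increment-∣∣-≤ {D} {h} {d} convex h′ {a} {b} {K} Da Db a≤b d≤K = ∣∣-lub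
    (MeanValue.increment-≤ convex h′ Da Db a≤b (λ t a≤t t≤b → ≤-trans (a≤∣a∣ (d t)) (d≤K t a≤t t≤b)))
    (≤-by (0≤diff (increment-≥ convex h′ {K = - K} Da Db a≤b λ t a≤t t≤b →
        ≤-by (0≤diff (≤-trans (-a≤∣a∣ (d t)) (d≤K t a≤t t≤b))) (solve 2 (λ d K → d :- :- K := K :- :- d) refl (d t) K)))
      (solve 3 (λ i K z → K :* z :- :- i := i :- :- K :* z) refl (h b - h a) K (b - a)))

  increment-∣∣ : ∀ {D} {h d : Carrier → Carrier} → Convex D → (∀ t → D t → HasDerivative D h (d t) t) →
    ∀ {a b K} → D a → D b → (∀ t → D t → ∣ t - a ∣ ≤ ∣ b - a ∣ → ∣ d t ∣ ≤ K) → ∣ h b - h a ∣ ≤ K * ∣ b - a ∣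
  increment-∣∣ {D} {h} {d} convex h′ {a} {b} {K} Da Db d≤K = by (≤-total a b)
    where
    by : a ≤ b ⊎ b ≤ a → ∣ h b - h a ∣ ≤ K * ∣ b - a ∣
    by (inj₁ a≤b) = ≤-respʳ-≈ (*-congˡ (sym ∣b-a∣≈)) (increment-∣∣-≤ {d = d} convex h′ Da Db a≤b λ t a≤t t≤b →
        d≤K t (convex Da Db a≤t t≤b) (≤-respˡ-≈ (sym (0≤⇒∣∣≈ (0≤diff a≤t))) (≤-respʳ-≈ (sym ∣b-a∣≈) (+-monoˡ-≤ (- a) t≤b))))
      where
      ∣b-a∣≈ : ∣ b - a ∣ ≈ b - a
      ∣b-a∣≈ = 0≤⇒∣∣≈ (0≤diff a≤b)
    by (inj₂ b≤a) = ≤-respˡ-≈ (∣a-b∣≈∣b-a∣ (h a) (h b)) (≤-respʳ-≈ (*-congˡ (sym ∣b-a∣≈)) (increment-∣∣-≤ {d = d} convex h′ Db Da b≤a λ t b≤t t≤a →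
        d≤K t (convex Db Da b≤t t≤a)
          (≤-respˡ-≈ (sym (trans (∣a-b∣≈∣b-a∣ t a) (0≤⇒∣∣≈ (0≤diff t≤a)))) (≤-respʳ-≈ (sym ∣b-a∣≈) (+-mono-≤ ≤-refl (neg-mono-≤ b≤t))))))
      where
      ∣b-a∣≈ : ∣ b - a ∣ ≈ a - b
      ∣b-a∣≈ = trans (∣a-b∣≈∣b-a∣ b a) (0≤⇒∣∣≈ (0≤diff b≤a))

  -- The function h t - d(a) t has derivative d t - d(a), which is at most L ∣b - a∣ between a and
  -- b; the increment estimate then gives the quadratic bound.
  taylor-∣∣ : ∀ {D} {h d : Carrier → Carrier} {L} → Convex D → (∀ t → D t → HasDerivative D h (d t) t) → 0# ≤ L →
    (∀ s t → D s → D t → ∣ d s - d t ∣ ≤ L * ∣ s - t ∣) →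
    ∀ {a b} → D a → D b → ∣ (h b - h a) - d a * (b - a) ∣ ≤ L * (∣ b - a ∣ * ∣ b - a ∣)
  taylor-∣∣ {D} {h} {d} {L} convex h′ 0≤L lip {a} {b} Da Db = ≤-respˡ-≈
    (∣∣-cong (solve 5 (λ ha hb d a b → (hb :- d :* b) :- (ha :- d :* a) := (hb :- ha) :- d :* (b :- a)) refl (h a) (h b) (d a) a b))
    (≤-respʳ-≈ (*-assoc L ∣ b - a ∣ ∣ b - a ∣)
      (increment-∣∣ {D} {λ t → h t - d a * t} {λ t → d t - d a} convex φ′ Da Db
        (λ t Dt near → ≤-trans (lip t a Dt Da) (*-monoˡ-≤ 0≤L near))))
    where
    φ′ : ∀ t → D t → HasDerivative D (λ t → h t - d a * t) (d t - d a) t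
    φ′ t Dt = deriv-- {k = λ t → d a * t} (h′ t Dt) (deriv-cong (*-identityʳ (d a)) (deriv-scale (d a) deriv-id))

  module _ {D : Pred Carrier 0ℓ} {h d : Carrier → Carrier} (convex : Convex D) (h′ : ∀ t → D t → HasDerivative D h (d t) t) where

    decreasing : ∀ {a b} → D a → D b → a ≤ b → (∀ t → a ≤ t → t ≤ b → 0# ≤ - d t) → h b ≤ h a
    decreasing {a} {b} Da Db a≤b 0≤-d = ≤-by (0≤diff (MeanValue.increment-≤ convex h′ {K = 0#} Da Db a≤b
        (λ t a≤t t≤b → ≤-by (0≤-d t a≤t t≤b) (+-identityˡ _))))
      (solve 4 (λ u v a b → u :- v := :0 :* (b :- a) :- (v :- u)) refl (h a) (h b) a b)

    increasing : ∀ {a b} → D a → D b → a ≤ b → (∀ t → a ≤ t → t ≤ b → 0# ≤ d t) → h a ≤ h b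
    increasing {a} {b} Da Db a≤b 0≤d = ≤-by (0≤diff (increment-≥ convex h′ {K = 0#} Da Db a≤b 0≤d))
      (solve 4 (λ u v a b → v :- u := (v :- u) :- :0 :* (b :- a)) refl (h a) (h b) a b)

    constant : (∀ t → D t → d t ≈ 0#) → ∀ {a b} → D a → D b → h b ≈ h a
    constant d≈0 {a} {b} Da Db = a-b≈0⇒a≈b (∣a∣≤0⇒a≈0 (≤-respʳ-≈ (zeroˡ ∣ b - a ∣)
      (increment-∣∣ {D} {h} {d} convex h′ {K = 0#} Da Db (λ t Dt _ → ≤-reflexive (trans (∣∣-cong (d≈0 t Dt)) (0≤⇒∣∣≈ ≤-refl))))))

  -- The exponential function

  -- If all natural numbers lay below x, they would have a supremum s. Since n + 1 ≤ s for every n,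
  -- the number s - 1 would bound them too.
  archimedean : ∀ x → Σ ℕ λ n → x ≤ fromℕ n
  archimedean x = decidable-stable em λ ¬p →
    let s , ub , lub = supremum P (0# , 0 , refl) (x , λ { _ (n , v≈n) → ≤-respˡ-≈ (sym v≈n) (proj₁ (below ¬p n)) })
    in <⇒≱ (s-1<s s) (lub (s - 1#) λ { v (n , v≈n) →
         ≤-by (0≤diff (ub (fromℕ (suc n)) (suc n , refl)))
           (trans (+-congˡ (-‿cong v≈n)) (solve 2 (λ s n → (s :- :1) :- n := s :- (:1 :+ n)) refl s (fromℕ n))) })
    where
    P : Pred Carrier 0ℓ
    P v = Σ ℕ λ n → v ≈ fromℕ n
    below : ¬ (Σ ℕ λ n → x ≤ fromℕ n) → ∀ n → fromℕ n < x
    below ¬p n = ≰⇒> λ x≤n → ¬p (n , x≤n)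
    s-1<s : ∀ s → s - 1# < s
    s-1<s s = <-by 0<1 (solve 1 (λ s → s :- (s :- :1) := :1) refl s)

  0≤fromℕ : ∀ n → 0# ≤ fromℕ n
  0≤fromℕ zero    = ≤-refl
  0≤fromℕ (suc n) = 0≤1 ⊕ 0≤fromℕ n

  0<fromℕ : ∀ n → 0# < fromℕ (suc n)
  0<fromℕ n = 0<+ˡ 0<1 (0≤fromℕ n)

  fromℕ-mono : ∀ {m n} → m ℕ.≤ n → fromℕ m ≤ fromℕ n
  fromℕ-mono {n = n} ℕ.z≤n = 0≤fromℕ n
  fromℕ-mono (ℕ.s≤s m≤n) = +-mono-≤ ≤-refl (fromℕ-mono m≤n)

  0<n! : ∀ n → 0# < fromℕ (n !)
  0<n! zero    = 0<fromℕ 0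
  0<n! (suc n) = <-respʳ (sym (×1-homo-* (suc n) (n !))) (0<* (0<fromℕ n) (0<n! n))

  w : ℕ → Carrier
  w n = fromℕ (n !) ⁻¹

  0<w : ∀ n → 0# < w n
  0<w n = 0<⁻¹ (0<n! n)

  w-suc : ∀ n → fromℕ (suc n) * w (suc n) ≈ w n
  w-suc n = *-cancelˡ-≈ (0<⇒≉0 (0<n! n)) (begin
    fromℕ (n !) * (fromℕ (suc n) * w (suc n))  ≈⟨ solve 3 (λ a b c → a :* (b :* c) := (b :* a) :* c) refl (fromℕ (n !)) (fromℕ (suc n)) (w (suc n)) ⟩
    (fromℕ (suc n) * fromℕ (n !)) * w (suc n)  ≈⟨ *-congʳ (sym (×1-homo-* (suc n) (n !))) ⟩
    fromℕ ((suc n) !) * w (suc n)              ≈⟨ *-inverse-pos (0<n! (suc n)) ⟩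
    1#                                         ≈⟨ sym (*-inverse-pos (0<n! n)) ⟩
    fromℕ (n !) * w n                          ∎)
    where open SetoidReasoning setoid

  deriv-expSum : ∀ {D} n {a} → HasDerivative D (expSum (suc n)) (expSum n a) a
  deriv-expSum zero = deriv-const _
  deriv-expSum (suc n) {a} = deriv-+ (deriv-expSum n) (deriv-cong eq (deriv-* (deriv-^ n deriv-id) (deriv-const (w (suc n)))))
    where
    eq : (fromℕ (suc n) * a ^ n * 1#) * w (suc n) + a ^ suc n * 0# ≈ a ^ n * w n
    eq = trans (solve 4 (λ m p q w → (m :* p :* :1) :* w :+ q :* :0 := p :* (m :* w)) refl (fromℕ (suc n)) (a ^ n) (a ^ suc n) (w (suc n)))
               (*-congˡ (w-suc n))

  0≤^ : ∀ {a} n → 0# ≤ a → 0# ≤ a ^ n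
  0≤^ zero    0≤a = 0≤1
  0≤^ (suc n) 0≤a = 0≤a ⊗ 0≤^ n 0≤a

  ∣^∣≤ : ∀ {a M} n → ∣ a ∣ ≤ M → ∣ a ^ n ∣ ≤ M ^ n
  ∣^∣≤ zero    a≤M = ≤-reflexive (0≤⇒∣∣≈ 0≤1)
  ∣^∣≤ (suc n) a≤M = ∣ab∣≤ a≤M (∣^∣≤ n a≤M)

  2½* : ∀ a → 2# * (½ * a) ≈ a
  2½* a = trans (sym (*-assoc 2# ½ a)) (trans (*-congʳ 2½≈1) (*-identityˡ a))

  geometric-bound : ∀ N (u : ℕ → Carrier) → (∀ k → N ℕ.≤ k → u (suc k) ≤ ½ * u k) →
    Σ Carrier λ C → ∀ k → u k ≤ C * ½ ^ k
  geometric-bound zero u dec = u 0 , bound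
    where
    bound : ∀ k → u k ≤ u 0 * ½ ^ k
    bound zero    = ≤-reflexive (sym (*-identityʳ (u 0)))
    bound (suc k) = ≤-trans (dec k ℕ.z≤n) (≤-respʳ-≈ (solve 3 (λ a h p → h :* (a :* p) := a :* (h :* p)) refl (u 0) ½ (½ ^ k))
      (*-monoˡ-≤ (proj₁ 0<½) (bound k)))
  geometric-bound (suc N) u dec = C , bound
    where
    ih : Σ Carrier λ C → ∀ k → u (suc k) ≤ C * ½ ^ k
    ih = geometric-bound N (λ k → u (suc k)) (λ k N≤k → dec (suc k) (ℕ.s≤s N≤k))
    C : Carrier
    -- The induction hypothesis concerns the shifted sequence; the factor 2 undoes the shift of ½ ^
    -- k, and the maximum takes in the first term.
    C = u 0 ⊔ (2# * proj₁ ih)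
    bound : ∀ k → u k ≤ C * ½ ^ k
    bound zero    = ≤-respʳ-≈ (sym (*-identityʳ C)) (x≤x⊔y (u 0) (2# * proj₁ ih))
    bound (suc k) = ≤-trans (proj₂ ih k) (≤-respˡ-≈
        (trans (solve 4 (λ t c h p → (t :* c) :* (h :* p) := (t :* (h :* (c :* p)))) refl 2# (proj₁ ih) ½ (½ ^ k)) (2½* _))
      (*-monoʳ-≤ (0≤^ (suc k) (proj₁ 0<½)) (x≤y⊔x (u 0) (2# * proj₁ ih))))

  -- From the index where 2 M ≤ k + 1 on, the ratio M / (k + 1) of successive terms is at most ½.
  exp-term-bound : ∀ M → 0# ≤ M → Σ Carrier λ C → ∀ k → M ^ k * w k ≤ C * ½ ^ k
  exp-term-bound M 0≤M = geometric-bound (proj₁ arch) (λ k → M ^ k * w k) λ k N≤k →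
    ≤-by (0≤diff (≤-trans (proj₂ arch) (fromℕ-mono (ℕ.m≤n⇒m≤1+n N≤k))) ⊗ (proj₁ 0<½ ⊗ (0≤^ k 0≤M ⊗ proj₁ (0<w (suc k)))))
      (trans (+-cong (*-congˡ (*-congˡ (sym (w-suc k)))) (-‿cong (sym (2½* _))))
        (solve 6 (λ t h M p n w → h :* (p :* (n :* w)) :- t :* (h :* (M :* p :* w)) := (n :- t :* M) :* (h :* (p :* w)))
          refl 2# ½ M (M ^ k) (fromℕ (suc k)) (w (suc k))))
    where
    arch : Σ ℕ λ n → 2# * M ≤ fromℕ n
    arch = archimedean (2# * M)

  opaque
    expSum-tail : ∀ M → 0# ≤ M → Σ Carrier λ C → 0# ≤ C ×
      (∀ y → ∣ y ∣ ≤ M → ∀ n j → ∣ expSum (j ℕ.+ n) y - expSum n y ∣ ≤ C * ½ ^ n)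
    expSum-tail M 0≤M = 2# * C , proj₁ 0<2 ⊗ 0≤C , λ y y≤M n j → ≤-trans (tail y y≤M n j)
        (≤-by (proj₁ 0<2 ⊗ 0≤C ⊗ 0≤^ (j ℕ.+ n) (proj₁ 0<½)) (solve 3 (λ c p q → c :* p :- c :* (p :- q) := c :* q) refl (2# * C) (½ ^ n) (½ ^ (j ℕ.+ n))))
      where
      C : Carrier
      C = proj₁ (exp-term-bound M 0≤M)
      bound : ∀ k → M ^ k * w k ≤ C * ½ ^ k
      bound = proj₂ (exp-term-bound M 0≤M)
      0≤C : 0# ≤ C
      0≤C = ≤-respʳ-≈ (*-identityʳ C) (≤-trans (0≤1 ⊗ proj₁ (0<w 0)) (bound 0))
      -- The right side is the exact finite geometric sum of C ½ ^ k for n ≤ k < j + n, which is the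
      -- form in which the induction on j closes.
      tail : ∀ y → ∣ y ∣ ≤ M → ∀ n j → ∣ expSum (j ℕ.+ n) y - expSum n y ∣ ≤ 2# * C * (½ ^ n - ½ ^ (j ℕ.+ n))
      tail y y≤M n zero = ≤-reflexive (trans (∣∣-cong (-‿inverseʳ _)) (trans (0≤⇒∣∣≈ ≤-refl)
        (solve 2 (λ c p → :0 := c :* (p :- p)) refl (2# * C) (½ ^ n))))
      tail y y≤M n (suc j) = ≤-respˡ-≈ (∣∣-cong (solve 3 (λ a b t → (a :- b) :+ t := (a :+ t) :- b) refl (expSum m y) (expSum n y) (y ^ m * w m)))
        (≤-trans (∣a+b∣≤ _ _) (≤-trans (+-mono-≤ (tail y y≤M n j) (≤-trans (∣ab∣≤ (∣^∣≤ m y≤M) (≤-reflexive (0≤⇒∣∣≈ (proj₁ (0<w m))))) (bound m)))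
          (≤-reflexive (trans (solve 3 (λ C p q → :2 :* C :* (p :- q) :+ C :* q := :2 :* C :* p :- C :* q) refl C (½ ^ n) (½ ^ m))
            (trans (+-congˡ (-‿cong (*-congˡ (sym (2½* (½ ^ m))))))
              (solve 4 (λ h C p q → :2 :* C :* p :- C :* (:2 :* (h :* q)) := :2 :* C :* (p :- h :* q)) refl ½ C (½ ^ n) (½ ^ m)))))))
        where
        m : ℕ
        m = j ℕ.+ n

  ½^≤1 : ∀ n → ½ ^ n ≤ 1#
  ½^≤1 zero    = ≤-refl
  ½^≤1 (suc n) = ≤-respʳ-≈ (*-identityʳ 1#)
    (*-mono-≤ (proj₁ 0<½) (≤-respʳ-≈ (½+½ 1#) (≤-by (proj₁ 0<½ ⊗ 0≤1) (solve 1 (λ h → (h :* :1 :+ h :* :1) :- h := h :* :1) refl ½)))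
      (0≤^ n (proj₁ 0<½)) (½^≤1 n))

  n½^n≤1 : ∀ n → fromℕ n * ½ ^ n ≤ 1#
  n½^n≤1 zero    = ≤-respˡ-≈ (sym (zeroˡ _)) 0≤1
  n½^n≤1 (suc n) = ≤-respˡ-≈ (solve 3 (λ n h p → h :* p :+ h :* (n :* p) := (:1 :+ n) :* (h :* p)) refl (fromℕ n) ½ (½ ^ n))
    (≤-respʳ-≈ (½+½ 1#) (+-mono-≤ (*-monoˡ-≤ (proj₁ 0<½) (½^≤1 n)) (*-monoˡ-≤ (proj₁ 0<½) (n½^n≤1 n))))

  -- Beyond A / ε + 1, multiplying A + ε ≤ ε n by ½ ^ n and using n ½ ^ n ≤ 1 leaves A ½ ^ n ≤ ε - ε
  -- ½ ^ n. The summand 1 in the choice of `N` is what makes the result strict.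
  ½^n→0 : ∀ A {ε} → 0# ≤ A → 0# < ε → Σ ℕ λ N → ∀ n → N ℕ.≤ n → A * ½ ^ n < ε
  ½^n→0 A {ε} 0≤A 0<ε = N , λ n N≤n → ≤-<-trans
      (≤-by (0≤^ n (proj₁ 0<½) ⊗ 0≤diff (A+ε≤ n N≤n) ⊕ proj₁ 0<ε ⊗ 0≤diff (n½^n≤1 n))
        (solve 4 (λ A ε n p → (ε :- ε :* p) :- A :* p := p :* (ε :* n :- (A :+ ε)) :+ ε :* (:1 :- n :* p)) refl A ε (fromℕ n) (½ ^ n)))
      (<-by (0<* 0<ε (0<½^ n)) (solve 2 (λ ε p → ε :- (ε :- ε :* p) := ε :* p) refl ε (½ ^ n)))
    where
    N : ℕ
    N = proj₁ (archimedean (A * ε ⁻¹ + 1#))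
    0<½^ : ∀ n → 0# < ½ ^ n
    0<½^ zero    = 0<1
    0<½^ (suc n) = 0<* 0<½ (0<½^ n)
    A+ε≤ : ∀ n → N ℕ.≤ n → A + ε ≤ ε * fromℕ n
    A+ε≤ n N≤n = ≤-respˡ-≈ (trans (solve 3 (λ A ε i → ε :* (A :* i :+ :1) := A :* (ε :* i) :+ ε) refl A ε (ε ⁻¹))
        (+-congʳ (trans (*-congˡ (*-inverse-pos 0<ε)) (*-identityʳ A))))
      (*-monoˡ-≤ (proj₁ 0<ε) (≤-trans (proj₂ (archimedean (A * ε ⁻¹ + 1#))) (fromℕ-mono N≤n)))

  ∣a-b∣≤⇒a≤b+ : ∀ {a b c} → ∣ a - b ∣ ≤ c → a ≤ b + c
  ∣a-b∣≤⇒a≤b+ {a} {b} {c} h = ≤-by (0≤diff (≤-trans (a≤∣a∣ (a - b)) h)) (solve 3 (λ a b c → (b :+ c) :- a := c :- (a :- b)) refl a b c)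

  ∣a-b∣≤⇒b≤a+ : ∀ {a b c} → ∣ a - b ∣ ≤ c → b ≤ a + c
  ∣a-b∣≤⇒b≤a+ {a} {b} h = ∣a-b∣≤⇒a≤b+ (≤-respˡ-≈ (∣a-b∣≈∣b-a∣ a b) h)

  -- The limit is the supremum of the eventual lower bounds.
  cauchy-limit : ∀ (a τ : ℕ → Carrier) → (∀ n j → ∣ a (j ℕ.+ n) - a n ∣ ≤ τ n) →
    Σ Carrier λ l → ∀ n → ∣ a n - l ∣ ≤ τ n
  cauchy-limit a τ cauchy = l , λ n → ∣∣-lub
      (≤-by (0≤diff (proj₁ (proj₂ sup) (a n - τ n) (low n))) (solve 3 (λ a t l → t :- (a :- l) := l :- (a :- t)) refl (a n) (τ n) l))
      (≤-by (0≤diff (proj₂ (proj₂ sup) (a n + τ n) (high n))) (solve 3 (λ a t l → t :- :- (a :- l) := (a :+ t) :- l) refl (a n) (τ n) l))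
    where
    P : Pred Carrier 0ℓ
    P v = Σ ℕ λ N → ∀ j → v ≤ a (j ℕ.+ N)
    low : ∀ n → P (a n - τ n)
    low n = n , λ j → ≤-by (0≤diff (∣a-b∣≤⇒b≤a+ (cauchy n j)))
      (solve 3 (λ a b t → a :- (b :- t) := (a :+ t) :- b) refl (a (j ℕ.+ n)) (a n) (τ n))
    high : ∀ n → UpperBound P (a n + τ n)
    high n v (N , v≤) = ≤-trans (v≤ n) (≡.subst (λ k → a k ≤ a n + τ n) (ℕ.+-comm N n) (∣a-b∣≤⇒a≤b+ (cauchy n N)))
    sup : Σ Carrier λ s → UpperBound P s × (∀ c → UpperBound P c → s ≤ c)
    sup = supremum P (_ , low 0) (_ , high 0)
    l : Carrier
    l = proj₁ sup

  opaque
    exp-limit : ∀ x → Σ Carrier λ l → ∀ n → ∣ expSum n x - l ∣ ≤ proj₁ (expSum-tail ∣ x ∣ (0≤∣∣ x)) * ½ ^ n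
    exp-limit x = cauchy-limit (λ n → expSum n x) _ (proj₂ (proj₂ (expSum-tail ∣ x ∣ (0≤∣∣ x))) x ≤-refl)

    exp : Carrier → Carrier
    exp x = proj₁ (exp-limit x)

    exp-isExp : IsExp exp
    exp-isExp x ε 0<ε = let C , 0≤C , _ = expSum-tail ∣ x ∣ (0≤∣∣ x)
                            N , H = ½^n→0 C 0≤C 0<ε
                        in N , λ n N≤n → ≤-<-trans (proj₂ (exp-limit x) n) (H n N≤n)

  ∣a-c∣≤ : ∀ a b c → ∣ a - c ∣ ≤ ∣ a - b ∣ + ∣ b - c ∣
  ∣a-c∣≤ a b c = ≤-respˡ-≈ (∣∣-cong (solve 3 (λ a b c → (a :- b) :+ (b :- c) := a :- c) refl a b c)) (∣a+b∣≤ (a - b) (b - c))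

  -- The constant in `exp-limit` depends on the point. Comparing with a partial sum of index N + n
  -- that is η-close to `exp y` replaces it by one constant for the whole ball; the case n = 0 of
  -- the tail bound also bounds the partial sums.
  exp-approx : ∀ M → 0# ≤ M → Σ Carrier λ C → 0# ≤ C ×
    (∀ y → ∣ y ∣ ≤ M → ∀ n → ∣ expSum n y ∣ ≤ C × ∣ exp y - expSum n y ∣ ≤ C * ½ ^ n)
  exp-approx M 0≤M = C , 0≤C , λ y y≤M n → sum-bound y y≤M n , ≤-by-η λ η 0<η →
      let N , H = exp-isExp y η 0<η in
      ≤-trans (∣a-c∣≤ (exp y) (expSum (N ℕ.+ n) y) (expSum n y)) (≤-respʳ-≈ (+-comm η (C * ½ ^ n)) (+-mono-≤
        (≤-respˡ-≈ (∣a-b∣≈∣b-a∣ (expSum (N ℕ.+ n) y) (exp y)) (proj₁ (H (N ℕ.+ n) (ℕ.m≤m+n N n)))) (tail y y≤M n N)))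
    where
    C : Carrier
    C = proj₁ (expSum-tail M 0≤M)
    0≤C : 0# ≤ C
    0≤C = proj₁ (proj₂ (expSum-tail M 0≤M))
    tail : ∀ y → ∣ y ∣ ≤ M → ∀ n j → ∣ expSum (j ℕ.+ n) y - expSum n y ∣ ≤ C * ½ ^ n
    tail = proj₂ (proj₂ (expSum-tail M 0≤M))
    sum-bound : ∀ y → ∣ y ∣ ≤ M → ∀ n → ∣ expSum n y ∣ ≤ C
    sum-bound y y≤M n = ≤-respʳ-≈ (*-identityʳ C) (≤-respˡ-≈ (∣∣-cong (solve 1 (λ s → s :- :0 := s) refl (expSum n y)))
      (≡.subst (λ k → ∣ expSum k y - 0# ∣ ≤ C * 1#) (ℕ.+-identityʳ n) (tail y y≤M 0 n)))

  Ball : Carrier → Pred Carrier 0ℓ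
  Ball M y = ∣ y ∣ ≤ M

  ball-convex : ∀ {M} → Convex (Ball M)
  ball-convex {M} {a} {b} {t} a≤M b≤M a≤t t≤b = ∣∣-lub (≤-trans t≤b (≤-trans (a≤∣a∣ b) b≤M))
    (≤-trans (neg-mono-≤ a≤t) (≤-trans (-a≤∣a∣ a) a≤M))

  -- Differentiating a partial sum twice gives a partial sum again, so the partial sums satisfy the
  -- quadratic estimate with a constant independent of their index. It survives the limit, and no
  -- exchange of limit and derivative has to be justified.
  exp-taylor : ∀ M → 0# ≤ M → Σ Carrier λ C → 0# ≤ C ×
    (∀ a b → ∣ a ∣ ≤ M → ∣ b ∣ ≤ M → ∣ (exp b - exp a) - exp a * (b - a) ∣ ≤ C * (∣ b - a ∣ * ∣ b - a ∣))
  exp-taylor M 0≤M = C , 0≤C , λ a b a≤M b≤M → ≤-by-ε (0≤1 ⊕ 0≤1 ⊕ 0≤∣∣ (b - a)) λ ε 0<ε →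
      let N , H = ½^n→0 C 0≤C 0<ε
          ε-close : ∀ y → ∣ y ∣ ≤ M → ∀ n → N ℕ.≤ n → ∣ exp y - expSum n y ∣ ≤ ε
          ε-close y y≤M n N≤n = ≤-trans (proj₂ (approx y y≤M n)) (proj₁ (H n N≤n))
          z = b - a
          -- Each differentiation drops one term, so three consecutive indices occur: N + 2 for the
          -- function, N + 1 for its derivative, N for the bound on the second derivative.
          N₁ = suc N
          N₂ = suc N₁
          N≤N₁ = ℕ.n≤1+n N
          N≤N₂ = ℕ.≤-trans N≤N₁ (ℕ.n≤1+n N₁)
      in ≤-respˡ-≈ (∣∣-cong (solve 6 (λ eb ea sb sa sa′ z →
             (((sb :- sa) :- sa′ :* z) :+ ((eb :- sb) :- (ea :- sa))) :- (ea :- sa′) :* z := (eb :- ea) :- ea :* z) refl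
             (exp b) (exp a) (expSum N₂ b) (expSum N₂ a) (expSum N₁ a) z))
         (≤-trans (∣a-b∣≤ _ _) (≤-trans (+-mono-≤ (≤-trans (∣a+b∣≤ _ _) (+-mono-≤
             (sum-taylor N a≤M b≤M) (≤-trans (∣a-b∣≤ _ _) (+-mono-≤ (ε-close b b≤M N₂ N≤N₂) (ε-close a a≤M N₂ N≤N₂)))))
             (∣ab∣≤ (ε-close a a≤M N₁ N≤N₁) (≤-refl {∣ z ∣})))
           (≤-reflexive (solve 3 (λ q ε z → (q :+ (ε :+ ε)) :+ ε :* z := q :+ ε :* ((:1 :+ :1) :+ z)) refl (C * (∣ z ∣ * ∣ z ∣)) ε ∣ z ∣))))
    where
    C : Carrier
    C = proj₁ (exp-approx M 0≤M)
    0≤C : 0# ≤ C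
    0≤C = proj₁ (proj₂ (exp-approx M 0≤M))
    approx : ∀ y → ∣ y ∣ ≤ M → ∀ n → ∣ expSum n y ∣ ≤ C × ∣ exp y - expSum n y ∣ ≤ C * ½ ^ n
    approx = proj₂ (proj₂ (exp-approx M 0≤M))
    sum-lipschitz : ∀ n s t → Ball M s → Ball M t → ∣ expSum (suc n) s - expSum (suc n) t ∣ ≤ C * ∣ s - t ∣
    sum-lipschitz n s t Bs Bt = increment-∣∣ {D = Ball M} ball-convex (λ t _ → deriv-expSum n) Bt Bs (λ t Bt _ → proj₁ (approx t Bt n))
    sum-taylor : ∀ n {a b} → Ball M a → Ball M b →
      ∣ (expSum (suc (suc n)) b - expSum (suc (suc n)) a) - expSum (suc n) a * (b - a) ∣ ≤ C * (∣ b - a ∣ * ∣ b - a ∣)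
    sum-taylor n = taylor-∣∣ {D = Ball M} ball-convex (λ t _ → deriv-expSum (suc n)) 0≤C (sum-lipschitz n)

  -- The chain rule: ∣G y - G a∣ = O(y - a) makes the quadratic error of `exp-taylor` negligible.
  -- The bound `M` on `G` fixes the ball on which that error is uniform.
  deriv-exp : ∀ {D G q a} M → D a → (∀ y → D y → ∣ G y ∣ ≤ M) → HasDerivative D G q a →
    HasDerivative D (λ y → exp (G y)) (exp (G a) * q) a
  deriv-exp {D} {G} {q} {a} M Da G≤M G′ = littleO-cong {D} {a}
    (λ y _ → solve 7 (λ ey ea gy ga q y a → ((ey :- ea) :- ea :* (gy :- ga)) :+ ea :* ((gy :- ga) :- q :* (y :- a)) :=
        (ey :- ea) :- (ea :* q) :* (y :- a)) refl (exp (G y)) (exp (G a)) (G y) (G a) q y a)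
    (littleO-+ {D} {a}
      (quadratic⇒littleO {D} {a} (C * (B * B)) δ (0≤C ⊗ (0≤B ⊗ 0≤B)) 0<δ λ y Dy near →
        ≤-trans (H (G a) (G y) (G≤M a Da) (G≤M y Dy))
          (≤-respʳ-≈ (solve 3 (λ C B z → C :* ((B :* z) :* (B :* z)) := C :* (B :* B) :* (z :* z)) refl C B ∣ y - a ∣)
            (*-monoˡ-≤ 0≤C (*-mono-≤ (0≤∣∣ _) (K y Dy near) (0≤∣∣ _) (K y Dy near)))))
      (littleO-scale {D} {a} (exp (G a)) G′))
    where
    taylor : Σ Carrier λ C → 0# ≤ C ×
      (∀ a b → ∣ a ∣ ≤ M → ∣ b ∣ ≤ M → ∣ (exp b - exp a) - exp a * (b - a) ∣ ≤ C * (∣ b - a ∣ * ∣ b - a ∣))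
    taylor = exp-taylor M (≤-trans (0≤∣∣ (G a)) (G≤M a Da))
    C : Carrier
    C = proj₁ taylor
    0≤C : 0# ≤ C
    0≤C = proj₁ (proj₂ taylor)
    H : ∀ a b → ∣ a ∣ ≤ M → ∣ b ∣ ≤ M → ∣ (exp b - exp a) - exp a * (b - a) ∣ ≤ C * (∣ b - a ∣ * ∣ b - a ∣)
    H = proj₂ (proj₂ taylor)
    big : BigO D a (λ y → G y - G a)
    big = increment-bigO G′
    B : Carrier
    B = proj₁ big
    0≤B : 0# ≤ B
    0≤B = proj₁ (proj₂ big)
    δ : Carrier
    δ = proj₁ (proj₂ (proj₂ big))
    0<δ : 0# < δ
    0<δ = proj₁ (proj₂ (proj₂ (proj₂ big)))
    K : ∀ y → D y → ∣ y - a ∣ < δ → ∣ G y - G a ∣ ≤ B * ∣ y - a ∣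
    K = proj₂ (proj₂ (proj₂ (proj₂ big)))

  exp-bounded : ∀ M → 0# ≤ M → Σ Carrier λ C → 0# ≤ C × (∀ y → ∣ y ∣ ≤ M → ∣ exp y ∣ ≤ C)
  exp-bounded M 0≤M = let C , 0≤C , H = exp-approx M 0≤M in
    C , 0≤C , λ y y≤M → ≤-respʳ-≈ (*-identityʳ C) (≤-respˡ-≈ (∣∣-cong (solve 1 (λ s → s :- :0 := s) refl (exp y))) (proj₂ (H y y≤M 0)))

  exp-lipschitz : ∀ M → 0# ≤ M → Σ Carrier λ C → 0# ≤ C × (∀ a b → ∣ a ∣ ≤ M → ∣ b ∣ ≤ M → ∣ exp b - exp a ∣ ≤ C * ∣ b - a ∣)
  exp-lipschitz M 0≤M = let C , 0≤C , H = exp-bounded M 0≤M in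
    C , 0≤C , λ a b a≤M b≤M → increment-∣∣ {D = Ball M} {d = λ t → exp t * 1#} ball-convex
      (λ t Bt → deriv-exp M Bt (λ _ By → By) deriv-id) a≤M b≤M
      (λ t Bt _ → ≤-respˡ-≈ (∣∣-cong (sym (*-identityʳ (exp t)))) (H t Bt))

  exp-cong : ∀ {a b} → a ≈ b → exp a ≈ exp b
  exp-cong {a} {b} a≈b = let C , 0≤C , H = exp-lipschitz ∣ b ∣ (0≤∣∣ b) in
    a-b≈0⇒a≈b (∣a∣≤0⇒a≈0 (≤-trans (H b a ≤-refl (≤-reflexive (∣∣-cong a≈b)))
      (≤-reflexive (trans (*-congˡ (trans (∣∣-cong (trans (+-congʳ a≈b) (-‿inverseʳ b))) (0≤⇒∣∣≈ ≤-refl))) (zeroʳ C)))))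

  expSum-0 : ∀ n → expSum (suc n) 0# ≈ 1#
  expSum-0 zero    = trans (+-identityˡ _) (trans (*-identityˡ _) (sym (⁻¹-unique (trans (*-identityʳ _) (+-identityʳ 1#)))))
  expSum-0 (suc n) = trans (+-cong (expSum-0 n) (trans (*-congʳ (zeroˡ _)) (zeroˡ _))) (+-identityʳ 1#)

  exp-0 : exp 0# ≈ 1#
  exp-0 = a-b≈0⇒a≈b (∣a∣≤0⇒a≈0 (≤-by-η λ η 0<η → let N , H = exp-isExp 0# η 0<η in
    ≤-respʳ-≈ (sym (+-identityˡ η)) (≤-respˡ-≈ (∣a-b∣≈∣b-a∣ 1# (exp 0#))
      (≤-respˡ-≈ (∣∣-cong (+-congʳ (expSum-0 N))) (proj₁ (H (suc N) (ℕ.n≤1+n N)))))))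

  1≤expSum : ∀ {x} n → 0# ≤ x → 1# ≤ expSum (suc n) x
  1≤expSum {x} zero    0≤x = ≤-reflexive (sym (trans (+-identityˡ _) (trans (*-identityˡ _) (sym (⁻¹-unique (trans (*-identityʳ _) (+-identityʳ 1#)))))))
  1≤expSum {x} (suc n) 0≤x = ≤-trans (1≤expSum n 0≤x)
    (≤-by (0≤^ (suc n) 0≤x ⊗ proj₁ (0<w (suc n))) (solve 2 (λ a b → (a :+ b) :- a := b) refl (expSum (suc n) x) (x ^ suc n * w (suc n))))

  1≤exp : ∀ {x} → 0# ≤ x → 1# ≤ exp x
  1≤exp {x} 0≤x = ≤-by-η λ η 0<η → let N , H = exp-isExp x η 0<η in
    ≤-trans (1≤expSum N 0≤x) (∣a-b∣≤⇒a≤b+ (proj₁ (H (suc N) (ℕ.n≤1+n N))))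

  -- The product exp t · exp(-t) has derivative 0 on the ball of radius ∣x∣ and equals 1 at 0.
  exp-inverse : ∀ x → exp x * exp (- x) ≈ 1#
  exp-inverse x = trans (constant {Ball M} {λ t → exp t * exp (- t)} ball-convex deriv (λ _ _ → refl)
        (≤-respˡ-≈ (sym (0≤⇒∣∣≈ ≤-refl)) (0≤∣∣ x)) ≤-refl)
      (trans (*-cong exp-0 (trans (exp-cong (solve 0 (:- :0 := :0) refl)) exp-0)) (*-identityʳ 1#))
    where
    M : Carrier
    M = ∣ x ∣
    deriv : ∀ t → Ball M t → HasDerivative (Ball M) (λ t → exp t * exp (- t)) 0# t
    deriv t Bt = deriv-cong
      (solve 2 (λ e f → (e :* :1) :* f :+ e :* (f :* :- :1) := :0) refl (exp t) (exp (- t)))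
      (deriv-* (deriv-exp M Bt (λ _ By → By) deriv-id)
        (deriv-exp M Bt (λ y By → ≤-respˡ-≈ (sym (∣∣-neg y)) By) (deriv-neg deriv-id)))

  0<exp : ∀ x → 0# < exp x
  0<exp x = by-sign (≤-total 0# x)
    where
    by-sign : 0# ≤ x ⊎ x ≤ 0# → 0# < exp x
    by-sign (inj₁ 0≤x) = <-≤-trans 0<1 (1≤exp 0≤x)
    by-sign (inj₂ x≤0) = <-respʳ (sym (⁻¹-unique (trans (*-comm (exp (- x)) (exp x)) (exp-inverse x))))
      (0<⁻¹ (<-≤-trans 0<1 (1≤exp (0≤-neg x≤0))))

  -- Antiderivatives and linear differential equations

  -- The bound is carried along because products of Lipschitz functions are Lipschitz only when the
  -- factors are bounded. The constants are data, so that error estimates for antiderivatives and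
  -- Riemann sums can name them.
  record BoundedLipschitz (D : Pred Carrier 0ℓ) (h : Carrier → Carrier) : Set where
    field
      L         : Carrier
      0≤L       : 0# ≤ L
      lipschitz : ∀ s t → D s → D t → ∣ h s - h t ∣ ≤ L * ∣ s - t ∣
      M         : Carrier
      0≤M       : 0# ≤ M
      bounded   : ∀ t → D t → ∣ h t ∣ ≤ M

  open BoundedLipschitz

  module _ {D : Pred Carrier 0ℓ} where

    opaque
      bl-const : ∀ c → BoundedLipschitz D (λ _ → c)
      bl-const c = record
        { L = 0#
        ; 0≤L = ≤-refl
        ; lipschitz = λ s t _ _ → ≤-reflexive (trans (∣∣-cong (-‿inverseʳ c)) (trans (0≤⇒∣∣≈ ≤-refl) (sym (zeroˡ ∣ s - t ∣))))
        ; M = ∣ c ∣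
        ; 0≤M = 0≤∣∣ c
        ; bounded = λ _ _ → ≤-refl
        }

      bl-neg : ∀ {h} → BoundedLipschitz D h → BoundedLipschitz D (λ t → - h t)
      bl-neg {h} H = record
        { L = L H
        ; 0≤L = 0≤L H
        ; lipschitz = λ s t Ds Dt → ≤-respˡ-≈
            (trans (sym (∣∣-neg (h s - h t))) (∣∣-cong (solve 2 (λ a b → :- (a :- b) := :- a :- :- b) refl (h s) (h t))))
            (lipschitz H s t Ds Dt)
        ; M = M H
        ; 0≤M = 0≤M H
        ; bounded = λ t Dt → ≤-respˡ-≈ (sym (∣∣-neg (h t))) (bounded H t Dt)
        }

      bl-+ : ∀ {h k} → BoundedLipschitz D h → BoundedLipschitz D k → BoundedLipschitz D (λ t → h t + k t)
      bl-+ {h} {k} H K = record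
        { L = L H + L K
        ; 0≤L = 0≤L H ⊕ 0≤L K
        ; lipschitz = λ s t Ds Dt → ≤-respˡ-≈
            (∣∣-cong (solve 4 (λ a b c d → (a :- b) :+ (c :- d) := (a :+ c) :- (b :+ d)) refl (h s) (h t) (k s) (k t)))
            (≤-respʳ-≈ (sym (distribʳ ∣ s - t ∣ (L H) (L K)))
              (≤-trans (∣a+b∣≤ (h s - h t) (k s - k t)) (+-mono-≤ (lipschitz H s t Ds Dt) (lipschitz K s t Ds Dt))))
        ; M = M H + M K
        ; 0≤M = 0≤M H ⊕ 0≤M K
        ; bounded = λ t Dt → ≤-trans (∣a+b∣≤ (h t) (k t)) (+-mono-≤ (bounded H t Dt) (bounded K t Dt))
        }

      bl-* : ∀ {h k} → BoundedLipschitz D h → BoundedLipschitz D k → BoundedLipschitz D (λ t → h t * k t)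
      bl-* {h} {k} H K = record
        { L = M H * L K + L H * M K
        ; 0≤L = 0≤M H ⊗ 0≤L K ⊕ 0≤L H ⊗ 0≤M K
        ; lipschitz = λ s t Ds Dt → ≤-respˡ-≈
            (∣∣-cong (solve 4 (λ a b c d → a :* (c :- d) :+ (a :- b) :* d := a :* c :- b :* d) refl (h s) (h t) (k s) (k t)))
            (≤-respʳ-≈ (solve 5 (λ m l l′ m′ z → m :* (l :* z) :+ (l′ :* z) :* m′ := (m :* l :+ l′ :* m′) :* z)
                refl (M H) (L K) (L H) (M K) ∣ s - t ∣)
              (≤-trans (∣a+b∣≤ (h s * (k s - k t)) ((h s - h t) * k t))
                (+-mono-≤ (∣ab∣≤ (bounded H s Ds) (lipschitz K s t Ds Dt)) (∣ab∣≤ (lipschitz H s t Ds Dt) (bounded K t Dt)))))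
        ; M = M H * M K
        ; 0≤M = 0≤M H ⊗ 0≤M K
        ; bounded = λ t Dt → ∣ab∣≤ (bounded H t Dt) (bounded K t Dt)
        }

      bl-exp : ∀ {h} → BoundedLipschitz D h → BoundedLipschitz D (λ t → exp (h t))
      bl-exp {h} H = let C , 0≤C , bd = exp-bounded (M H) (0≤M H)
                         C′ , 0≤C′ , lp = exp-lipschitz (M H) (0≤M H) in record
        { L = C′ * L H
        ; 0≤L = 0≤C′ ⊗ 0≤L H
        ; lipschitz = λ s t Ds Dt → ≤-respʳ-≈ (sym (*-assoc C′ (L H) ∣ s - t ∣))
            (≤-trans (lp (h t) (h s) (bounded H t Dt) (bounded H s Ds)) (*-monoˡ-≤ 0≤C′ (lipschitz H s t Ds Dt)))
        ; M = C
        ; 0≤M = 0≤C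
        ; bounded = λ t Dt → bd (h t) (bounded H t Dt)
        }

    bl-^ : ∀ {h} n → BoundedLipschitz D h → BoundedLipschitz D (λ t → h t ^ n)
    bl-^ zero    H = bl-const 1#
    bl-^ (suc n) H = bl-* H (bl-^ n H)

  [0,]-convex : ∀ {T} → Convex [0, T ]
  [0,]-convex (0≤a , _) (_ , b≤T) a≤t t≤b = ≤-trans 0≤a a≤t , ≤-trans t≤b b≤T

  [0,⟩-convex : ∀ {T} → Convex [0, T ⟩
  [0,⟩-convex (0≤a , _) (_ , b<T) a≤t t≤b = ≤-trans 0≤a a≤t , ≤-<-trans t≤b b<T

  opaque
    bl-deriv : ∀ {T} {h d : Carrier → Carrier} K → 0# ≤ T → 0# ≤ K → (∀ t → [0, T ] t → HasDerivative [0, T ] h (d t) t) →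
      (∀ t → [0, T ] t → ∣ d t ∣ ≤ K) → BoundedLipschitz [0, T ] h
    bl-deriv {T} {h} {d} K 0≤T 0≤K h′ d≤K = record
      { L = K
      ; 0≤L = 0≤K
      ; lipschitz = lip
      ; M = K * T + ∣ h 0# ∣
      ; 0≤M = 0≤K ⊗ 0≤T ⊕ 0≤∣∣ (h 0#)
      ; bounded = λ t Dt → ≤-respˡ-≈ (∣∣-cong (solve 2 (λ a b → (a :- b) :+ b := a) refl (h t) (h 0#)))
          (≤-trans (∣a+b∣≤ (h t - h 0#) (h 0#)) (+-mono-≤ (≤-trans (lip t 0# Dt (≤-refl , 0≤T))
            (*-monoˡ-≤ 0≤K (≤-respˡ-≈ (trans (sym (0≤⇒∣∣≈ (proj₁ Dt))) (∣∣-cong (solve 1 (λ t → t := t :- :0) refl t))) (proj₂ Dt)))) ≤-refl))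
      }
      where
      lip : ∀ s t → [0, T ] s → [0, T ] t → ∣ h s - h t ∣ ≤ K * ∣ s - t ∣
      lip s t Ds Dt = increment-∣∣ {[0, T ]} {h} {d} [0,]-convex h′ Dt Ds (λ t Dt _ → d≤K t Dt)

  -- Perron's method: the supremum of all functions p with p 0 = 0 whose increments satisfy
  -- the upper estimate p c - p a ≤ (h a + L (c - a)) (c - a) that an antiderivative has.
  module Antiderivative {T : Carrier} {h : Carrier → Carrier} (0≤T : 0# ≤ T) (H : BoundedLipschitz [0, T ] h) where

    Sub : (Carrier → Carrier) → Set
    Sub p = p 0# ≈ 0# × (∀ a c → [0, T ] a → [0, T ] c → a ≤ c → p c - p a ≤ (h a + L H * (c - a)) * (c - a))

    Value : Carrier → Pred Carrier 0ℓ
    Value t v = Σ (Carrier → Carrier) λ p → Sub p × v ≈ p t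

    opaque
      h-near : ∀ {a s} → [0, T ] a → [0, T ] s → a ≤ s → 0# ≤ h s - h a + L H * (s - a)
      h-near {a} {s} Da Ds a≤s = ≤-respʳ-≈
        (solve 3 (λ hs ha l → l :- :- (hs :- ha) := hs :- ha :+ l) refl (h s) (h a) (L H * (s - a)))
        (0≤diff (≤-trans (-a≤∣a∣ _) (≤-respʳ-≈ (*-congˡ (0≤⇒∣∣≈ (0≤diff a≤s))) (lipschitz H s a Ds Da))))

      h-near′ : ∀ {a s} → [0, T ] a → [0, T ] s → a ≤ s → 0# ≤ h a - h s + L H * (s - a)
      h-near′ {a} {s} Da Ds a≤s = ≤-respʳ-≈
        (solve 3 (λ hs ha l → l :- (hs :- ha) := ha :- hs :+ l) refl (h s) (h a) (L H * (s - a)))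
        (0≤diff (≤-trans (a≤∣a∣ _) (≤-respʳ-≈ (*-congˡ (0≤⇒∣∣≈ (0≤diff a≤s))) (lipschitz H s a Ds Da))))

      -- Shows that every `Value t` is inhabited, as `supremum` demands: since -M ≤ h, the slope -M
      -- is below any admissible one.
      linear-sub : Sub (λ t → - M H * t)
      linear-sub = zeroʳ (- M H) , λ a c Da Dc a≤c →
        ≤-by (0≤diff (≤-trans (-a≤∣a∣ (h a)) (bounded H a Da)) ⊗ 0≤diff a≤c ⊕ 0≤L H ⊗ (0≤diff a≤c ⊗ 0≤diff a≤c))
          (solve 5 (λ h L M a c → (h :+ L :* (c :- a)) :* (c :- a) :- (:- M :* c :- :- M :* a) :=
              (M :- :- h) :* (c :- a) :+ L :* ((c :- a) :* (c :- a))) refl (h a) (L H) (M H) a c)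

      value-bounded : ∀ t → [0, T ] t → UpperBound (Value t) ((h 0# + L H * (t - 0#)) * (t - 0#))
      value-bounded t Dt v (p , (p0 , sub) , v≈) = ≤-respˡ-≈
        (trans (trans (+-congˡ (-‿cong p0)) (solve 1 (λ p → p :- :0 := p) refl (p t))) (sym v≈))
        (sub 0# t (≤-refl , 0≤T) Dt (proj₁ Dt))

    sup : ∀ t → [0, T ] t → Σ Carrier λ s → UpperBound (Value t) s × (∀ b → UpperBound (Value t) b → s ≤ b)
    sup t Dt = supremum (Value t) (_ , _ , linear-sub , refl) (_ , value-bounded t Dt)

    -- The value 0 outside the interval is a filler, as subfunctions are unconstrained there. The
    -- decision is an argument so that properties can be proved by cases on an arbitrary decision
    -- and then applied to the one given by `em`.
    F? : ∀ t → Dec ([0, T ] t) → Carrier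
    F? t (yes Dt) = proj₁ (sup t Dt)
    F? t (no _)   = 0#

    opaque
      F : Carrier → Carrier
      F t = F? t em

      F-upper : ∀ t → [0, T ] t → UpperBound (Value t) (F t)
      F-upper t Dt = by em
        where
        by : (d : Dec ([0, T ] t)) → UpperBound (Value t) (F? t d)
        by (yes Dt′) = proj₁ (proj₂ (sup t Dt′))
        by (no ¬Dt)  = ⊥-elim (¬Dt Dt)

      F-least : ∀ t → [0, T ] t → ∀ b → UpperBound (Value t) b → F t ≤ b
      F-least t Dt = by em
        where
        by : (d : Dec ([0, T ] t)) → ∀ b → UpperBound (Value t) b → F? t d ≤ b
        by (yes Dt′) = proj₂ (proj₂ (sup t Dt′))
        by (no ¬Dt)  = ⊥-elim (¬Dt Dt)

    opaque
      F-0 : F 0# ≈ 0#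
      F-0 = ≤-antisym (F-least 0# D0 0# (λ { v (p , (p0 , _) , v≈) → ≤-reflexive (trans v≈ p0) }))
                      (F-upper 0# D0 0# (_ , linear-sub , sym (zeroʳ (- M H))))
        where
        D0 : [0, T ] 0#
        D0 = ≤-refl , 0≤T

      F-increment-≤ : ∀ a c → [0, T ] a → [0, T ] c → a ≤ c → F c ≤ F a + (h a + L H * (c - a)) * (c - a)
      F-increment-≤ a c Da Dc a≤c = F-least c Dc _ λ { v (p , (p0 , sub) , v≈) → ≤-respˡ-≈ (sym v≈)
        (≤-by (0≤diff (F-upper a Da (p a) (p , (p0 , sub) , refl)) ⊕ 0≤diff (sub a c Da Dc a≤c))
          (solve 4 (λ F q pa pc → (F :+ q) :- pc := (F :- pa) :+ (q :- (pc :- pa))) refl (F a) _ (p a) (p c))) }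

    -- A subfunction p can be continued beyond a by the lower estimate.
    module Extend (p : Carrier → Carrier) (p-sub : Sub p) (a : Carrier) (Da : [0, T ] a) where
      low : Carrier → Carrier
      low s = (h a - L H * (s - a)) * (s - a)

      p? : ∀ s → Dec (s ≤ a) → Carrier
      p? s (yes _) = p s
      p? s (no _)  = p a + low s

      p⁺ : Carrier → Carrier
      p⁺ s = p? s em

      p⁺-0 : (d : Dec (0# ≤ a)) → p? 0# d ≈ 0#
      p⁺-0 (yes _)  = proj₁ p-sub
      p⁺-0 (no 0≰a) = ⊥-elim (0≰a (proj₁ Da))

      -- Beyond a the graph of `low` is a parabola whose slope falls at rate 2 L, faster than `h`
      -- can fall, so its increments stay below the permitted ones. When a lies between s and t, the
      -- estimate of `p` up to a is followed by comparing h s with h a.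
      p⁺-sub : ∀ s t → (d : Dec (s ≤ a)) (e : Dec (t ≤ a)) → [0, T ] s → [0, T ] t → s ≤ t →
        p? t e - p? s d ≤ (h s + L H * (t - s)) * (t - s)
      p⁺-sub s t (yes s≤a) (yes t≤a) Ds Dt s≤t = proj₂ p-sub s t Ds Dt s≤t
      p⁺-sub s t (no s≰a) (yes t≤a) Ds Dt s≤t = ⊥-elim (s≰a (≤-trans s≤t t≤a))
      p⁺-sub s t (yes s≤a) (no t≰a) Ds Dt s≤t =
        ≤-by (0≤diff (proj₂ p-sub s a Ds Da s≤a) ⊕ h-near′ Ds Da s≤a ⊗ v ⊕ 0≤L H ⊗ (u ⊗ v ⊕ (v ⊗ v ⊕ v ⊗ v)))
          (solve 8 (λ L hs ha ps pa s a t →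
              (hs :+ L :* (t :- s)) :* (t :- s) :- ((pa :+ (ha :- L :* (t :- a)) :* (t :- a)) :- ps) :=
              (((hs :+ L :* (a :- s)) :* (a :- s) :- (pa :- ps)) :+ (hs :- ha :+ L :* (a :- s)) :* (t :- a))
                :+ L :* ((a :- s) :* (t :- a) :+ ((t :- a) :* (t :- a) :+ (t :- a) :* (t :- a))))
            refl (L H) (h s) (h a) (p s) (p a) s a t)
        where
        u : 0# ≤ a - s
        u = 0≤diff s≤a
        v : 0# ≤ t - a
        v = 0≤diff (proj₁ (≰⇒> t≰a))
      p⁺-sub s t (no s≰a) (no t≰a) Ds Dt s≤t =
        ≤-by (h-near Da Ds a≤s ⊗ v ⊕ 0≤L H ⊗ (u ⊗ v ⊕ (v ⊗ v ⊕ v ⊗ v)))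
          (solve 7 (λ L hs ha pa s a t →
              (hs :+ L :* (t :- s)) :* (t :- s) :- ((pa :+ (ha :- L :* (t :- a)) :* (t :- a)) :- (pa :+ (ha :- L :* (s :- a)) :* (s :- a))) :=
              (hs :- ha :+ L :* (s :- a)) :* (t :- s)
                :+ L :* ((s :- a) :* (t :- s) :+ ((t :- s) :* (t :- s) :+ (t :- s) :* (t :- s))))
            refl (L H) (h s) (h a) (p a) s a t)
        where
        a≤s : a ≤ s
        a≤s = proj₁ (≰⇒> s≰a)
        u : 0# ≤ s - a
        u = 0≤diff a≤s
        v : 0# ≤ t - s
        v = 0≤diff s≤t

      p⁺-≥ : ∀ c → (d : Dec (c ≤ a)) → [0, T ] c → a ≤ c → p a + low c ≤ p? c d
      p⁺-≥ c (no _) Dc a≤c = ≤-refl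
      -- Here c ≈ a, but `p` is not assumed to respect `_≈_`; its own estimate from c to a still
      -- gives p a ≤ p c.
      p⁺-≥ c (yes c≤a) Dc a≤c = ≤-by (0≤diff (proj₂ p-sub c a Dc Da c≤a))
        (trans (+-congˡ (-‿cong (+-congˡ (trans (*-congˡ c-a≈0) (zeroʳ _)))))
          (trans (solve 2 (λ pc pa → pc :- (pa :+ :0) := :0 :- (pa :- pc)) refl (p c) (p a))
            (+-congʳ (sym (trans (*-congˡ a-c≈0) (zeroʳ _))))))
        where
        a≈c : a ≈ c
        a≈c = ≤-antisym a≤c c≤a
        c-a≈0 : c - a ≈ 0#
        c-a≈0 = trans (+-congˡ (-‿cong a≈c)) (-‿inverseʳ c)
        a-c≈0 : a - c ≈ 0#
        a-c≈0 = trans (+-congʳ a≈c) (-‿inverseʳ c)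

      extended : ∀ c → [0, T ] c → a ≤ c → p a + low c ≤ F c
      extended c Dc a≤c = ≤-trans (p⁺-≥ c em Dc a≤c)
        (F-upper c Dc (p⁺ c) (p⁺ , (p⁺-0 em , λ s t → p⁺-sub s t em em) , refl))

    opaque
      -- Every subfunction, continued from a by `low`, competes for the supremum at c. Hence F c -
      -- low c bounds all values p a, and therefore F a.
      F-increment-≥ : ∀ a c → [0, T ] a → [0, T ] c → a ≤ c → F a + (h a - L H * (c - a)) * (c - a) ≤ F c
      F-increment-≥ a c Da Dc a≤c = ≤-by
        (0≤diff (F-least a Da (F c - (h a - L H * (c - a)) * (c - a)) λ { v (p , p-sub , v≈) → ≤-respˡ-≈ (sym v≈)
          (≤-by (0≤diff (Extend.extended p p-sub a Da c Dc a≤c)) (solve 3 (λ F q p → (F :- q) :- p := F :- (p :+ q)) refl (F c) _ (p a))) }))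
        (solve 3 (λ Fc Fa q → Fc :- (Fa :+ q) := (Fc :- q) :- Fa) refl (F c) (F a) _)

      F-estimate : ∀ a c → [0, T ] a → [0, T ] c → a ≤ c → ∣ (F c - F a) - h a * (c - a) ∣ ≤ L H * ((c - a) * (c - a))
      F-estimate a c Da Dc a≤c = ∣∣-lub
        (≤-by (0≤diff (F-increment-≤ a c Da Dc a≤c))
          (solve 5 (λ Fc Fa h L z → L :* (z :* z) :- ((Fc :- Fa) :- h :* z) := (Fa :+ (h :+ L :* z) :* z) :- Fc) refl (F c) (F a) (h a) (L H) (c - a)))
        (≤-by (0≤diff (F-increment-≥ a c Da Dc a≤c))
          (solve 5 (λ Fc Fa h L z → L :* (z :* z) :- :- ((Fc :- Fa) :- h :* z) := Fc :- (Fa :+ (h :- L :* z) :* z)) refl (F c) (F a) (h a) (L H) (c - a)))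

      F-deriv : ∀ a → [0, T ] a → HasDerivative [0, T ] F (h a) a
      F-deriv a Da = quadratic⇒littleO {[0, T ]} {a} (L H + L H) 1# (0≤L H ⊕ 0≤L H) 0<1 λ y Dy _ → either y Dy (≤-total a y)
        where
        either : ∀ y → [0, T ] y → a ≤ y ⊎ y ≤ a → ∣ (F y - F a) - h a * (y - a) ∣ ≤ (L H + L H) * (∣ y - a ∣ * ∣ y - a ∣)
        either y Dy (inj₁ a≤y) = ≤-respʳ-≈ (*-congˡ (sym (∣a∣∣a∣≈ (y - a)))) (≤-trans (F-estimate a y Da Dy a≤y)
          (≤-by (0≤L H ⊗ 0≤sq (y - a)) (solve 2 (λ L q → (L :+ L) :* q :- L :* q := L :* q) refl (L H) _)))
        -- To the left of a the estimate is anchored at y. Replacing the slope h y by h a costs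
        -- another L (a - y)², whence the constant L + L.
        either y Dy (inj₂ y≤a) = ≤-respˡ-≈
          (trans (sym (∣∣-neg _)) (∣∣-cong (solve 6 (λ Fy Fa hy ha y a →
            :- (((Fa :- Fy) :- hy :* (a :- y)) :+ (hy :- ha) :* (a :- y)) := (Fy :- Fa) :- ha :* (y :- a)) refl (F y) (F a) (h y) (h a) y a)))
          (≤-trans (∣a+b∣≤ _ _) (≤-trans (+-mono-≤ (F-estimate y a Dy Da y≤a)
              (∣ab∣≤ (lipschitz H y a Dy Da) (≤-reflexive (∣a-b∣≈∣b-a∣ a y))))
            (≤-reflexive (trans (+-congˡ (*-assoc (L H) _ _)) (trans (+-congʳ (*-congˡ
                (trans (solve 2 (λ y a → (a :- y) :* (a :- y) := (y :- a) :* (y :- a)) refl y a) (sym (∣a∣∣a∣≈ (y - a))))))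
              (sym (distribʳ _ (L H) (L H))))))))

  -- Riemann integrals of Lipschitz functions with a given antiderivative.

  module _ {T : Carrier} {h F : Carrier → Carrier} (H : BoundedLipschitz [0, T ] h)
           (F′ : ∀ t → [0, T ] t → HasDerivative [0, T ] F (h t) t) where

    partition-≤ : ∀ {a b} → TaggedPartition b a → a ≤ b
    partition-≤ (stop a≈b) = ≤-reflexive a≈b
    partition-≤ (step ξ c a≤ξ ξ≤c π) = ≤-trans a≤ξ (≤-trans ξ≤c (partition-≤ π))

    opaque
      primitive-estimate : ∀ {a b} → [0, T ] a → [0, T ] b → ∣ (F b - F a) - h a * (b - a) ∣ ≤ L H * (∣ b - a ∣ * ∣ b - a ∣)
      primitive-estimate = taylor-∣∣ [0,]-convex F′ (0≤L H) (lipschitz H)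

      -- Moving the tag from ξ to a costs at most L δ (c - a), and so does the Taylor estimate at a.
      -- Summed over a partition, the increments of `F` telescope.
      step-estimate : ∀ {a ξ c δ} → [0, T ] a → [0, T ] c → a ≤ ξ → ξ ≤ c → c - a < δ →
        ∣ h ξ * (c - a) - (F c - F a) ∣ ≤ (L H + L H) * δ * (c - a)
      step-estimate {a} {ξ} {c} {δ} Da Dc a≤ξ ξ≤c c-a<δ = ≤-respˡ-≈
        (∣∣-cong (solve 5 (λ hξ ha Fc Fa z → (hξ :- ha) :* z :- ((Fc :- Fa) :- ha :* z) := hξ :* z :- (Fc :- Fa)) refl (h ξ) (h a) (F c) (F a) (c - a)))
        (≤-trans (∣a-b∣≤ _ _) (≤-respʳ-≈ (solve 3 (λ L δ z → L :* δ :* z :+ L :* (δ :* z) := (L :+ L) :* δ :* z) refl (L H) δ (c - a)) (+-mono-≤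
          (∣ab∣≤ (≤-trans (lipschitz H ξ a Dξ Da) (*-monoˡ-≤ (0≤L H) (≤-respˡ-≈ (sym (0≤⇒∣∣≈ (0≤diff a≤ξ)))
                   (≤-trans (+-monoˡ-≤ (- a) ξ≤c) (proj₁ c-a<δ))))) (≤-reflexive ∣z∣≈))
          (≤-trans (primitive-estimate Da Dc) (*-monoˡ-≤ (0≤L H)
            (*-mono-≤ (0≤∣∣ _) (≤-respˡ-≈ (sym ∣z∣≈) (proj₁ c-a<δ)) (0≤∣∣ _) (≤-reflexive ∣z∣≈)))))))
        where
        Dξ : [0, T ] ξ
        Dξ = [0,]-convex Da Dc a≤ξ ξ≤c
        ∣z∣≈ : ∣ c - a ∣ ≈ c - a
        ∣z∣≈ = 0≤⇒∣∣≈ (0≤diff (≤-trans a≤ξ ξ≤c))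

      riemannSum-estimate : ∀ {a b δ} → [0, T ] a → [0, T ] b → (π : TaggedPartition b a) → MeshBelow δ π →
        ∣ riemannSum h π - (F b - F a) ∣ ≤ (L H + L H) * δ * (b - a)
      -- The endpoints agree only up to `_≈_`; the Taylor estimate at distance 0 gives F b ≈ F a.
      riemannSum-estimate {a} {b} {δ} Da Db (stop a≈b) _ = ≤-respˡ-≈
        (trans (sym (∣∣-neg _)) (∣∣-cong (trans (-‿cong (+-congˡ (-‿cong (trans (*-congˡ b-a≈0) (zeroʳ (h a))))))
          (solve 1 (λ q → :- (q :- :0) := :0 :- q) refl (F b - F a)))))
        (≤-trans (primitive-estimate Da Db) (≤-reflexive (trans (*-congˡ (trans (∣a∣∣a∣≈ _) (trans (*-congˡ b-a≈0) (zeroʳ _))))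
          (trans (zeroʳ (L H)) (sym (trans (*-congˡ b-a≈0) (zeroʳ _)))))))
        where
        b-a≈0 : b - a ≈ 0#
        b-a≈0 = trans (+-congˡ (-‿cong a≈b)) (-‿inverseʳ b)
      riemannSum-estimate {a} {b} {δ} Da Db (step ξ c a≤ξ ξ≤c π) (c-a<δ , mesh) = ≤-respˡ-≈
        (∣∣-cong (solve 5 (λ t r Fa Fb Fc → (t :- (Fc :- Fa)) :+ (r :- (Fb :- Fc)) := (t :+ r) :- (Fb :- Fa)) refl (h ξ * (c - a)) (riemannSum h π) (F a) (F b) (F c)))
        (≤-trans (∣a+b∣≤ _ _) (≤-trans (+-mono-≤ (step-estimate Da Dc a≤ξ ξ≤c c-a<δ) (riemannSum-estimate Dc Db π mesh))
          (≤-reflexive (solve 4 (λ K a b c → K :* (c :- a) :+ K :* (b :- c) := K :* (b :- a)) refl ((L H + L H) * δ) a b c))))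
        where
        Dc : [0, T ] c
        Dc = [0,]-convex Da Db (≤-trans a≤ξ ξ≤c) (partition-≤ π)

      isIntegral : F 0# ≈ 0# → ∀ t → [0, T ] t → IsIntegral h 0# t (F t)
      isIntegral F0≈0 t Dt ε 0<ε =
        let δ , 0<δ , Kδ≤½ε = shrink ((0≤L H ⊕ 0≤L H) ⊗ proj₁ Dt) (0<* 0<½ 0<ε)
        in δ , 0<δ , λ π mesh → ≤-<-trans
             (≤-respˡ-≈ (∣∣-cong (+-congˡ (-‿cong (trans (+-congˡ (-‿cong F0≈0)) (solve 1 (λ q → q :- :0 := q) refl (F t))))))
               (≤-trans (riemannSum-estimate (≤-refl , ≤-trans (proj₁ Dt) (proj₂ Dt)) Dt π mesh)
                 (≤-respˡ-≈ (solve 3 (λ K t δ → K :* t :* δ := K :* δ :* (t :- :0)) refl (L H + L H) t δ) Kδ≤½ε)))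
             (½<1 0<ε)

  -- Grönwall: y² exp(-2Kt) is nonincreasing.
  linear-ode-unique : ∀ {T K} {y a : Carrier → Carrier} → 0# ≤ T → y 0# ≈ 0# →
    (∀ t → [0, T ] t → HasDerivative [0, T ] y (a t * y t) t) → (∀ t → [0, T ] t → a t ≤ K) → y T ≈ 0#
  linear-ode-unique {T} {K} {y} {a} 0≤T y0≈0 y′ a≤K = decidable-stable em λ yT≉0 →
      <⇒≱ (0<* (0≤sq (y T) , λ 0≈ → *-nonzero yT≉0 yT≉0 (sym 0≈)) (0<exp (c * T))) u-T≤0
    where
    c : Carrier
    c = - (2# * K)
    u : Carrier → Carrier
    u t = y t * y t * exp (c * t)
    d : Carrier → Carrier
    d t = (a t * y t * y t + y t * (a t * y t)) * exp (c * t) + y t * y t * (exp (c * t) * c)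
    ct-bounded : ∀ t → [0, T ] t → ∣ c * t ∣ ≤ ∣ c ∣ * T
    ct-bounded t Dt = ∣ab∣≤ ≤-refl (≤-respˡ-≈ (sym (0≤⇒∣∣≈ (proj₁ Dt))) (proj₂ Dt))
    u′ : ∀ t → [0, T ] t → HasDerivative [0, T ] u (d t) t
    u′ t Dt = deriv-* {h = λ t → y t * y t} (deriv-* (y′ t Dt) (y′ t Dt))
      (deriv-exp (∣ c ∣ * T) Dt ct-bounded (deriv-cong (*-identityʳ c) (deriv-scale c deriv-id)))
    d≤0 : ∀ t → [0, T ] t → d t ≤ 0#
    d≤0 t Dt = ≤-by (proj₁ 0<2 ⊗ (0≤diff (a≤K t Dt) ⊗ (0≤sq (y t) ⊗ proj₁ (0<exp (c * t)))))
      (solve 4 (λ a y e K → :0 :- ((a :* y :* y :+ y :* (a :* y)) :* e :+ y :* y :* (e :* :- (:2 :* K))) := :2 :* ((K :- a) :* (y :* y :* e)))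
        refl (a t) (y t) (exp (c * t)) K)
    u-T≤0 : u T ≤ 0#
    u-T≤0 = ≤-trans (decreasing {[0, T ]} {u} {d} [0,]-convex u′ (≤-refl , 0≤T) (0≤T , ≤-refl) 0≤T
              (λ t 0≤t t≤T → 0≤-neg (d≤0 t (0≤t , t≤T))))
          (≤-reflexive (trans (*-congʳ (trans (*-congʳ y0≈0) (zeroˡ _))) (zeroˡ _)))

  opaque
    -- With `exp (Q t)` as integrating factor, the derivative of `K` contributes exp(-Q) exp(Q) p =
    -- p. The function `K` is a parameter, so that the lemma serves both `g` and `n`.
    variation-of-constants : ∀ {D Q K q p y₀ a} M → D a → (∀ y → D y → ∣ Q y ∣ ≤ M) →
      HasDerivative D Q q a → HasDerivative D K (exp (Q a) * p) a →
      HasDerivative D (λ t → exp (- Q t) * (y₀ + K t)) (p - q * (exp (- Q a) * (y₀ + K a))) a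
    variation-of-constants {D} {Q} {K} {q} {p} {y₀} {a} M Da Q≤M Q′ K′ = deriv-cong
      (trans (solve 6 (λ e E q p y K → (e :* :- q) :* (y :+ K) :+ e :* (:0 :+ E :* p) := (E :* e) :* p :- q :* (e :* (y :+ K)))
          refl (exp (- Q a)) (exp (Q a)) q p y₀ (K a))
        (+-congʳ (trans (*-congʳ (exp-inverse (Q a))) (*-identityˡ p))))
      (deriv-* {h = λ t → exp (- Q t)} {k = λ t → y₀ + K t}
        (deriv-exp M Da (λ y Dy → ≤-respˡ-≈ (sym (∣∣-neg (Q y))) (Q≤M y Dy)) (deriv-neg Q′))
        (deriv-+ (deriv-const y₀) K′))

    -- From z k = 1 follows k y - k a = - k y k a (z y - z a). Used twice, this writes the remainder
    -- as k y (k a)² (z y - z a)² minus (k a)² times the remainder of z. The bound 1 on k fits a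
    -- reciprocal of a function that is at least 1.
    deriv-reciprocal : ∀ {D z k d a} → D a → (∀ y → D y → z y * k y ≈ 1#) → (∀ y → D y → ∣ k y ∣ ≤ 1#) →
      HasDerivative D z d a → HasDerivative D k (- (k a * k a * d)) a
    deriv-reciprocal {D} {z} {k} {d} {a} Da zk≈1 k≤1 z′ = littleO-cong {D} {a}
      (λ y Dy → trans (solve 6 (λ ky ka zy za d Δ →
            ((ky :* ka :* ka) :* ((zy :- za) :* (zy :- za)) :+ (:- (ka :* ka)) :* ((zy :- za) :- d :* Δ)) :=
            (:- (ka :* (zy :- za))) :* (:- (ky :* ka :* (zy :- za))) :+ (:- (ka :* ka)) :* ((zy :- za) :- d :* Δ))
          refl (k y) (k a) (z y) (z a) d (y - a))
        (trans (+-congʳ (*-congˡ (sym (lemma y Dy))))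
          (trans (solve 6 (λ ky ka zy za d Δ →
              (:- (ka :* (zy :- za))) :* (ky :- ka) :+ (:- (ka :* ka)) :* ((zy :- za) :- d :* Δ) :=
              :- (ky :* ka :* (zy :- za)) :- :- (ka :* ka :* d) :* Δ) refl (k y) (k a) (z y) (z a) d (y - a))
            (+-congʳ (sym (lemma y Dy))))))
      (littleO-+ {D} {a}
        (littleO-bounded-* {D} {a} (λ y → k y * k a * k a) (1# * 1# * 1#) (0≤1 ⊗ 0≤1 ⊗ 0≤1)
          (λ y Dy → ∣ab∣≤ (∣ab∣≤ (k≤1 y Dy) (k≤1 a Da)) (k≤1 a Da))
          (bigO-* {D} {a} (increment-bigO z′) (increment-bigO z′)))
        (littleO-scale {D} {a} (- (k a * k a)) z′))
      where
      lemma : ∀ y → D y → k y - k a ≈ - (k y * k a * (z y - z a))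
      lemma y Dy = trans (+-cong (sym (trans (*-congˡ (zk≈1 a Da)) (*-identityʳ (k y))))
                                (-‿cong (sym (trans (*-congˡ (zk≈1 y Dy)) (*-identityʳ (k a))))))
        (solve 4 (λ ky ka zy za → ky :* (za :* ka) :- ka :* (zy :* ky) := :- (ky :* ka :* (zy :- za))) refl (k y) (k a) (z y) (z a))

    lipschitz-vanishes-at-end : ∀ {T k} → 0# < T → BoundedLipschitz [0, T ] k → (∀ t → [0, T ⟩ t → k t ≈ 0#) → k T ≈ 0#
    lipschitz-vanishes-at-end {T} {k} 0<T K k≈0 = ∣a∣≤0⇒a≈0 (≤-by-ε (0≤L K) λ ε 0<ε →
      let δ , 0<δ , δ≤ε , δ≤T = min⁺ 0<ε 0<T
          t = T - δ
          0≤t = 0≤diff δ≤T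
          t<T = <-by 0<δ (solve 2 (λ T δ → T :- (T :- δ) := δ) refl T δ)
      in ≤-trans (≤-respˡ-≈ (∣∣-cong (trans (+-congˡ (-‿cong (k≈0 t (0≤t , t<T)))) (solve 1 (λ k → k :- :0 := k) refl (k T))))
           (lipschitz K T t (proj₁ 0<T , ≤-refl) (0≤t , proj₁ t<T)))
         (≤-respˡ-≈ (*-congˡ (sym (trans (∣∣-cong (solve 2 (λ T δ → T :- (T :- δ) := δ) refl T δ)) (0≤⇒∣∣≈ (proj₁ 0<δ)))))
           (≤-respʳ-≈ (trans (*-comm (L K) ε) (sym (+-identityˡ _))) (*-monoˡ-≤ (0≤L K) δ≤ε))))

  -- The ring solver proves identities only. An equality that depends on the relation f s₂ = 1 is
  -- reduced to one by supplying the cofactor c of f s₂ - 1.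
  ≈-by-relation : ∀ {r a b} c → r ≈ 1# → a - b ≈ (r - 1#) * c → a ≈ b
  ≈-by-relation {r} c r≈1 eq = a-b≈0⇒a≈b (trans eq (trans (*-congʳ (trans (+-congʳ r≈1) (-‿inverseʳ 1#))) (zeroˡ c)))

  -- The system up to its explosion time.

  module Explosion (x : Carrier → Carrier) (isX : Equations.IsX x) (tc : Carrier) (0<tc : 0# < tc)
                   (s₂ : Carrier → Carrier) (isS₂ : Equations.IsS₂ x [0, tc ⟩ s₂) (s₂→∞ : TendsTo+∞ tc s₂) where

    open Equations x

    ⟨⊆] : ∀ t → [0, tc ⟩ t → [0, tc ] t
    ⟨⊆] t (0≤t , t<tc) = 0≤t , proj₁ t<tc

    q : Carrier → Carrier
    q t = x t ^ 2

    opaque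
      0<x : ∀ {t} → 0# ≤ t → 0# < x t
      0<x {t} 0≤t = proj₁ (proj₂ isX t 0≤t)

      x≤1 : ∀ {t} → 0# ≤ t → x t ≤ 1#
      x≤1 {t} 0≤t = proj₂ (proj₂ isX t 0≤t)

      0≤^2 : ∀ a → 0# ≤ a ^ 2
      0≤^2 a = ≤-respʳ-≈ (*-congˡ (sym (*-identityʳ a))) (0≤sq a)

      ^2≤1 : ∀ {a} → 0# ≤ a → a ≤ 1# → a ^ 2 ≤ 1#
      ^2≤1 {a} 0≤a a≤1 = ≤-by (0≤diff a≤1 ⊕ 0≤a ⊗ 0≤diff a≤1) (solve 1 (λ a → :1 :- a :^ 2 := (:1 :- a) :+ a :* (:1 :- a)) refl a)

      0≤q : ∀ t → 0# ≤ q t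
      0≤q t = 0≤^2 (x t)

      q≤1 : ∀ {t} → 0# ≤ t → q t ≤ 1#
      q≤1 0≤t = ^2≤1 (proj₁ (0<x 0≤t)) (x≤1 0≤t)

      0≤1-q : ∀ {t} → 0# ≤ t → 0# ≤ 1# - q t
      0≤1-q 0≤t = 0≤diff (q≤1 0≤t)

      x-deriv : ∀ t → [0, tc ] t → HasDerivative [0, tc ] x (- (x t ^ 2) - (1# - x t ^ 2) * x t) t
      x-deriv t Dt = deriv-⊆ (λ _ → proj₁) (proj₂ (proj₁ isX) t (proj₁ Dt))

      x-bl : BoundedLipschitz [0, tc ] x
      x-bl = bl-deriv {d = λ t → - (x t ^ 2) - (1# - x t ^ 2) * x t} 2# (proj₁ 0<tc) (proj₁ 0<2) x-deriv λ t Dt →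
        let 0≤t = proj₁ Dt in ∣∣-lub
        (≤-by (proj₁ 0<2 ⊕ (0≤q t ⊕ 0≤1-q 0≤t ⊗ proj₁ (0<x 0≤t)))
          (solve 3 (λ t q x → t :- (:- q :- (:1 :- q) :* x) := t :+ (q :+ (:1 :- q) :* x)) refl 2# (q t) (x t)))
        (≤-by (0≤1-q 0≤t ⊕ 0≤diff (x≤1 0≤t) ⊕ 0≤q t ⊗ proj₁ (0<x 0≤t))
          (solve 2 (λ q x → :2 :- :- (:- q :- (:1 :- q) :* x) := (:1 :- q) :+ (:1 :- x) :+ q :* x) refl (q t) (x t)))

      q-bl : BoundedLipschitz [0, tc ] (λ t → x t ^ 2)
      q-bl = bl-^ 2 x-bl

      0≤tc : 0# ≤ tc
      0≤tc = proj₁ 0<tc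

      x-antitone : ∀ {t} → 0# ≤ t → t ≤ tc → x tc ≤ x t
      x-antitone {t} 0≤t t≤tc = decreasing [0,]-convex x-deriv (0≤t , t≤tc) (0≤tc , ≤-refl) t≤tc λ u t≤u _ →
        ≤-respʳ-≈ (solve 2 (λ q x → q :+ (:1 :- q) :* x := :- (:- q :- (:1 :- q) :* x)) refl (q u) (x u))
          (0≤q u ⊕ 0≤1-q (≤-trans 0≤t t≤u) ⊗ proj₁ (0<x (≤-trans 0≤t t≤u)))

      -- x′ ≤ -x² ≤ -x(tc)² on [0, tc].
      x-tc<1 : x tc < 1#
      x-tc<1 = <-≤-trans (<-by (0<* (0<* 0<X 0<X) 0<tc) (solve 2 (λ X e → (X :+ e) :- X := e) refl X (X * X * tc)))
        (≤-by (0≤diff (MeanValue.increment-≤ [0,]-convex x-deriv {K = - (X * X)} (≤-refl , 0≤tc) (0≤tc , ≤-refl) 0≤tc slope))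
          (trans (+-congʳ (sym (proj₁ (proj₁ isX))))
            (solve 3 (λ x0 X T → x0 :- (X :+ X :* X :* T) := :- (X :* X) :* (T :- :0) :- (X :- x0)) refl (x 0#) X tc)))
        where
        X : Carrier
        X = x tc
        0<X : 0# < X
        0<X = 0<x 0≤tc
        slope : ∀ t → 0# ≤ t → t ≤ tc → - (x t ^ 2) - (1# - x t ^ 2) * x t ≤ - (X * X)
        slope t 0≤t t≤tc = ≤-by (0≤diff (*-mono-≤ (proj₁ 0<X) (x-antitone 0≤t t≤tc) (proj₁ 0<X) (x-antitone 0≤t t≤tc)) ⊕ 0≤1-q 0≤t ⊗ proj₁ (0<x 0≤t))
          (solve 2 (λ X x → :- (X :* X) :- (:- (x :^ 2) :- (:1 :- x :^ 2) :* x) := (x :* x :- X :* X) :+ (:1 :- x :^ 2) :* x) refl X (x t))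

    κ : Carrier
    κ = 1# - x tc ^ 2

    α : Carrier
    α = κ ⁻¹

    opaque
      0<κ : 0# < κ
      0<κ = <-respʳ (solve 1 (λ X → (:1 :- X) :* (:1 :+ X) := :1 :- X :^ 2) refl (x tc))
        (0<* (<⇒0<diff x-tc<1) (0<+ˡ 0<1 (proj₁ (0<x 0≤tc))))

      0<α : 0# < α
      0<α = 0<⁻¹ 0<κ

      -- Stated for any solution, since uniqueness needs the bound for the competitor of `s₂` as
      -- well.
      s₂-mono : ∀ z → IsS₂ [0, tc ⟩ z → ∀ {a b} → [0, tc ⟩ a → [0, tc ⟩ b → a ≤ b → z a ≤ z b
      s₂-mono z (_ , z′) {a} {b} Da Db a≤b = increasing [0,⟩-convex z′ Da Db a≤b
        (λ t a≤t _ → 0≤q t ⊕ 0≤1-q (≤-trans (proj₁ Da) a≤t) ⊗ 0≤^2 (z t))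

      1≤s₂ : ∀ z → IsS₂ [0, tc ⟩ z → ∀ {t} → [0, tc ⟩ t → 1# ≤ z t
      1≤s₂ z isz@(z0 , _) Dt = ≤-respˡ-≈ z0 (s₂-mono z isz (≤-refl , 0<tc) Dt (proj₁ Dt))

      0<s₂ : ∀ {t} → [0, tc ⟩ t → 0# < s₂ t
      0<s₂ Dt = <-≤-trans 0<1 (1≤s₂ s₂ isS₂ Dt)

    -- The reciprocal of s₂, extended to the explosion time.

    f? : ∀ t → Dec (t < tc) → Carrier
    f? t (yes _) = s₂ t ⁻¹
    -- The limit of 1 / s₂ at `tc`, so that the extension is continuous there.
    f? t (no _)  = 0#

    opaque
      f : Carrier → Carrier
      f t = f? t em

      f-below : ∀ {t} → t < tc → f t ≈ s₂ t ⁻¹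
      f-below {t} t<tc = by em
        where
        by : (d : Dec (t < tc)) → f? t d ≈ s₂ t ⁻¹
        by (yes _) = refl
        by (no t≮tc) = ⊥-elim (t≮tc t<tc)

      f-end : ∀ {t} → tc ≤ t → f t ≈ 0#
      f-end {t} tc≤t = by em
        where
        by : (d : Dec (t < tc)) → f? t d ≈ 0#
        by (yes t<tc) = ⊥-elim (<⇒≱ t<tc tc≤t)
        by (no _) = refl

    opaque
      f-tc : f tc ≈ 0#
      f-tc = f-end ≤-refl

      s₂f≈1 : ∀ t → [0, tc ⟩ t → s₂ t * f t ≈ 1#
      s₂f≈1 t Dt = trans (*-congˡ (f-below (proj₂ Dt))) (*-inverse-pos (0<s₂ Dt))

      fs₂≈1 : ∀ t → [0, tc ⟩ t → f t * s₂ t ≈ 1#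
      fs₂≈1 t Dt = trans (*-comm _ _) (s₂f≈1 t Dt)

      0<f : ∀ {t} → [0, tc ⟩ t → 0# < f t
      0<f Dt = <-respʳ (sym (f-below (proj₂ Dt))) (0<⁻¹ (0<s₂ Dt))

      f≤1 : ∀ {t} → [0, tc ⟩ t → f t ≤ 1#
      f≤1 {t} Dt = ≤-by (proj₁ (0<f Dt) ⊗ 0≤diff (1≤s₂ s₂ isS₂ Dt))
        (trans (+-congʳ (sym (fs₂≈1 t Dt))) (solve 2 (λ f s → f :* s :- f := f :* (s :- :1)) refl (f t) (s₂ t)))

      split : ∀ {t} → [0, tc ] t → [0, tc ⟩ t ⊎ tc ≤ t
      split {t} (0≤t , t≤tc) = by (≤⊎> tc t)
        where
        by : tc ≤ t ⊎ t < tc → [0, tc ⟩ t ⊎ tc ≤ t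
        by (inj₁ tc≤t) = inj₂ tc≤t
        by (inj₂ t<tc) = inj₁ (0≤t , t<tc)

      0≤f : ∀ {t} → [0, tc ] t → 0# ≤ f t
      0≤f {t} Dt = by (split Dt)
        where
        by : [0, tc ⟩ t ⊎ tc ≤ t → 0# ≤ f t
        by (inj₁ Dt)   = proj₁ (0<f Dt)
        by (inj₂ tc≤t) = ≤-reflexive (sym (f-end tc≤t))

      f≤1′ : ∀ {t} → [0, tc ] t → f t ≤ 1#
      f≤1′ {t} Dt = by (split Dt)
        where
        by : [0, tc ⟩ t ⊎ tc ≤ t → f t ≤ 1#
        by (inj₁ Dt)   = f≤1 Dt
        by (inj₂ tc≤t) = ≤-trans (≤-reflexive (f-end tc≤t)) 0≤1

      f-0 : f 0# ≈ 1#
      f-0 = trans (f-below 0<tc) (trans (⁻¹-cong (proj₁ isS₂)) (sym (⁻¹-unique (*-identityʳ 1#))))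

    f-rhs : Carrier → Carrier
    f-rhs t = - (x t ^ 2 * f t ^ 2) - (1# - x t ^ 2)

    opaque
      f-deriv⟨ : ∀ t → [0, tc ⟩ t → HasDerivative [0, tc ⟩ f (f-rhs t) t
      f-deriv⟨ t Dt = deriv-cong
        (≈-by-relation (- ((1# - q t) * (s₂ t * f t + 1#))) (s₂f≈1 t Dt)
          (solve 3 (λ q s f → :- (f :* f :* (q :+ (:1 :- q) :* s :^ 2)) :- (:- (q :* f :^ 2) :- (:1 :- q)) :=
              (s :* f :- :1) :* :- ((:1 :- q) :* (s :* f :+ :1))) refl (q t) (s₂ t) (f t)))
        (deriv-reciprocal {z = s₂} Dt s₂f≈1 (λ y Dy → ≤-respˡ-≈ (sym (0≤⇒∣∣≈ (proj₁ (0<f Dy)))) (f≤1 Dy)) (proj₂ isS₂ t Dt))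

      f-rhs-bound : ∀ t → [0, tc ] t → ∣ f-rhs t ∣ ≤ 1#
      f-rhs-bound t Dt = ∣∣-lub
        (≤-by (0≤1 ⊕ (0≤q t ⊗ 0≤^2 (f t) ⊕ 0≤1-q (proj₁ Dt)))
          (solve 2 (λ q r → :1 :- (:- (q :* r) :- (:1 :- q)) := :1 :+ (q :* r :+ (:1 :- q))) refl (q t) (f t ^ 2)))
        (≤-by (0≤q t ⊗ 0≤diff (^2≤1 (0≤f Dt) (f≤1′ Dt)))
          (solve 2 (λ q r → :1 :- :- (:- (q :* r) :- (:1 :- q)) := q :* (:1 :- r)) refl (q t) (f t ^ 2)))

      f-lipschitz⟨ : ∀ s t → [0, tc ⟩ s → [0, tc ⟩ t → ∣ f s - f t ∣ ≤ 1# * ∣ s - t ∣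
      f-lipschitz⟨ s t Ds Dt = increment-∣∣ {d = f-rhs} [0,⟩-convex f-deriv⟨ Dt Ds (λ u Du _ → f-rhs-bound u (⟨⊆] u Du))

      -- The explosion enters here: s₂ exceeds η⁻¹ close to `tc`. If a is already that close, it
      -- serves as t itself; otherwise t = tc - ½ δ lies to its right.
      f-small : ∀ {a} η → [0, tc ⟩ a → 0# < η → Σ Carrier λ t → a ≤ t × [0, tc ⟩ t × f t ≤ η
      f-small {a} η Da 0<η = by (≤⊎> (tc - ½ * δ) a)
        where
        δ : Carrier
        δ = proj₁ (s₂→∞ (η ⁻¹))
        0<δ : 0# < δ
        0<δ = proj₁ (proj₂ (s₂→∞ (η ⁻¹)))
        large : ∀ t → [0, tc ⟩ t → tc - t < δ → η ⁻¹ < s₂ t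
        large = proj₂ (proj₂ (s₂→∞ (η ⁻¹)))
        small : ∀ t → [0, tc ⟩ t → tc - t < δ → f t ≤ η
        small t Dt near = ≤-by (proj₁ 0<η ⊗ (proj₁ (0<f Dt) ⊗ 0≤diff (proj₁ (large t Dt near))))
          (trans (+-cong (sym (trans (*-congˡ (fs₂≈1 t Dt)) (*-identityʳ η))) (-‿cong (sym (trans (*-congˡ (*-inverse-pos 0<η)) (*-identityʳ (f t))))))
            (solve 4 (λ η f s i → η :* (f :* s) :- f :* (η :* i) := η :* (f :* (s :- i))) refl η (f t) (s₂ t) (η ⁻¹)))
        by : tc - ½ * δ ≤ a ⊎ a < tc - ½ * δ → Σ Carrier λ t → a ≤ t × [0, tc ⟩ t × f t ≤ η
        by (inj₁ ≤a) = a , ≤-refl , Da , small a Da (≤-<-trans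
          (≤-by (0≤diff ≤a) (solve 3 (λ T a h → h :- (T :- a) := a :- (T :- h)) refl tc a (½ * δ))) (½<1 0<δ))
        by (inj₂ a<) = t , proj₁ a< , Dt , small t Dt (<-respˡ (solve 2 (λ T h → h := T :- (T :- h)) refl tc (½ * δ)) (½<1 0<δ))
          where
          t : Carrier
          t = tc - ½ * δ
          Dt : [0, tc ⟩ t
          Dt = ≤-trans (proj₁ Da) (proj₁ a<) , <-by (0<* 0<½ 0<δ) (solve 2 (λ T h → T :- (T :- h) := h) refl tc (½ * δ))

      -- On [0, tc) the function f is 1-Lipschitz and takes arbitrarily small values to the right of
      -- t, so f t is at most the time that remains. This carries the Lipschitz bound across the
      -- endpoint.
      f≤tc-t : ∀ t → [0, tc ⟩ t → f t ≤ tc - t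
      f≤tc-t t Dt = ≤-by-η λ η 0<η →
        let u , t≤u , Du , fu≤η = f-small η Dt 0<η
            fu-ft = ≤-respʳ-≈ (trans (*-identityˡ _) (0≤⇒∣∣≈ (0≤diff t≤u))) (f-lipschitz⟨ u t Du Dt)
        in ≤-by (0≤diff (≤-trans (-a≤∣a∣ (f u - f t)) fu-ft) ⊕ 0≤diff fu≤η ⊕ 0≤diff (proj₁ (proj₂ Du)))
             (solve 6 (λ fu ft u t T η → (T :- t :+ η) :- ft := ((u :- t) :- :- (fu :- ft)) :+ (η :- fu) :+ (T :- u)) refl (f u) (f t) u t tc η)

      f-lipschitz-end : ∀ s t → [0, tc ⟩ s → [0, tc ] t → tc ≤ t → ∣ f s - f t ∣ ≤ 1# * ∣ s - t ∣
      f-lipschitz-end s t Ds Dt tc≤t = ≤-respˡ-≈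
          (trans (sym (0≤⇒∣∣≈ (proj₁ (0<f Ds)))) (∣∣-cong (trans (solve 1 (λ f → f := f :- :0) refl (f s)) (+-congˡ (-‿cong (sym (f-end tc≤t)))))))
        (≤-respʳ-≈ (sym (*-identityˡ _)) (≤-trans (≤-trans (f≤tc-t s Ds)
            (≤-by (0≤diff tc≤t) (solve 3 (λ T s t → :- (s :- t) :- (T :- s) := t :- T) refl tc s t)))
          (-a≤∣a∣ (s - t))))

      f-bl : BoundedLipschitz [0, tc ] f
      f-bl = record
        { L = 1#
        ; 0≤L = 0≤1
        ; lipschitz = λ s t Ds Dt → by s t Ds Dt (split Ds) (split Dt)
        ; M = 1#
        ; 0≤M = 0≤1
        ; bounded = λ t Dt → ≤-respˡ-≈ (sym (0≤⇒∣∣≈ (0≤f Dt))) (f≤1′ Dt)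
        }
        where
        by : ∀ s t → [0, tc ] s → [0, tc ] t → [0, tc ⟩ s ⊎ tc ≤ s → [0, tc ⟩ t ⊎ tc ≤ t → ∣ f s - f t ∣ ≤ 1# * ∣ s - t ∣
        by s t _ _ (inj₁ Ds) (inj₁ Dt) = f-lipschitz⟨ s t Ds Dt
        by s t _ Dt (inj₁ Ds) (inj₂ tc≤t) = f-lipschitz-end s t Ds Dt tc≤t
        by s t Ds _ (inj₂ tc≤s) (inj₁ Dt) = ≤-respˡ-≈ (∣a-b∣≈∣b-a∣ (f t) (f s)) (≤-respʳ-≈ (*-congˡ (∣a-b∣≈∣b-a∣ t s)) (f-lipschitz-end t s Dt Ds tc≤s))
        by s t _ _ (inj₂ tc≤s) (inj₂ tc≤t) = ≤-respˡ-≈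
          (trans (sym (0≤⇒∣∣≈ ≤-refl)) (∣∣-cong (trans (solve 0 (:0 := :0 :- :0) refl) (+-cong (sym (f-end tc≤s)) (-‿cong (sym (f-end tc≤t)))))))
          (0≤1 ⊗ 0≤∣∣ (s - t))

      f-rhs-bl : BoundedLipschitz [0, tc ] f-rhs
      f-rhs-bl = bl-+ (bl-neg (bl-* q-bl (bl-^ 2 f-bl))) (bl-neg (bl-+ (bl-const 1#) (bl-neg q-bl)))

      -- f and 1 + ∫ f-rhs are Lipschitz on [0, tc] and agree on [0, tc).
      f-deriv : ∀ t → [0, tc ] t → HasDerivative [0, tc ] f (f-rhs t) t
      f-deriv t Dt = deriv-ext {h = λ t → 1# + A.F t} Dt (λ y Dy → sym (f≈ y Dy))
          (deriv-cong (+-identityˡ (f-rhs t)) (deriv-+ (deriv-const 1#) (A.F-deriv t Dt)))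
        where
        module A = Antiderivative 0≤tc f-rhs-bl
        F-bl : BoundedLipschitz [0, tc ] A.F
        F-bl = bl-deriv {d = f-rhs} 1# 0≤tc 0≤1 A.F-deriv f-rhs-bound
        gap : Carrier → Carrier
        gap t = f t - (1# + A.F t)
        gap⟨ : ∀ t → [0, tc ⟩ t → gap t ≈ 0#
        gap⟨ t Dt = trans (constant {[0, tc ⟩} {gap} {λ _ → 0#} [0,⟩-convex gap′ (λ _ _ → refl) (≤-refl , 0<tc) Dt)
          (trans (+-cong f-0 (-‿cong (+-congˡ A.F-0))) (solve 0 (:1 :- (:1 :+ :0) := :0) refl))
          where
          gap′ : ∀ t → [0, tc ⟩ t → HasDerivative [0, tc ⟩ gap 0# t
          gap′ t Dt = deriv-cong (solve 1 (λ r → r :- (:0 :+ r) := :0) refl (f-rhs t))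
            (deriv-- {k = λ t → 1# + A.F t} (f-deriv⟨ t Dt) (deriv-+ (deriv-const 1#) (deriv-⊆ ⟨⊆] (A.F-deriv t (⟨⊆] t Dt)))))
        gap-bl : BoundedLipschitz [0, tc ] gap
        gap-bl = bl-+ f-bl (bl-neg (bl-+ (bl-const 1#) F-bl))
        f≈ : ∀ t → [0, tc ] t → f t ≈ 1# + A.F t
        f≈ t Dt = a-b≈0⇒a≈b (by (split Dt))
          where
          by : [0, tc ⟩ t ⊎ tc ≤ t → gap t ≈ 0#
          by (inj₁ Dt′) = gap⟨ t Dt′
          by (inj₂ tc≤t) = trans (a-b≈0⇒a≈b (∣a∣≤0⇒a≈0 (≤-trans (lipschitz gap-bl t tc Dt (0≤tc , ≤-refl))
              (≤-reflexive (trans (*-congˡ (trans (∣∣-cong (trans (+-congʳ (≤-antisym (proj₂ Dt) tc≤t)) (-‿inverseʳ tc))) (0≤⇒∣∣≈ ≤-refl))) (zeroʳ _))))))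
            (lipschitz-vanishes-at-end 0<tc gap-bl gap⟨)

      isF : IsF [0, tc ] f
      isF = f-0 , f-deriv

      -- The difference of two solutions solves a linear equation with coefficient -x² (φ + f). No
      -- sign of φ is known beforehand, but φ is decreasing, so -φ ≤ -φ(tc) ≤ ∣φ(tc)∣ bounds the
      -- coefficient above.
      f-unique : ∀ φ → IsF [0, tc ] φ → EqualOn [0, tc ] φ f
      f-unique φ (φ0 , φ′) t (0≤t , t≤tc) = a-b≈0⇒a≈b (linear-ode-unique {K = ∣ φ tc ∣} {y = λ u → φ u - f u} {a = λ u → - (q u * (φ u + f u))} 0≤t
          (trans (+-cong φ0 (-‿cong f-0)) (-‿inverseʳ 1#))
          (λ u Du → deriv-⊆ sub (deriv-cong
            (solve 3 (λ q φ f → (:- (q :* φ :^ 2) :- (:1 :- q)) :- (:- (q :* f :^ 2) :- (:1 :- q)) := :- (q :* (φ :+ f)) :* (φ :- f)) refl (q u) (φ u) (f u))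
            (deriv-- (φ′ u (sub u Du)) (f-deriv u (sub u Du)))))
          (λ u Du → ≤-by (0≤1-q (proj₁ Du) ⊗ 0≤∣∣ (φ tc) ⊕ 0≤q u ⊗ 0≤diff (-φ≤ u (sub u Du)) ⊕ 0≤q u ⊗ 0≤f (sub u Du))
            (solve 4 (λ q K φ f → K :- :- (q :* (φ :+ f)) := (:1 :- q) :* K :+ q :* (K :- :- φ) :+ q :* f) refl (q u) ∣ φ tc ∣ (φ u) (f u))))
        where
        sub : ∀ u → [0, t ] u → [0, tc ] u
        sub u (0≤u , u≤t) = 0≤u , ≤-trans u≤t t≤tc
        -φ≤ : ∀ u → [0, tc ] u → - φ u ≤ ∣ φ tc ∣
        -φ≤ u Du = ≤-trans (neg-mono-≤ (decreasing [0,]-convex φ′ Du (0≤tc , ≤-refl) (proj₂ Du) λ v u≤v _ →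
            ≤-respʳ-≈ (solve 2 (λ q r → q :* r :+ (:1 :- q) := :- (:- (q :* r) :- (:1 :- q))) refl (q v) (φ v ^ 2))
              (0≤q v ⊗ 0≤^2 (φ v) ⊕ 0≤1-q (≤-trans (proj₁ Du) u≤v))))
          (-a≤∣a∣ (φ tc))

    -- The functions g and n, by variation of constants.

    opaque
      qf-bl : BoundedLipschitz [0, tc ] (λ u → x u ^ 2 * f u)
      qf-bl = bl-* q-bl f-bl

    module I = Antiderivative 0≤tc qf-bl

    G : Carrier → Carrier
    G t = fromℕ 3 * I.F t

    opaque
      I-bl : BoundedLipschitz [0, tc ] I.F
      I-bl = bl-deriv {d = λ u → x u ^ 2 * f u} (M qf-bl) 0≤tc (0≤M qf-bl) I.F-deriv (bounded qf-bl)

      G-bl : BoundedLipschitz [0, tc ] G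
      G-bl = bl-* (bl-const (fromℕ 3)) I-bl

      G-deriv : ∀ t → [0, tc ] t → HasDerivative [0, tc ] G (fromℕ 3 * (x t ^ 2 * f t)) t
      G-deriv t Dt = deriv-scale (fromℕ 3) (I.F-deriv t Dt)

      j-bl : BoundedLipschitz [0, tc ] (λ u → exp (G u) * x u ^ 2 * f u ^ 3)
      j-bl = bl-* (bl-* (bl-exp G-bl) q-bl) (bl-^ 3 f-bl)

    module J = Antiderivative 0≤tc j-bl

    -- Kept in the expanded form for which the explicit formula holds by `refl`; `g≈` factors it for
    -- differentiation.
    g : Carrier → Carrier
    g t = exp (- G t) + fromℕ 3 * exp (- G t) * J.F t

    opaque
      J-bl : BoundedLipschitz [0, tc ] J.F
      J-bl = bl-deriv {d = λ u → exp (G u) * x u ^ 2 * f u ^ 3} (M j-bl) 0≤tc (0≤M j-bl) J.F-deriv (bounded j-bl)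

      g-bl : BoundedLipschitz [0, tc ] g
      g-bl = bl-+ (bl-exp (bl-neg G-bl)) (bl-* (bl-* (bl-const (fromℕ 3)) (bl-exp (bl-neg G-bl))) J-bl)

      explicitFormula : ExplicitFormula tc f g
      explicitFormula = exp , exp-isExp , G , I.F , J.F , λ t Dt →
        isIntegral qf-bl I.F-deriv I.F-0 t Dt , refl , isIntegral j-bl J.F-deriv J.F-0 t Dt , refl

      g-0 : g 0# ≈ 1#
      g-0 = trans (+-cong e≈1 (trans (*-congˡ J.F-0) (zeroʳ _))) (+-identityʳ 1#)
        where
        e≈1 : exp (- G 0#) ≈ 1#
        e≈1 = trans (exp-cong (trans (-‿cong (trans (*-congˡ I.F-0) (zeroʳ (fromℕ 3)))) (solve 0 (:- :0 := :0) refl))) exp-0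

      g≈ : ∀ t → exp (- G t) * (1# + fromℕ 3 * J.F t) ≈ g t
      g≈ t = solve 2 (λ e J → e :* (:1 :+ con (+ 3) :* J) := e :+ con (+ 3) :* e :* J) refl (exp (- G t)) (J.F t)

    g-rhs : Carrier → Carrier
    g-rhs t = fromℕ 3 * x t ^ 2 * f t ^ 3 - fromℕ 3 * x t ^ 2 * f t * g t

    opaque
      g-deriv : ∀ t → [0, tc ] t → HasDerivative [0, tc ] g (g-rhs t) t
      g-deriv t Dt = deriv-ext {h = λ t → exp (- G t) * (1# + fromℕ 3 * J.F t)} Dt (λ y _ → g≈ y) (deriv-cong
        (trans (+-congˡ (-‿cong (*-congˡ (g≈ t))))
          (solve 3 (λ q f g → con (+ 3) :* q :* f :^ 3 :- con (+ 3) :* (q :* f) :* g := con (+ 3) :* q :* f :^ 3 :- con (+ 3) :* q :* f :* g) refl (q t) (f t) (g t)))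
        (variation-of-constants {Q = G} {K = λ t → fromℕ 3 * J.F t} (M G-bl) Dt (bounded G-bl) (G-deriv t Dt)
          (deriv-cong (solve 3 (λ E q r → con (+ 3) :* (E :* q :* r) := E :* (con (+ 3) :* q :* r)) refl (exp (G t)) (q t) (f t ^ 3))
            (deriv-scale (fromℕ 3) (J.F-deriv t Dt)))))

      isG : IsG [0, tc ] f g
      isG = g-0 , g-deriv

      g-unique : ∀ z → IsG [0, tc ] f z → EqualOn [0, tc ] z g
      g-unique z (z0 , z′) t (0≤t , t≤tc) = a-b≈0⇒a≈b (linear-ode-unique {K = 0#} {y = λ u → z u - g u} {a = λ u → - (fromℕ 3 * (q u * f u))} 0≤t
          (trans (+-cong z0 (-‿cong g-0)) (-‿inverseʳ 1#))
          (λ u Du → deriv-⊆ sub (deriv-cong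
            (solve 4 (λ q f z g → (con (+ 3) :* q :* f :^ 3 :- con (+ 3) :* q :* f :* z) :- (con (+ 3) :* q :* f :^ 3 :- con (+ 3) :* q :* f :* g) :=
                :- (con (+ 3) :* (q :* f)) :* (z :- g)) refl (q u) (f u) (z u) (g u))
            (deriv-- (z′ u (sub u Du)) (g-deriv u (sub u Du)))))
          (λ u Du → ≤-by (0≤fromℕ 3 ⊗ (0≤q u ⊗ 0≤f (sub u Du))) (solve 1 (λ a → :0 :- :- a := a) refl (fromℕ 3 * (q u * f u)))))
        where
        sub : ∀ u → [0, t ] u → [0, tc ] u
        sub u (0≤u , u≤t) = 0≤u , ≤-trans u≤t t≤tc

      0<g : ∀ {t} → [0, tc ] t → 0# < g t
      0<g {t} Dt = <-respʳ (g≈ t) (0<* (0<exp (- G t)) (0<+ˡ 0<1 (0≤fromℕ 3 ⊗ 0≤J)))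
        where
        0≤J : 0# ≤ J.F t
        0≤J = ≤-respˡ-≈ J.F-0 (increasing [0,]-convex J.F-deriv (≤-refl , 0≤tc) Dt (proj₁ Dt) λ u 0≤u u≤t →
          proj₁ (0<exp (G u)) ⊗ 0≤q u ⊗ 0≤^ 3 (0≤f (0≤u , ≤-trans u≤t (proj₂ Dt))))

    -- Dividing the equation of n f by f leaves these terms. The first 18 is 6 · 3, from 6 g g′ = (3
    -- g²)′ and the term 3 x² f³ of g′. The coefficient 3 of x² g² is 18 - 15, where 15 is 5 · 3
    -- from (s₂⁵)′. The coefficient 4 of the damping term x² f n is 5 - 1, with 1 coming from n f′.
    n-source : Carrier → Carrier
    n-source t = fromℕ 7 * x t ^ 2 * f t ^ 4 - fromℕ 18 * x t ^ 2 * f t ^ 2 * g t + fromℕ 3 * x t ^ 2 * g t ^ 2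

    4I : Carrier → Carrier
    4I t = fromℕ 4 * I.F t

    opaque
      4I-bl : BoundedLipschitz [0, tc ] 4I
      4I-bl = bl-* (bl-const (fromℕ 4)) I-bl

      k-bl : BoundedLipschitz [0, tc ] (λ u → exp (4I u) * n-source u)
      k-bl = bl-* (bl-exp 4I-bl) (bl-+ (bl-+ (bl-* (bl-* (bl-const (fromℕ 7)) q-bl) (bl-^ 4 f-bl))
          (bl-neg (bl-* (bl-* (bl-* (bl-const (fromℕ 18)) q-bl) (bl-^ 2 f-bl)) g-bl)))
        (bl-* (bl-* (bl-const (fromℕ 3)) q-bl) (bl-^ 2 g-bl)))

    module K = Antiderivative 0≤tc k-bl

    -- The constant -2 is forced by s₄(0) = 3 g(0)² + n(0) = 1.
    n : Carrier → Carrier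
    n t = exp (- 4I t) * (- fromℕ 2 + K.F t)

    opaque
      n-bl : BoundedLipschitz [0, tc ] n
      n-bl = bl-* (bl-exp (bl-neg 4I-bl)) (bl-+ (bl-const (- fromℕ 2))
        (bl-deriv {d = λ u → exp (4I u) * n-source u} (M k-bl) 0≤tc (0≤M k-bl) K.F-deriv (bounded k-bl)))

      n-0 : n 0# ≈ - fromℕ 2
      n-0 = trans (*-cong (trans (exp-cong (trans (-‿cong (trans (*-congˡ I.F-0) (zeroʳ (fromℕ 4)))) (solve 0 (:- :0 := :0) refl))) exp-0)
                          (trans (+-congˡ K.F-0) (+-identityʳ _))) (*-identityˡ _)

      n-deriv : ∀ t → [0, tc ] t → HasDerivative [0, tc ] n (n-source t - fromℕ 4 * (x t ^ 2 * f t) * n t) t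
      n-deriv t Dt = variation-of-constants {Q = 4I} {K = K.F} (M 4I-bl) Dt (bounded 4I-bl)
        (deriv-scale (fromℕ 4) (I.F-deriv t Dt)) (K.F-deriv t Dt)

    -- The solutions s₃ and s₄.

    s₃ s₄ : Carrier → Carrier
    s₃ t = g t * s₂ t ^ 3
    -- In n f s₂⁵ one factor f s₂ = 1 is already cancelled, which keeps f out of the definition.
    s₄ t = fromℕ 3 * g t ^ 2 * s₂ t ^ 5 + n t * s₂ t ^ 4

    s₂-rhs : Carrier → Carrier
    s₂-rhs t = x t ^ 2 + (1# - x t ^ 2) * s₂ t ^ 2

    opaque
      isS₃ : IsS₃ [0, tc ⟩ s₂ s₃
      isS₃ = trans (*-cong g-0 (*-cong (proj₁ isS₂) (*-cong (proj₁ isS₂) (*-cong (proj₁ isS₂) refl)))) (solve 0 (:1 :* (:1 :* (:1 :* (:1 :* :1))) := :1) refl)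
           , λ t Dt → deriv-cong
               -- With r = f s₂ the two sides differ by 3 x² (r³ - 1) - 3 x² g s₂² (r - 1); the
               -- cofactor is the quotient by r - 1.
               (≈-by-relation (fromℕ 3 * q t * ((f t * s₂ t) ^ 2 + f t * s₂ t + 1#) - fromℕ 3 * q t * g t * s₂ t ^ 2) (fs₂≈1 t Dt)
                 (solve 4 (λ q f g s →
                     ((con (+ 3) :* q :* f :^ 3 :- con (+ 3) :* q :* f :* g) :* s :^ 3 :+ g :* (con (+ 3) :* s :^ 2 :* (q :+ (:1 :- q) :* s :^ 2)))
                       :- (con (+ 3) :* q :+ con (+ 3) :* (:1 :- q) :* s :* (g :* s :^ 3)) :=
                     (f :* s :- :1) :* (con (+ 3) :* q :* ((f :* s) :^ 2 :+ f :* s :+ :1) :- con (+ 3) :* q :* g :* s :^ 2))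
                   refl (q t) (f t) (g t) (s₂ t)))
               (deriv-* (deriv-⊆ ⟨⊆] (g-deriv t (⟨⊆] t Dt))) (deriv-^ 2 (proj₂ isS₂ t Dt)))

      s₄-0 : s₄ 0# ≈ 1#
      s₄-0 = trans (+-cong (*-cong (*-congˡ (*-cong g-0 (*-cong g-0 refl))) (^-cong 5)) (*-cong n-0 (^-cong 4)))
        (solve 0 (con (+ 3) :* :1 :^ 2 :* :1 :^ 5 :+ :- con (+ 2) :* :1 :^ 4 := :1) refl)
        where
        ^-cong : ∀ k → s₂ 0# ^ k ≈ 1# ^ k
        ^-cong zero    = refl
        ^-cong (suc k) = *-cong (proj₁ isS₂) (^-cong k)

      s₄-deriv : ∀ t → [0, tc ⟩ t → HasDerivative [0, tc ⟩ s₄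
        (fromℕ 7 * x t ^ 2 + (1# - x t ^ 2) * (fromℕ 4 * s₂ t * s₄ t + fromℕ 3 * s₃ t ^ 2)) t
      s₄-deriv t Dt = deriv-cong
        -- The terms with 1 - x² cancel identically. With r = f s₂ the others group into 7 (r⁴ - 1),
        -- 18 g s₂² (r³ - r²), -18 g² s₂⁴ (r - 1) and -4 n s₂³ (r - 1), all times x².
        (≈-by-relation
          (q t * (fromℕ 18 * g t * s₂ t ^ 2 * (f t * s₂ t) ^ 2 - fromℕ 18 * g t ^ 2 * s₂ t ^ 4
            + fromℕ 7 * ((f t * s₂ t) ^ 3 + (f t * s₂ t) ^ 2 + f t * s₂ t + 1#) - fromℕ 4 * n t * s₂ t ^ 3))
          (fs₂≈1 t Dt)
          (solve 5 (λ q f g n s →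
              let s′ = q :+ (:1 :- q) :* s :^ 2
                  g′ = con (+ 3) :* q :* f :^ 3 :- con (+ 3) :* q :* f :* g
                  n′ = (con (+ 7) :* q :* f :^ 4 :- con (+ 18) :* q :* f :^ 2 :* g :+ con (+ 3) :* q :* g :^ 2) :- con (+ 4) :* (q :* f) :* n
                  r  = f :* s
              in ((con (+ 3) :* (con (+ 2) :* g :^ 1 :* g′) :* s :^ 5 :+ con (+ 3) :* g :^ 2 :* (con (+ 5) :* s :^ 4 :* s′))
                   :+ (n′ :* s :^ 4 :+ n :* (con (+ 4) :* s :^ 3 :* s′)))
                 :- (con (+ 7) :* q :+ (:1 :- q) :* (con (+ 4) :* s :* (con (+ 3) :* g :^ 2 :* s :^ 5 :+ n :* s :^ 4) :+ con (+ 3) :* (g :* s :^ 3) :^ 2)) :=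
                 (r :- :1) :* (q :* (con (+ 18) :* g :* s :^ 2 :* r :^ 2 :- con (+ 18) :* g :^ 2 :* s :^ 4
                   :+ con (+ 7) :* (r :^ 3 :+ r :^ 2 :+ r :+ :1) :- con (+ 4) :* n :* s :^ 3)))
            refl (q t) (f t) (g t) (n t) (s₂ t)))
        (deriv-+ {h = λ t → fromℕ 3 * g t ^ 2 * s₂ t ^ 5} {k = λ t → n t * s₂ t ^ 4}
          (deriv-* {h = λ t → fromℕ 3 * g t ^ 2} {k = λ t → s₂ t ^ 5} (deriv-scale (fromℕ 3) (deriv-^ 1 g′)) (deriv-^ 4 s₂′))
          (deriv-* {h = n} {k = λ t → s₂ t ^ 4} (deriv-⊆ ⟨⊆] (n-deriv t (⟨⊆] t Dt))) (deriv-^ 3 s₂′)))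
        where
        g′ : HasDerivative [0, tc ⟩ g (g-rhs t) t
        g′ = deriv-⊆ ⟨⊆] (g-deriv t (⟨⊆] t Dt))
        s₂′ : HasDerivative [0, tc ⟩ s₂ (s₂-rhs t) t
        s₂′ = proj₂ isS₂ t Dt

      isS₄ : IsS₄ [0, tc ⟩ s₂ s₃ s₄
      isS₄ = s₄-0 , s₄-deriv

    -- Uniqueness on [0, tc).

    module _ {T : Carrier} (DT : [0, tc ⟩ T) where
      ⊆⟨ : ∀ u → [0, T ] u → [0, tc ⟩ u
      ⊆⟨ u (0≤u , u≤T) = 0≤u , ≤-<-trans u≤T (proj₂ DT)

      [1-q]*c≤ : ∀ {c C u} → [0, T ] u → c ≤ C → 0# ≤ C → (1# - q u) * c ≤ C
      [1-q]*c≤ {c} {C} {u} Du c≤C 0≤C = ≤-by (0≤1-q (proj₁ Du) ⊗ 0≤diff c≤C ⊕ 0≤q u ⊗ 0≤C)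
        (solve 3 (λ q c C → C :- (:1 :- q) :* c := (:1 :- q) :* (C :- c) :+ q :* C) refl (q u) c C)

      s₂≤s₂T : ∀ z → IsS₂ [0, tc ⟩ z → ∀ {u} → [0, T ] u → z u ≤ z T
      s₂≤s₂T z isz Du = s₂-mono z isz (⊆⟨ _ Du) DT (proj₂ Du)

    opaque
      -- The linear coefficient z + s₂ is not bounded on [0, tc), so the Grönwall argument runs on
      -- [0, t] for each single t. There both solutions are at most their values at t, by
      -- monotonicity.
      s₂-unique : ∀ z → IsS₂ [0, tc ⟩ z → EqualOn [0, tc ⟩ z s₂
      s₂-unique z isz@(z0 , z′) t Dt = a-b≈0⇒a≈b (linear-ode-unique {K = z t + s₂ t} {y = λ u → z u - s₂ u} {a = λ u → (1# - q u) * (z u + s₂ u)} (proj₁ Dt)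
        (trans (+-cong z0 (-‿cong (proj₁ isS₂))) (-‿inverseʳ 1#))
        (λ u Du → deriv-⊆ (⊆⟨ Dt) (deriv-cong
          (solve 3 (λ q z s → (q :+ (:1 :- q) :* z :^ 2) :- (q :+ (:1 :- q) :* s :^ 2) := (:1 :- q) :* (z :+ s) :* (z :- s)) refl (q u) (z u) (s₂ u))
          (deriv-- (z′ u (⊆⟨ Dt u Du)) (proj₂ isS₂ u (⊆⟨ Dt u Du)))))
        (λ u Du → [1-q]*c≤ Dt Du (+-mono-≤ (s₂≤s₂T Dt z isz Du) (s₂≤s₂T Dt s₂ isS₂ Du))
          (≤-trans 0≤1 (1≤s₂ z isz Dt) ⊕ proj₁ (0<s₂ Dt))))

      s₃-unique : ∀ z → IsS₃ [0, tc ⟩ s₂ z → EqualOn [0, tc ⟩ z s₃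
      s₃-unique z (z0 , z′) t Dt = a-b≈0⇒a≈b (linear-ode-unique {K = fromℕ 3 * s₂ t} {y = λ u → z u - s₃ u} {a = λ u → (1# - q u) * (fromℕ 3 * s₂ u)} (proj₁ Dt)
        (trans (+-cong z0 (-‿cong (proj₁ isS₃))) (-‿inverseʳ 1#))
        (λ u Du → deriv-⊆ (⊆⟨ Dt) (deriv-cong
          (solve 4 (λ q s z w → (con (+ 3) :* q :+ con (+ 3) :* (:1 :- q) :* s :* z) :- (con (+ 3) :* q :+ con (+ 3) :* (:1 :- q) :* s :* w) :=
              (:1 :- q) :* (con (+ 3) :* s) :* (z :- w)) refl (q u) (s₂ u) (z u) (s₃ u))
          (deriv-- {k = s₃} (z′ u (⊆⟨ Dt u Du)) (proj₂ isS₃ u (⊆⟨ Dt u Du)))))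
        (λ u Du → [1-q]*c≤ Dt Du (*-monoˡ-≤ (0≤fromℕ 3) (s₂≤s₂T Dt s₂ isS₂ Du)) (0≤fromℕ 3 ⊗ proj₁ (0<s₂ Dt))))

      s₄-unique : ∀ z → IsS₄ [0, tc ⟩ s₂ s₃ z → EqualOn [0, tc ⟩ z s₄
      s₄-unique z (z0 , z′) t Dt = a-b≈0⇒a≈b (linear-ode-unique {K = fromℕ 4 * s₂ t} {y = λ u → z u - s₄ u} {a = λ u → (1# - q u) * (fromℕ 4 * s₂ u)} (proj₁ Dt)
        (trans (+-cong z0 (-‿cong s₄-0)) (-‿inverseʳ 1#))
        (λ u Du → deriv-⊆ (⊆⟨ Dt) (deriv-cong
          (solve 5 (λ q s r z w → (con (+ 7) :* q :+ (:1 :- q) :* (con (+ 4) :* s :* z :+ con (+ 3) :* r)) :- (con (+ 7) :* q :+ (:1 :- q) :* (con (+ 4) :* s :* w :+ con (+ 3) :* r)) :=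
              (:1 :- q) :* (con (+ 4) :* s) :* (z :- w)) refl (q u) (s₂ u) (s₃ u ^ 2) (z u) (s₄ u))
          (deriv-- {k = s₄} (z′ u (⊆⟨ Dt u Du)) (s₄-deriv u (⊆⟨ Dt u Du)))))
        (λ u Du → [1-q]*c≤ Dt Du (*-monoˡ-≤ (0≤fromℕ 4) (s₂≤s₂T Dt s₂ isS₂ Du)) (0≤fromℕ 4 ⊗ proj₁ (0<s₂ Dt))))

    -- Asymptotics at tc

    -- The quantitative form u = 1 + O(tc - t). It is stable under products, powers and inverses and
    -- yields both `Asymptotic` and `PowerLaw`.
    Near1 : (Carrier → Carrier) → Set
    Near1 u = Σ Carrier λ C → 0# ≤ C × EventuallyBelow tc (λ t → ∣ u t - 1# ∣ ≤ C * (tc - t))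

    opaque
      0≤τ : ∀ {t} → [0, tc ⟩ t → 0# ≤ tc - t
      0≤τ Dt = 0≤diff (proj₁ (proj₂ Dt))

      0<τ : ∀ {t} → [0, tc ⟩ t → 0# < tc - t
      0<τ Dt = <⇒0<diff (proj₂ Dt)

      near1-* : ∀ {u v} → Near1 u → Near1 v → Near1 (λ t → u t * v t)
      near1-* {u} {v} (C , 0≤C , δ , 0<δ , H) (C′ , 0≤C′ , δ′ , 0<δ′ , H′) =
        let δ″ , 0<δ″ , ≤δ , ≤δ′ = min⁺ 0<δ 0<δ′ in
        -- From uv - 1 = (u - 1)(v - 1) + (u - 1) + (v - 1), where the quadratic error is made
        -- linear by tc - t ≤ tc.
        C * C′ * tc + C + C′ , 0≤C ⊗ 0≤C′ ⊗ 0≤tc ⊕ 0≤C ⊕ 0≤C′ , δ″ , 0<δ″ , λ t Dt near →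
          let h = H t Dt (<-≤-trans near ≤δ)
              h′ = H′ t Dt (<-≤-trans near ≤δ′)
          in ≤-respˡ-≈ (∣∣-cong (solve 2 (λ u v → (u :- :1) :* (v :- :1) :+ (u :- :1) :+ (v :- :1) := u :* v :- :1) refl (u t) (v t)))
            (≤-trans (∣a+b∣≤ _ _) (≤-trans (+-mono-≤ (≤-trans (∣a+b∣≤ _ _) (+-mono-≤ (∣ab∣≤ h h′) h)) h′)
              (≤-by (0≤C ⊗ 0≤C′ ⊗ 0≤τ Dt ⊗ proj₁ Dt)
                (solve 4 (λ C C′ T t → (C :* C′ :* T :+ C :+ C′) :* (T :- t) :- ((C :* (T :- t)) :* (C′ :* (T :- t)) :+ C :* (T :- t) :+ C′ :* (T :- t)) :=
                  C :* C′ :* (T :- t) :* t) refl C C′ tc t))))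

      near1-^ : ∀ {u} k → Near1 u → Near1 (λ t → u t ^ suc k)
      near1-^ {u} zero (C , 0≤C , δ , 0<δ , H) = C , 0≤C , δ , 0<δ , λ t Dt near → ≤-respˡ-≈ (∣∣-cong (+-congʳ (sym (*-identityʳ (u t))))) (H t Dt near)
      near1-^ (suc k) U = near1-* U (near1-^ k U)

      -- Close to `tc` the error is at most ½, hence u ≥ ½ and 1 / u ≤ 2; so ∣1 / u - 1∣ = ∣1 - u∣ /
      -- u at most doubles the constant.
      near1-⁻¹ : ∀ {u} → Near1 u → Near1 (λ t → u t ⁻¹)
      near1-⁻¹ {u} (C , 0≤C , δ , 0<δ , H) =
        let ε , 0<ε , Cε≤½ = shrink 0≤C 0<½
            δ′ , 0<δ′ , ≤δ , ≤ε = min⁺ 0<δ 0<ε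
        in 2# * C , proj₁ 0<2 ⊗ 0≤C , δ′ , 0<δ′ , λ t Dt near →
          estimate t (H t Dt (<-≤-trans near ≤δ)) (≤-trans (*-monoˡ-≤ 0≤C (≤-trans (proj₁ near) ≤ε)) Cε≤½)
        where
        estimate : ∀ t → ∣ u t - 1# ∣ ≤ C * (tc - t) → C * (tc - t) ≤ ½ → ∣ u t ⁻¹ - 1# ∣ ≤ 2# * C * (tc - t)
        estimate t ∣u-1∣≤ ≤½ = ≤-respˡ-≈ (∣∣-cong (trans (solve 2 (λ u i → (:1 :- u) :* i := i :- u :* i) refl (u t) (u t ⁻¹)) (+-congˡ (-‿cong ui≈1))))
            (≤-trans (∣ab∣≤ (≤-respˡ-≈ (∣a-b∣≈∣b-a∣ (u t) 1#) ∣u-1∣≤) (≤-respˡ-≈ (sym (0≤⇒∣∣≈ (proj₁ 0<i))) i≤2))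
              (≤-reflexive (solve 3 (λ t C z → C :* z :* t := t :* C :* z) refl 2# C (tc - t))))
          where
          ½≤u : ½ ≤ u t
          ½≤u = ≤-by (0≤diff ≤½ ⊕ 0≤diff (≤-trans (-a≤∣a∣ _) ∣u-1∣≤))
            (trans (solve 3 (λ u h m → u :- h := (:1 :- h :- h) :+ (h :- m) :+ (m :- :- (u :- :1))) refl (u t) ½ (C * (tc - t)))
              (+-congʳ (trans (+-congʳ (trans (solve 1 (λ h → :1 :- h :- h := :1 :- :2 :* h) refl ½) (trans (+-congˡ (-‿cong 2½≈1)) (-‿inverseʳ 1#)))) (+-identityˡ _))))
          0<u : 0# < u t
          0<u = <-≤-trans 0<½ ½≤u
          ui≈1 : u t * u t ⁻¹ ≈ 1#
          ui≈1 = *-inverse-pos 0<u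
          0<i : 0# < u t ⁻¹
          0<i = 0<⁻¹ 0<u
          i≤2 : u t ⁻¹ ≤ 2#
          i≤2 = ≤-by (proj₁ 0<2 ⊗ (0≤diff ½≤u ⊗ proj₁ 0<i))
            (trans (+-cong (sym (trans (*-congˡ ui≈1) (*-identityʳ 2#))) (-‿cong (sym (trans (*-congʳ 2½≈1) (*-identityˡ (u t ⁻¹))))))
              (solve 4 (λ t u h i → t :* (u :* i) :- (t :* h) :* i := t :* ((u :- h) :* i)) refl 2# (u t) ½ (u t ⁻¹)))

      near1-lipschitz : ∀ {k γ} → BoundedLipschitz [0, tc ] k → k tc ≈ γ → 0# < γ → Near1 (λ t → k t * γ ⁻¹)
      near1-lipschitz {k} {γ} K k≈γ 0<γ = L K * γ ⁻¹ , 0≤L K ⊗ proj₁ (0<⁻¹ 0<γ) , 1# , 0<1 , λ t Dt _ → ≤-respˡ-≈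
        (∣∣-cong (trans (*-congʳ (+-congˡ (-‿cong k≈γ))) (trans (solve 3 (λ k γ i → (k :- γ) :* i := k :* i :- γ :* i) refl (k t) γ (γ ⁻¹)) (+-congˡ (-‿cong (*-inverse-pos 0<γ))))))
        (≤-trans (∣ab∣≤ (lipschitz K t tc (⟨⊆] t Dt) (0≤tc , ≤-refl)) (≤-reflexive (0≤⇒∣∣≈ (proj₁ (0<⁻¹ 0<γ)))))
          (≤-reflexive (trans (*-congʳ (*-congˡ (trans (∣a-b∣≈∣b-a∣ t tc) (0≤⇒∣∣≈ (0≤τ Dt)))))
            (solve 3 (λ L z i → L :* z :* i := L :* i :* z) refl (L K) (tc - t) (γ ⁻¹)))))

      near1⇒powerLaw : ∀ {h u γ} p → Near1 u → (∀ t → [0, tc ⟩ t → h t ≈ pole tc γ p t * u t) → PowerLaw tc p γ h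
      near1⇒powerLaw {u = u} p (C , _ , δ , 0<δ , H) h≈ = (λ t → u t - 1#) , C , δ , 0<δ , λ t Dt near →
        trans (h≈ t Dt) (*-congˡ (solve 1 (λ u → u := :1 :+ (u :- :1)) refl (u t))) , H t Dt near

      near1⇒asymptotic : ∀ {a c u} → Near1 u → (∀ t → [0, tc ⟩ t → a t ≈ c t * u t) → (∀ t → [0, tc ⟩ t → 0# < c t) → Asymptotic tc a c
      near1⇒asymptotic {a} {c} {u} (C , 0≤C , δ , 0<δ , H) a≈ 0<c ε 0<ε =
        let ε′ , 0<ε′ , Cε′≤ = shrink 0≤C (0<* 0<½ 0<ε)
            δ′ , 0<δ′ , ≤δ , ≤ε′ = min⁺ 0<δ 0<ε′
        in δ′ , 0<δ′ , λ t Dt near → ≤-<-trans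
          (≤-respˡ-≈ (∣∣-cong (+-congʳ (sym (quotient t Dt))))
            (≤-trans (H t Dt (<-≤-trans near ≤δ)) (≤-trans (*-monoˡ-≤ 0≤C (≤-trans (proj₁ near) ≤ε′)) Cε′≤)))
          (½<1 0<ε)
        where
        quotient : ∀ t → [0, tc ⟩ t → a t * c t ⁻¹ ≈ u t
        quotient t Dt = trans (*-congʳ (a≈ t Dt)) (trans (solve 3 (λ c u i → c :* u :* i := (c :* i) :* u) refl (c t) (u t) (c t ⁻¹))
          (trans (*-congʳ (*-inverse-pos (0<c t Dt))) (*-identityˡ (u t))))

      0<^ : ∀ {a} k → 0# < a → 0# < a ^ k
      0<^ zero    0<a = 0<1
      0<^ (suc k) 0<a = 0<* 0<a (0<^ k 0<a)

      ^-cong : ∀ {a b} k → a ≈ b → a ^ k ≈ b ^ k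
      ^-cong zero    a≈b = refl
      ^-cong (suc k) a≈b = *-cong a≈b (^-cong k a≈b)

      [ab]^ : ∀ a b k → (a * b) ^ k ≈ a ^ k * b ^ k
      [ab]^ a b zero    = sym (*-identityʳ 1#)
      [ab]^ a b (suc k) = trans (*-congˡ ([ab]^ a b k)) (solve 4 (λ a b p q → a :* b :* (p :* q) := a :* p :* (b :* q)) refl a b (a ^ k) (b ^ k))

      ^-⁻¹ : ∀ {a} k → 0# < a → a ⁻¹ ^ k ≈ (a ^ k) ⁻¹
      ^-⁻¹ {a} k 0<a = ⁻¹-unique (trans (sym ([ab]^ a (a ⁻¹) k)) (trans (^-cong k (*-inverse-pos 0<a)) (1^ k)))
        where
        1^ : ∀ k → 1# ^ k ≈ 1#
        1^ zero    = refl
        1^ (suc k) = trans (*-identityˡ _) (1^ k)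

      0<pole : ∀ {γ t} p → 0# < γ → [0, tc ⟩ t → 0# < pole tc γ p t
      0<pole p 0<γ Dt = 0<* 0<γ (0<⁻¹ (0<^ p (0<τ Dt)))

    -- The quotient of f by its tangent κ (tc - t) at `tc`.
    ρ : Carrier → Carrier
    ρ t = f t * (α * (tc - t) ⁻¹)

    opaque
      -- At `tc` the value of f is 0 and its slope is -κ, so the Taylor estimate bounds f - κ (tc -
      -- t) by L (tc - t)². Since κ > 0 the zero is simple, and dividing by κ (tc - t) leaves a
      -- relative error of first order.
      near1-ρ : Near1 ρ
      near1-ρ = L f-rhs-bl * α , 0≤L f-rhs-bl ⊗ proj₁ 0<α , 1# , 0<1 , λ t Dt _ →
        let i  = (tc - t) ⁻¹
            τi = *-inverse-pos (0<τ Dt)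
            ∣τ∣ = trans (∣a-b∣≈∣b-a∣ t tc) (0≤⇒∣∣≈ (0≤τ Dt))
        in ≤-respˡ-≈
          (∣∣-cong (trans (*-congʳ (expand t))
            (trans (solve 5 (λ f κ τ α i → (f :- κ :* τ) :* (α :* i) := f :* (α :* i) :- (κ :* α) :* (τ :* i)) refl (f t) κ (tc - t) α i)
              (+-congˡ (-‿cong (trans (*-cong (*-inverse-pos 0<κ) τi) (*-identityʳ 1#)))))))
          (≤-trans (∣ab∣≤ (taylor-∣∣ [0,]-convex f-deriv (0≤L f-rhs-bl) (lipschitz f-rhs-bl) (0≤tc , ≤-refl) (⟨⊆] t Dt))
              (≤-reflexive (0≤⇒∣∣≈ (proj₁ 0<α ⊗ proj₁ (0<⁻¹ (0<τ Dt))))))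
            (≤-reflexive (trans (*-congʳ (*-congˡ (*-cong ∣τ∣ ∣τ∣)))
              (trans (solve 4 (λ L α τ i → L :* (τ :* τ) :* (α :* i) := L :* α :* τ :* (τ :* i)) refl (L f-rhs-bl) α (tc - t) i)
                (trans (*-congˡ τi) (*-identityʳ _))))))
        where
        expand : ∀ t → (f t - f tc) - f-rhs tc * (t - tc) ≈ f t - κ * (tc - t)
        expand t = trans (+-cong (+-congˡ (-‿cong f-tc)) (-‿cong (*-congʳ (+-congʳ (-‿cong (*-congˡ (*-congʳ f-tc)))))))
          -- Here e is the second factor of f(tc)², left as it stands because the first is already
          -- 0.
          (solve 5 (λ f e q t T → (f :- :0) :- (:- (q :* (:0 :* e)) :- (:1 :- q)) :* (t :- T) := f :- (:1 :- q) :* (T :- t)) refl (f t) (f tc * 1#) (x tc ^ 2) t tc)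

      near1-ρ⁻¹ : Near1 (λ t → ρ t ⁻¹)
      near1-ρ⁻¹ = near1-⁻¹ near1-ρ

      s₂-factor : ∀ t → [0, tc ⟩ t → s₂ t ≈ α * (tc - t) ⁻¹ * ρ t ⁻¹
      s₂-factor t Dt = trans (sym (trans (*-congˡ (*-inverse-pos 0<ρ)) (*-identityʳ (s₂ t))))
        (trans (solve 4 (λ s f a r → s :* ((f :* a) :* r) := (s :* f) :* (a :* r)) refl (s₂ t) (f t) (α * (tc - t) ⁻¹) (ρ t ⁻¹))
          (trans (*-congʳ (s₂f≈1 t Dt)) (*-identityˡ _)))
        where
        0<ρ : 0# < ρ t
        0<ρ = 0<* (0<f Dt) (0<* 0<α (0<⁻¹ (0<τ Dt)))

      s₂^-factor : ∀ k γ t → [0, tc ⟩ t → γ * s₂ t ^ k ≈ pole tc (γ * α ^ k) k t * (ρ t ⁻¹) ^ k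
      s₂^-factor k γ t Dt = trans (*-congˡ (trans (^-cong k (s₂-factor t Dt)) (trans ([ab]^ _ _ k) (*-congʳ (trans ([ab]^ _ _ k) (*-congˡ (^-⁻¹ k (0<τ Dt))))))))
        (solve 4 (λ γ a i r → γ :* (a :* i :* r) := γ :* a :* i :* r) refl γ (α ^ k) (((tc - t) ^ k) ⁻¹) ((ρ t ⁻¹) ^ k))

    β : Carrier
    β = g tc

    γ₄ : Carrier
    γ₄ = fromℕ 3 * β ^ 2

    opaque
      0<β : 0# < β
      0<β = 0<g (0≤tc , ≤-refl)

      0<γ₄ : 0# < γ₄
      -- The index is one less than the numeral: `0<fromℕ 2` is the positivity of 3.
      0<γ₄ = 0<* (0<fromℕ 2) (0<^ 2 0<β)

      ĝ-near1 : Near1 (λ t → g t * β ⁻¹)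
      ĝ-near1 = near1-lipschitz g-bl refl 0<β

      -- At `tc` the correction n f vanishes, so the limit is 3 β² whatever value n has there.
      m-near1 : Near1 (λ t → (fromℕ 3 * g t ^ 2 + n t * f t) * γ₄ ⁻¹)
      m-near1 = near1-lipschitz (bl-+ (bl-* (bl-const (fromℕ 3)) (bl-^ 2 g-bl)) (bl-* n-bl f-bl))
        (trans (+-congˡ (trans (*-congˡ f-tc) (zeroʳ _))) (+-identityʳ _)) 0<γ₄

      s₃-factor : ∀ t → [0, tc ⟩ t → s₃ t ≈ β * s₂ t ^ 3 * (g t * β ⁻¹)
      s₃-factor t Dt = trans (*-congʳ (sym (trans (*-congˡ (*-inverse-pos 0<β)) (*-identityʳ (g t)))))
        (solve 4 (λ g β i p → g :* (β :* i) :* p := β :* p :* (g :* i)) refl (g t) β (β ⁻¹) (s₂ t ^ 3))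

      -- Multiplying the lower-order term n s₂⁴ by f s₂ = 1 brings it to the common power s₂⁵, with
      -- the vanishing coefficient n f.
      s₄-factor : ∀ t → [0, tc ⟩ t → s₄ t ≈ γ₄ * s₂ t ^ 5 * ((fromℕ 3 * g t ^ 2 + n t * f t) * γ₄ ⁻¹)
      s₄-factor t Dt = trans (sym (+-congˡ (trans (*-congʳ (fs₂≈1 t Dt)) (*-identityˡ _))))
        (trans (solve 4 (λ g n f s → con (+ 3) :* g :^ 2 :* s :^ 5 :+ (f :* s) :* (n :* s :^ 4) := (con (+ 3) :* g :^ 2 :+ n :* f) :* s :^ 5) refl (g t) (n t) (f t) (s₂ t))
          (trans (*-congʳ (sym (trans (*-congˡ (*-inverse-pos 0<γ₄)) (*-identityʳ _))))
            (solve 4 (λ m γ i p → m :* (γ :* i) :* p := γ :* p :* (m :* i)) refl (fromℕ 3 * g t ^ 2 + n t * f t) γ₄ (γ₄ ⁻¹) (s₂ t ^ 5))))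

      s₂-pole : ∀ t → [0, tc ⟩ t → s₂ t ≈ pole tc α 1 t * ρ t ⁻¹
      s₂-pole t Dt = trans (s₂-factor t Dt) (*-congʳ (*-congˡ (⁻¹-cong (sym (*-identityʳ (tc - t))))))

      -- Two relative errors multiply: that of u and that of s₂ against its pole, raised to the
      -- exponent. As in `near1-^`, k is one less than the exponent.
      via-s₂ : ∀ {h u} k γ → (∀ t → [0, tc ⟩ t → h t ≈ γ * s₂ t ^ suc k * u t) → Near1 u → PowerLaw tc (suc k) (γ * α ^ suc k) h
      via-s₂ {h} {u} k γ h≈ U = near1⇒powerLaw (suc k) (near1-* (near1-^ k near1-ρ⁻¹) U) λ t Dt →
        trans (h≈ t Dt) (trans (*-congʳ (s₂^-factor (suc k) γ t Dt)) (*-assoc (pole tc (γ * α ^ suc k) (suc k) t) _ (u t)))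

      s₂^-asymptotic : ∀ k γ → 0# < γ → Asymptotic tc (λ t → γ * s₂ t ^ suc k) (pole tc (γ * α ^ suc k) (suc k))
      s₂^-asymptotic k γ 0<γ = near1⇒asymptotic (near1-^ k near1-ρ⁻¹) (s₂^-factor (suc k) γ)
        (λ t Dt → 0<pole (suc k) (0<* 0<γ (0<^ (suc k) 0<α)) Dt)

      s₂-nonzero : ∀ t → [0, tc ⟩ t → ¬ (s₂ t ≈ 0#) × f t ≈ s₂ t ⁻¹
      s₂-nonzero t Dt = 0<⇒≉0 (0<s₂ Dt) , f-below (proj₂ Dt)

      0<γs₂^ : ∀ k {γ} → 0# < γ → ∀ t → [0, tc ⟩ t → 0# < γ * s₂ t ^ k
      0<γs₂^ k 0<γ t Dt = 0<* 0<γ (0<^ k (0<s₂ Dt))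

theorem3p1 :
  ExcludedMiddle 0ℓ →
  (ℝ : CompleteOrderedField) →
  let open Analysis ℝ in
  (x : Carrier → Carrier) →
  let open Equations x in
  IsX →
  (tc : Carrier) → 0# < tc →
  (s₂ : Carrier → Carrier) → IsS₂ [0, tc ⟩ s₂ → TendsTo+∞ tc s₂ →
  Σ (Carrier → Carrier) λ s₃ → Σ (Carrier → Carrier) λ s₄ →
  Σ (Carrier → Carrier) λ f → Σ (Carrier → Carrier) λ g →
  let α = (1# - x tc ^ 2) ⁻¹
      β = g tc
  in
    IsTheOn [0, tc ⟩ (IsS₂ [0, tc ⟩) s₂
  × IsTheOn [0, tc ⟩ (IsS₃ [0, tc ⟩ s₂) s₃
  × IsTheOn [0, tc ⟩ (IsS₄ [0, tc ⟩ s₂ s₃) s₄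
  × IsTheOn [0, tc ] (IsF [0, tc ]) f
  × (∀ t → [0, tc ⟩ t → ¬ (s₂ t ≈ 0#) × f t ≈ s₂ t ⁻¹)
  × f tc ≈ 0#
  × IsTheOn [0, tc ] (IsG [0, tc ] f) g
  × ExplicitFormula tc f g
  × 0# < α
  × 0# < β
  × Asymptotic tc s₂ (pole tc α 1)
  × Asymptotic tc s₃ (λ t → β * s₂ t ^ 3)
  × Asymptotic tc (λ t → β * s₂ t ^ 3) (pole tc (β * α ^ 3) 3)
  × Asymptotic tc s₄ (λ t → fromℕ 3 * β ^ 2 * s₂ t ^ 5)
  × Asymptotic tc (λ t → fromℕ 3 * β ^ 2 * s₂ t ^ 5) (pole tc (fromℕ 3 * β ^ 2 * α ^ 5) 5)
  × PowerLaw tc 1 α s₂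
  × PowerLaw tc 3 (β * α ^ 3) s₃
  × PowerLaw tc 5 (fromℕ 3 * β ^ 2 * α ^ 5) s₄
theorem3p1 em ℝ x isX tc 0<tc s₂ isS₂ s₂→∞ =
    s₃ , s₄ , f , g
  , (isS₂ , s₂-unique)
  , (isS₃ , s₃-unique)
  , (isS₄ , s₄-unique)
  , (isF , f-unique)
  , s₂-nonzero
  , f-tc
  , (isG , g-unique)
  , explicitFormula
  , 0<α
  , 0<β
  , near1⇒asymptotic near1-ρ⁻¹ s₂-pole (λ t → 0<pole 1 0<α)
  , near1⇒asymptotic ĝ-near1 s₃-factor (0<γs₂^ 3 0<β)
  , s₂^-asymptotic 2 β 0<β
  , near1⇒asymptotic m-near1 s₄-factor (0<γs₂^ 5 0<γ₄)
  , s₂^-asymptotic 4 γ₄ 0<γ₄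
  , near1⇒powerLaw 1 near1-ρ⁻¹ s₂-pole
  , via-s₂ 2 β s₃-factor ĝ-near1
  , via-s₂ 4 γ₄ s₄-factor m-near1
  where
  open RealAnalysis em ℝ
  open Explosion x isX tc 0<tc s₂ isS₂ s₂→∞
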